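{- There exist functions $h_0, h_1 : \mathbb{Z}^3 \to \mathbb{Z}$, each having finite support in the last variable for fixed values of the first two, such that for all integers $m, n \geq 0$, \[U^{(0)}\left(\frac{x^m}{(1+5x)^n}\right) = \frac{1}{(1+5x)^{5n+5}} \sum_{r \geq \lceil (m+4)/5 \rceil} h_0(m,n,r) \cdot 5^{\pi_0(m,r)} \cdot x^r,\] \[U^{(1)}\left(\frac{x^m}{(1+5x)^n}\right) = \frac{1}{(1+5x)^{5n}} \sum_{r \geq \lceil m/5 \rceil} h_1(m,n,r) \cdot 5^{\pi_1(m,r)} \cdot x^r,\] where $\pi_0(m,r) = \max\left(0, \left\lfloor \frac{5r-m+2}{7} \right\rfloor -5 \right)$ and $\pi_1(m,r) = \left\lfloor \frac{5r-m}{7} \right\rfloor$.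
   Context: All functions are treated as formal Laurent series in $q$. For $r\ge1$, $f_r = \prod_{n\ge1}(1-q^{rn})$. Let $x = q\frac{f_2 f_{10}^3}{f_1^3 f_5}$; since $x=q+O(q^2)$, $x^m/(1+5x)^n$ is a well-defined Laurent series in $q$. Let $\Phi = q^5 \frac{f_{25}f_{50}^2}{f_1f_2^2}$, let $U_5\left(\sum_{n} a(n)q^n\right) = \sum_{n} a(5n)q^n$, and define $U^{(0)}(f) = U_5(\Phi f)$ and $U^{(1)}(f) = U_5(f)$. -}

module Defs where

open import Data.Nat as ℕ using (ℕ; zero; suc; _∸_; _<_)
open import Data.Nat.DivMod using (_/_)
open import Data.Integer as ℤ using (ℤ; +_; -_; ∣_∣)
open import Data.List using (List; []; _∷_)
open import Data.Product using (∃-syntax)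
open import Relation.Binary.PropositionalEquality using (_≡_)

-- Formal power series in q with integer coefficients: n ↦ coefficient of q^n.
-- (All series in the theorem have only nonnegative powers of q, since m,n ≥ 0.)
FPS : Set
FPS = ℕ → ℤ

infix 4 _≈_
_≈_ : FPS → FPS → Set
f ≈ g = ∀ k → f k ≡ g k

constF : ℤ → FPS
constF c zero    = c
constF c (suc _) = + 0

oneF : FPS
oneF = constF (+ 1)

infixl 6 _⊕_
_⊕_ : FPS → FPS → FPS
(f ⊕ g) k = f k ℤ.+ g k

scale : ℤ → FPS → FPS
scale c f k = c ℤ.* f k

shiftQ : ℕ → FPS → FPS
shiftQ zero    f k       = f k
shiftQ (suc s) f zero    = + 0
shiftQ (suc s) f (suc k) = shiftQ s f k

cauchy : FPS → FPS → ℕ → ℕ → ℤ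
cauchy f g k zero    = f 0 ℤ.* g k
cauchy f g k (suc i) = f (suc i) ℤ.* g (k ∸ suc i) ℤ.+ cauchy f g k i

infixl 7 _⊛_
_⊛_ : FPS → FPS → FPS
(f ⊛ g) k = cauchy f g k k

pow : FPS → ℕ → FPS
pow f zero    = oneF
pow f (suc n) = f ⊛ pow f n

-- Multiplicative inverse of a series with constant term 1:
-- b_0 = 1, b_k = - Σ_{j=1}^{k} a_j b_{k-j}.
-- invList a k = [b_k, b_{k-1}, ..., b_0].
private
  convTail : FPS → ℕ → List ℤ → ℤ
  convTail a j []       = + 0
  convTail a j (b ∷ bs) = a j ℤ.* b ℤ.+ convTail a (suc j) bs

  hd : List ℤ → ℤ
  hd []      = + 0
  hd (b ∷ _) = b

invList : FPS → ℕ → List ℤ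
invList a zero    = + 1 ∷ []
invList a (suc k) = (- convTail a 1 (invList a k)) ∷ invList a k

inv : FPS → FPS
inv a k = hd (invList a k)

oneMinusQ : ℕ → FPS
oneMinusQ j = oneF ⊕ scale (- + 1) (shiftQ j oneF)

eulerPartial : ℕ → ℕ → FPS
eulerPartial r zero    = oneF
eulerPartial r (suc N) = eulerPartial r N ⊛ oneMinusQ (r ℕ.* suc N)

-- f_r = ∏_{n ≥ 1} (1 - q^{r n}); for r ≥ 1 the coefficient of q^k is already
-- determined by the factors n ≤ k.
f : ℕ → FPS
f r k = eulerPartial r k k

x : FPS
x = shiftQ 1 (f 2 ⊛ pow (f 10) 3 ⊛ inv (pow (f 1) 3 ⊛ f 5))

onePlus5x : FPS
onePlus5x = oneF ⊕ scale (+ 5) x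

xFrac : ℕ → ℕ → FPS
xFrac m n = pow x m ⊛ inv (pow onePlus5x n)

Φ : FPS
Φ = shiftQ 5 (f 25 ⊛ pow (f 50) 2 ⊛ inv (f 1 ⊛ pow (f 2) 2))

U5 : FPS → FPS
U5 g k = g (5 ℕ.* k)

U⁽⁰⁾ : FPS → FPS
U⁽⁰⁾ g = U5 (Φ ⊛ g)

U⁽¹⁾ : FPS → FPS
U⁽¹⁾ g = U5 g

sumF : (ℕ → FPS) → ℕ → FPS
sumF g zero    = g 0
sumF g (suc N) = sumF g N ⊕ g (suc N)

-- π_0(m,r) = max(0, ⌊(5r-m+2)/7⌋ - 5), used only for r ≥ ⌈(m+4)/5⌉ (so 5r-m+2 ≥ 0)
π₀ : ℕ → ℕ → ℕ
π₀ m r = ((5 ℕ.* r ℕ.+ 2 ∸ m) / 7) ∸ 5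

-- π_1(m,r) = ⌊(5r-m)/7⌋, used only for r ≥ ⌈m/5⌉ (so 5r-m ≥ 0)
π₁ : ℕ → ℕ → ℕ
π₁ m r = (5 ℕ.* r ∸ m) / 7

-- ⌈(m+4)/5⌉ and ⌈m/5⌉
lo₀ : ℕ → ℕ
lo₀ m = (m ℕ.+ 8) / 5

lo₁ : ℕ → ℕ
lo₁ m = (m ℕ.+ 4) / 5

SuppBound : (ℤ → ℤ → ℤ → ℤ) → ℤ → ℤ → ℕ → Set
SuppBound h a b B = ∀ r → B < ∣ r ∣ → h a b r ≡ + 0

FinSupp : (ℤ → ℤ → ℤ → ℤ) → Set
FinSupp h = ∀ a b → ∃[ B ] SuppBound h a b B

-- Σ_{r ≥ lo} h(m,n,r) 5^{π(m,r)} x^r, truncated at r = lo + B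
-- (exact when B bounds the support of h(m,n,·), since lo ≥ 0).
hSum : (ℤ → ℤ → ℤ → ℤ) → (ℕ → ℕ → ℕ) → ℕ → ℕ → ℕ → ℕ → FPS
hSum h π lo m n B =
  sumF (λ i → scale (h (+ m) (+ n) (+ (lo ℕ.+ i)) ℤ.* (+ 5) ℤ.^ π m (lo ℕ.+ i))
                    (pow x (lo ℕ.+ i))) B

{-# OPTIONS --safe #-}
module Submission where

-- Dissecting the pentagonal number series f₁ and φ(-q) = f₁²/f₂ modulo 5 and comparing the components of f₁² = f₂ φ(-q)
-- yields f₁ = u (1 - a - a²) and f₂ = w (1 - b - b²), where a = r(q⁵), b = r(q¹⁰) are Rogers–Ramanujan continued fractions
-- related by b (1 - K) = a² (1 + K), K = a b² = k(q⁵). The lattice identity φ² = φ₀² + q φ₁ φ₄ expresses φ²/φ₀² through k.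
-- This reduces z (1 + 4x) = 1 and 4y + z = 5, for the eta quotients z = f₁⁴f₁₀²/(f₂²f₅⁴) and y = f₁₀f₂³/(f₅³f₁), to the same
-- identities at q⁵ up to a factor vanishing at q = 0, so both hold. Hence x = k/(1 - 4k - k²), and x and Φ become rational
-- functions of a and K with a⁵ (1 + K)² = K (1 - K)². In these terms the modular equation of degree 5 between x and X = x(q⁵)
-- and the initial values U(x^j), j < 5, are polynomial identities. The modular equation gives a recursion for U(x^m) and a
-- polynomial Q(x, X) with Q (1 + 5x) = (1 + 5X)⁵, so that U(x^m / (1+5x)^n) = (1+5x)^{-5n} U(x^m Q^n); giving x weight 1,
-- X weight 5 and 5 weight 7, the weights of the coefficients carry the divisibility through both recursions.

open import Data.Nat as ℕ using (ℕ; zero; suc; _∸_; _≤_; _<_; z≤n; s≤s)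
open import Data.Integer as ℤ using (ℤ; +_; -[1+_]; ∣_∣)
open import Data.Bool using (Bool; true; false; _∧_)
open import Data.Fin using (Fin; zero; suc)
open import Data.List using (List; []; _∷_; take; drop; length)
open import Data.List.Relation.Unary.All using (All; []; _∷_)
open import Data.Vec using (Vec; []; _∷_; lookup; tabulate)
open import Data.Vec.N-ary using (N-ary; ∀ⁿ; curryⁿ; _$ⁿ_)
open import Data.Vec.Relation.Binary.Pointwise.Inductive as Pointwise using (Pointwise; []; _∷_)
open import Data.Product using (∃-syntax; _×_; _,_; proj₁; proj₂)
open import Relation.Binary.PropositionalEquality using (_≡_; refl)
open import Algebra.Bundles using (CommutativeRing)
open import Level using (0ℓ)

-- The theory of modular functions would give `D ≈ 0` and `E′ ≈ 0` by comparing finitely many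
-- coefficients. Over formal series a descent takes its place: `E′` is tied to `D` at q⁵ and `D` to
-- `E′` at q⁵, so a finite positive order of vanishing would have to exceed itself. After that
-- everything happens among polynomials in `a` over ℤ[`K`], and identities are settled by
-- evaluation. Hence polynomials are kept as lists of coefficients, which can be reduced,
-- homogenized and tested for divisibility as well as compared. `U5` is computable there because `K`
-- is a series in q⁵ while a^i has exponents ≡ i (mod 5): once a denominator is free of `a`, only
-- the coefficient of a⁰ survives. Denominators in `a` are cleared by their norm over the fifth
-- roots of unity. The weights 1, 5, 7 come from π: 5r - m gains 5 when r grows by 1, loses 1 when m
-- grows by 1, and 7 units of it are worth one factor 5. The modular equation, `Q` and the initial
-- values are given data that the proof only verifies.

-- Integer polynomials and identities in commutative rings

infixl 6 _:+_ _:-_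
infixl 7 _:*_
infixr 8 _:^_ :-_

data Expr (n : ℕ) : Set where
  con            : ℤ → Expr n
  var            : Fin n → Expr n
  _:+_ _:*_ _:-_ : Expr n → Expr n → Expr n
  :-_            : Expr n → Expr n
  _:^_           : Expr n → ℕ → Expr n

:0 :1 : ∀ {n} → Expr n
:0 = con (+ 0)
:1 = con (+ 1)

Poly : ℕ → Set
Poly zero    = ℤ
Poly (suc n) = List (Poly n)

conᴾ : ∀ {n} → ℤ → Poly n
conᴾ {zero}  c = c
conᴾ {suc n} c = conᴾ c ∷ []

varᴾ : ∀ {n} → Fin n → Poly n
varᴾ {suc n} zero    = conᴾ (+ 0) ∷ conᴾ (+ 1) ∷ []
varᴾ {suc n} (suc i) = varᴾ i ∷ []

infixl 6 _+ᴾ_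
infixl 7 _*ᴾ_ _·ᴾ_

_+ᴾ_ : ∀ {n} → Poly n → Poly n → Poly n
_+ᴾ_ {zero}  c        d        = c ℤ.+ d
_+ᴾ_ {suc n} []       q        = q
_+ᴾ_ {suc n} (c ∷ p)  []       = c ∷ p
_+ᴾ_ {suc n} (c ∷ p)  (d ∷ q)  = c +ᴾ d ∷ p +ᴾ q

mutual
  _·ᴾ_ : ∀ {n} → Poly n → Poly (suc n) → Poly (suc n)
  c ·ᴾ []      = []
  c ·ᴾ (d ∷ q) = c *ᴾ d ∷ c ·ᴾ q

  _*ᴾ_ : ∀ {n} → Poly n → Poly n → Poly n
  _*ᴾ_ {zero}  c       d = c ℤ.* d
  _*ᴾ_ {suc n} []      q = []
  _*ᴾ_ {suc n} (c ∷ p) q = c ·ᴾ q +ᴾ (conᴾ (+ 0) ∷ p *ᴾ q)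

_^ᴾ_ : ∀ {n} → Poly n → ℕ → Poly n
p ^ᴾ zero  = conᴾ (+ 1)
p ^ᴾ suc k = p *ᴾ (p ^ᴾ k)

normᴾ : ∀ {n} → Expr n → Poly n
normᴾ (con c)   = conᴾ c
normᴾ (var i)   = varᴾ i
normᴾ (e :+ e′) = normᴾ e +ᴾ normᴾ e′
normᴾ (e :* e′) = normᴾ e *ᴾ normᴾ e′
normᴾ (e :- e′) = normᴾ e +ᴾ conᴾ ℤ.-1ℤ *ᴾ normᴾ e′
normᴾ (:- e)    = conᴾ ℤ.-1ℤ *ᴾ normᴾ e
normᴾ (e :^ k)  = normᴾ e ^ᴾ k

-- Trailing zeros are never stripped, so equal polynomials may differ as lists. Equality is
-- therefore decided by testing whether all coefficients of the difference vanish.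
isZero : ∀ {n} → Poly n → Bool
isZero {zero}  (+ zero)  = true
isZero {zero}  (+ suc _) = false
isZero {zero}  -[1+ _ ]  = false
isZero {suc n} []        = true
isZero {suc n} (c ∷ p)   = isZero c ∧ isZero p

vars : ∀ n → Vec (Expr n) n
vars n = tabulate var

module PolyEval (R : CommutativeRing 0ℓ 0ℓ) (ι : ℤ → CommutativeRing.Carrier R) where

  open CommutativeRing R renaming (Carrier to A; zeroˡ to 0*; zeroʳ to *0)
  open import Relation.Binary.Reasoning.Setoid setoid
  open import Algebra.Properties.Semiring.Exp semiring public using (_^_; ^-congˡ)
  open import Algebra.Properties.Ring ring using (-1*x≈-x)
  open import Algebra.Properties.CommutativeSemigroup +-commutativeSemigroup using (interchange)
  open import Algebra.Properties.CommutativeSemigroup *-commutativeSemigroup using (x∙yz≈y∙xz)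

  ⟦_⟧ : ∀ {n} → Expr n → Vec A n → A
  ⟦ con c ⟧   ρ = ι c
  ⟦ var i ⟧   ρ = lookup ρ i
  ⟦ e :+ e′ ⟧ ρ = ⟦ e ⟧ ρ + ⟦ e′ ⟧ ρ
  ⟦ e :* e′ ⟧ ρ = ⟦ e ⟧ ρ * ⟦ e′ ⟧ ρ
  ⟦ e :- e′ ⟧ ρ = ⟦ e ⟧ ρ + - ⟦ e′ ⟧ ρ
  ⟦ :- e ⟧    ρ = - ⟦ e ⟧ ρ
  ⟦ e :^ k ⟧  ρ = ⟦ e ⟧ ρ ^ k

  ⟦_⟧ᴾ : ∀ {n} → Poly n → Vec A n → A
  ⟦_⟧ᴾ {zero}  c       []      = ι c
  ⟦_⟧ᴾ {suc n} []      (a ∷ ρ) = 0#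
  ⟦_⟧ᴾ {suc n} (c ∷ p) (a ∷ ρ) = ⟦ c ⟧ᴾ ρ + a * ⟦ p ⟧ᴾ (a ∷ ρ)

  module Correct
    (ι-0 : ι (+ 0) ≈ 0#) (ι-1 : ι (+ 1) ≈ 1#)
    (ι-+ : ∀ a b → ι (a ℤ.+ b) ≈ ι a + ι b) (ι-* : ∀ a b → ι (a ℤ.* b) ≈ ι a * ι b)
    where

    conᴾ-correct : ∀ {n} c (ρ : Vec A n) → ⟦ conᴾ c ⟧ᴾ ρ ≈ ι c
    conᴾ-correct c []      = CommutativeRing.refl R
    conᴾ-correct c (a ∷ ρ) = trans (+-cong (conᴾ-correct c ρ) (*0 a)) (+-identityʳ _)

    varᴾ-correct : ∀ {n} i (ρ : Vec A n) → ⟦ varᴾ i ⟧ᴾ ρ ≈ lookup ρ i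
    varᴾ-correct zero    (a ∷ ρ) = begin
      ⟦ conᴾ (+ 0) ⟧ᴾ ρ + a * (⟦ conᴾ (+ 1) ⟧ᴾ ρ + a * 0#)
        ≈⟨ +-cong (trans (conᴾ-correct _ ρ) ι-0) (*-congˡ (trans (+-cong (trans (conᴾ-correct _ ρ) ι-1) (*0 a)) (+-identityʳ _))) ⟩
      0# + a * 1#  ≈⟨ trans (+-identityˡ _) (*-identityʳ a) ⟩
      a            ∎
    varᴾ-correct (suc i) (a ∷ ρ) = trans (+-cong (varᴾ-correct i ρ) (*0 a)) (+-identityʳ _)

    +ᴾ-correct : ∀ {n} (p q : Poly n) ρ → ⟦ p +ᴾ q ⟧ᴾ ρ ≈ ⟦ p ⟧ᴾ ρ + ⟦ q ⟧ᴾ ρ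
    +ᴾ-correct {zero}  c       d       []      = ι-+ c d
    +ᴾ-correct {suc n} []      q       (a ∷ ρ) = sym (+-identityˡ _)
    +ᴾ-correct {suc n} (c ∷ p) []      (a ∷ ρ) = sym (+-identityʳ _)
    +ᴾ-correct {suc n} (c ∷ p) (d ∷ q) (a ∷ ρ) = begin
      ⟦ c +ᴾ d ⟧ᴾ ρ + a * ⟦ p +ᴾ q ⟧ᴾ (a ∷ ρ)
        ≈⟨ +-cong (+ᴾ-correct c d ρ) (trans (*-congˡ (+ᴾ-correct p q (a ∷ ρ))) (distribˡ a _ _)) ⟩
      (⟦ c ⟧ᴾ ρ + ⟦ d ⟧ᴾ ρ) + (a * ⟦ p ⟧ᴾ (a ∷ ρ) + a * ⟦ q ⟧ᴾ (a ∷ ρ))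
        ≈⟨ interchange _ _ _ _ ⟩
      (⟦ c ⟧ᴾ ρ + a * ⟦ p ⟧ᴾ (a ∷ ρ)) + (⟦ d ⟧ᴾ ρ + a * ⟦ q ⟧ᴾ (a ∷ ρ)) ∎

    mutual
      ·ᴾ-correct : ∀ {n} (c : Poly n) q a ρ → ⟦ c ·ᴾ q ⟧ᴾ (a ∷ ρ) ≈ ⟦ c ⟧ᴾ ρ * ⟦ q ⟧ᴾ (a ∷ ρ)
      ·ᴾ-correct c []      a ρ = sym (*0 _)
      ·ᴾ-correct c (d ∷ q) a ρ = begin
        ⟦ c *ᴾ d ⟧ᴾ ρ + a * ⟦ c ·ᴾ q ⟧ᴾ (a ∷ ρ)
          ≈⟨ +-cong (*ᴾ-correct c d ρ) (trans (*-congˡ (·ᴾ-correct c q a ρ)) (x∙yz≈y∙xz a _ _)) ⟩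
        ⟦ c ⟧ᴾ ρ * ⟦ d ⟧ᴾ ρ + ⟦ c ⟧ᴾ ρ * (a * ⟦ q ⟧ᴾ (a ∷ ρ)) ≈⟨ distribˡ _ _ _ ⟨
        ⟦ c ⟧ᴾ ρ * (⟦ d ⟧ᴾ ρ + a * ⟦ q ⟧ᴾ (a ∷ ρ)) ∎

      *ᴾ-correct : ∀ {n} (p q : Poly n) ρ → ⟦ p *ᴾ q ⟧ᴾ ρ ≈ ⟦ p ⟧ᴾ ρ * ⟦ q ⟧ᴾ ρ
      *ᴾ-correct {zero}  c       d []      = ι-* c d
      *ᴾ-correct {suc n} []      q (a ∷ ρ) = sym (0* _)
      *ᴾ-correct {suc n} (c ∷ p) q (a ∷ ρ) = begin
        ⟦ c ·ᴾ q +ᴾ (conᴾ (+ 0) ∷ p *ᴾ q) ⟧ᴾ (a ∷ ρ)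
          ≈⟨ +ᴾ-correct (c ·ᴾ q) (conᴾ (+ 0) ∷ p *ᴾ q) (a ∷ ρ) ⟩
        ⟦ c ·ᴾ q ⟧ᴾ (a ∷ ρ) + (⟦ conᴾ (+ 0) ⟧ᴾ ρ + a * ⟦ p *ᴾ q ⟧ᴾ (a ∷ ρ))
          ≈⟨ +-cong (·ᴾ-correct c q a ρ) (trans (+-cong (trans (conᴾ-correct _ ρ) ι-0)
               (trans (*-congˡ (*ᴾ-correct p q (a ∷ ρ))) (sym (*-assoc a _ _)))) (+-identityˡ _)) ⟩
        ⟦ c ⟧ᴾ ρ * ⟦ q ⟧ᴾ (a ∷ ρ) + a * ⟦ p ⟧ᴾ (a ∷ ρ) * ⟦ q ⟧ᴾ (a ∷ ρ) ≈⟨ distribʳ _ _ _ ⟨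
        (⟦ c ⟧ᴾ ρ + a * ⟦ p ⟧ᴾ (a ∷ ρ)) * ⟦ q ⟧ᴾ (a ∷ ρ) ∎

    ^ᴾ-correct : ∀ {n} (p : Poly n) k ρ → ⟦ p ^ᴾ k ⟧ᴾ ρ ≈ ⟦ p ⟧ᴾ ρ ^ k
    ^ᴾ-correct p zero    ρ = trans (conᴾ-correct _ ρ) ι-1
    ^ᴾ-correct p (suc k) ρ = trans (*ᴾ-correct p (p ^ᴾ k) ρ) (*-congˡ (^ᴾ-correct p k ρ))

    ι-neg : ι ℤ.-1ℤ ≈ - 1#
    ι-neg = begin
      ι ℤ.-1ℤ                    ≈⟨ +-identityʳ _ ⟨
      ι ℤ.-1ℤ + 0#               ≈⟨ +-congˡ (-‿inverseʳ 1#) ⟨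
      ι ℤ.-1ℤ + (1# + - 1#)      ≈⟨ +-assoc _ _ _ ⟨
      ι ℤ.-1ℤ + 1# + - 1#        ≈⟨ +-congʳ (trans (+-congˡ (sym ι-1)) (trans (sym (ι-+ _ _)) ι-0)) ⟩
      0# + - 1#                        ≈⟨ +-identityˡ _ ⟩
      - 1#                             ∎

    neg-correct : ∀ {n} (p : Poly n) ρ → ⟦ conᴾ ℤ.-1ℤ *ᴾ p ⟧ᴾ ρ ≈ - ⟦ p ⟧ᴾ ρ
    neg-correct p ρ = trans (*ᴾ-correct (conᴾ _) p ρ) (trans (*-congʳ (trans (conᴾ-correct _ ρ) ι-neg)) (-1*x≈-x _))

    norm-correct : ∀ {n} (e : Expr n) ρ → ⟦ normᴾ e ⟧ᴾ ρ ≈ ⟦ e ⟧ ρ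
    norm-correct (con c)   ρ = conᴾ-correct c ρ
    norm-correct (var i)   ρ = varᴾ-correct i ρ
    norm-correct (e :+ e′) ρ = trans (+ᴾ-correct (normᴾ e) (normᴾ e′) ρ) (+-cong (norm-correct e ρ) (norm-correct e′ ρ))
    norm-correct (e :* e′) ρ = trans (*ᴾ-correct (normᴾ e) (normᴾ e′) ρ) (*-cong (norm-correct e ρ) (norm-correct e′ ρ))
    norm-correct (e :- e′) ρ = trans (+ᴾ-correct (normᴾ e) _ ρ)
      (+-cong (norm-correct e ρ) (trans (neg-correct (normᴾ e′) ρ) (-‿cong (norm-correct e′ ρ))))
    norm-correct (:- e)    ρ = trans (neg-correct (normᴾ e) ρ) (-‿cong (norm-correct e ρ))
    norm-correct (e :^ k)  ρ = trans (^ᴾ-correct (normᴾ e) k ρ) (^-congˡ k (norm-correct e ρ))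

    isZero-correct : ∀ {n} (p : Poly n) ρ → isZero p ≡ true → ⟦ p ⟧ᴾ ρ ≈ 0#
    isZero-correct {zero}  (+ zero) []      _ = ι-0
    isZero-correct {suc n} []       (a ∷ ρ) _ = CommutativeRing.refl R
    isZero-correct {suc n} (c ∷ p)  (a ∷ ρ) z with isZero c in c≡0 | isZero p in p≡0
    isZero-correct {suc n} (c ∷ p)  (a ∷ ρ) z | true | true = trans
      (+-cong (isZero-correct c ρ c≡0) (trans (*-congˡ (isZero-correct p (a ∷ ρ) p≡0)) (*0 a))) (+-identityˡ 0#)

    difference≈0 : ∀ {a b} → a + - b ≈ 0# → a ≈ b
    difference≈0 {a} {b} d = begin
      a              ≈⟨ +-identityʳ a ⟨
      a + 0#         ≈⟨ +-congˡ (-‿inverseˡ b) ⟨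
      a + (- b + b)  ≈⟨ +-assoc a _ _ ⟨
      a + - b + b    ≈⟨ +-congʳ d ⟩
      0# + b         ≈⟨ +-identityˡ b ⟩
      b              ∎

    prove : ∀ {n} (e e′ : Expr n) ρ → isZero (normᴾ (e :- e′)) ≡ true → ⟦ e ⟧ ρ ≈ ⟦ e′ ⟧ ρ
    prove e e′ ρ z = difference≈0 (trans (sym (norm-correct (e :- e′) ρ)) (isZero-correct _ ρ z))

    forallⁿ : ∀ n {P : Vec A n → Set} → (∀ ρ → P ρ) → ∀ⁿ n (curryⁿ P)
    forallⁿ zero    h = h []
    forallⁿ (suc n) h = λ a → forallⁿ n (λ ρ → h (a ∷ ρ))

    private
      sides : ∀ n → N-ary n (Expr n) (Expr n × Expr n) → Expr n × Expr n
      sides n s = s $ⁿ vars n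

    solve : ∀ n (s : N-ary n (Expr n) (Expr n × Expr n)) →
            isZero (normᴾ (proj₁ (sides n s) :- proj₂ (sides n s))) ≡ true →
            ∀ⁿ n (curryⁿ (λ ρ → ⟦ proj₁ (sides n s) ⟧ ρ ≈ ⟦ proj₂ (sides n s) ⟧ ρ))
    solve n s z = forallⁿ n (λ ρ → prove (proj₁ (sides n s)) (proj₂ (sides n s)) ρ z)

open import Defs
open import Data.Nat using (_+_; _*_)
open import Data.Sum using (_⊎_; inj₁; inj₂)
open import Data.Unit using (⊤; tt)
open import Relation.Nullary using (¬_; Dec; yes; contradiction)
open import Relation.Nullary.Decidable using (from-no; from-yes; _⊎-dec_; _×-dec_)
open import Relation.Binary.PropositionalEquality using (_≢_; sym; trans; cong; cong₂; subst)
import Data.Nat.Properties as ℕₚ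
open import Data.Nat.Divisibility using (n∣m*n)
open import Data.Nat.DivMod using (_%_; _/_; m≡m%n+[m/n]*n; m%n<n; [m+kn]%n≡m%n; m<n⇒m%n≡m; /-mono-≤; +-distrib-/-∣ʳ; m*n/n≡m; m/n*n≤m)
open import Data.Nat.Tactic.RingSolver using () renaming (solve-∀ to solveℕ-∀)
import Data.Integer.Properties as ℤₚ
import Data.Integer.Divisibility.Signed as ℤ∣
open import Data.Integer.Tactic.RingSolver using (solve-∀)

-- Formal power series

tailF : FPS → FPS
tailF g k = g (suc k)

zeroF : FPS
zeroF = constF (+ 0)

zeroF-at : ∀ k → zeroF k ≡ + 0
zeroF-at zero    = refl
zeroF-at (suc _) = refl

cauchy-suc : ∀ g h k i → cauchy g h (suc k) (suc i) ≡ g 0 ℤ.* h (suc k) ℤ.+ cauchy (tailF g) h k i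
cauchy-suc g h k zero    = ℤₚ.+-comm (g 1 ℤ.* h k) (g 0 ℤ.* h (suc k))
cauchy-suc g h k (suc i) = trans (cong (ℤ._+_ (g (suc (suc i)) ℤ.* h (k ∸ suc i))) (cauchy-suc g h k i))
  (rearrange (g (suc (suc i)) ℤ.* h (k ∸ suc i)) (g 0 ℤ.* h (suc k)) (cauchy (tailF g) h k i))
  where
  rearrange : ∀ a b c → a ℤ.+ (b ℤ.+ c) ≡ b ℤ.+ (a ℤ.+ c)
  rearrange = solve-∀

-- Peeling off the constant term of the first factor gives a recursion on the index, and the ring
-- laws below rest on it.
⊛-suc : ∀ g h k → (g ⊛ h) (suc k) ≡ g 0 ℤ.* h (suc k) ℤ.+ (tailF g ⊛ h) k
⊛-suc g h k = cauchy-suc g h k k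

-- A coefficient of a product involves only coefficients of the factors up to the same index; this
-- is what lets infinite products and sums be replaced by truncations.
⊛-cong≤ : ∀ n {g g′ h h′ : FPS} → (∀ k → k ≤ n → g k ≡ g′ k) → (∀ k → k ≤ n → h k ≡ h′ k) →
          (g ⊛ h) n ≡ (g′ ⊛ h′) n
⊛-cong≤ zero    p r = cong₂ ℤ._*_ (p 0 z≤n) (r 0 z≤n)
⊛-cong≤ (suc n) {g} {g′} {h} {h′} p r = trans (⊛-suc g h n) (trans
  (cong₂ ℤ._+_ (cong₂ ℤ._*_ (p 0 z≤n) (r (suc n) ℕₚ.≤-refl))
    (⊛-cong≤ n (λ k k≤n → p (suc k) (s≤s k≤n)) (λ k k≤n → r k (ℕₚ.m≤n⇒m≤1+n k≤n))))
  (sym (⊛-suc g′ h′ n)))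

⊛-cong : ∀ {g g′ h h′ : FPS} → g ≈ g′ → h ≈ h′ → g ⊛ h ≈ g′ ⊛ h′
⊛-cong p r n = ⊛-cong≤ n (λ k _ → p k) (λ k _ → r k)

scale-⊛ : ∀ c g h → scale c g ⊛ h ≈ scale c (g ⊛ h)
scale-⊛ c g h zero    = ℤₚ.*-assoc c (g 0) (h 0)
scale-⊛ c g h (suc k) = trans (⊛-suc (scale c g) h k) (trans
  (cong (ℤ._+_ (c ℤ.* g 0 ℤ.* h (suc k))) (scale-⊛ c (tailF g) h k)) (trans
  (factor c (g 0) (h (suc k)) ((tailF g ⊛ h) k))
  (cong (c ℤ.*_) (sym (⊛-suc g h k)))))
  where
  factor : ∀ c a b d → c ℤ.* a ℤ.* b ℤ.+ c ℤ.* d ≡ c ℤ.* (a ℤ.* b ℤ.+ d)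
  factor = solve-∀

⊛-distribʳ : ∀ h g g′ → (g ⊕ g′) ⊛ h ≈ g ⊛ h ⊕ g′ ⊛ h
⊛-distribʳ h g g′ zero    = ℤₚ.*-distribʳ-+ (h 0) (g 0) (g′ 0)
⊛-distribʳ h g g′ (suc k) = trans (⊛-suc (g ⊕ g′) h k) (trans
  (cong (ℤ._+_ ((g 0 ℤ.+ g′ 0) ℤ.* h (suc k))) (⊛-distribʳ h (tailF g) (tailF g′) k)) (trans
  (regroup (g 0) (g′ 0) (h (suc k)) ((tailF g ⊛ h) k) ((tailF g′ ⊛ h) k))
  (sym (cong₂ ℤ._+_ (⊛-suc g h k) (⊛-suc g′ h k)))))
  where
  regroup : ∀ a b c d e → (a ℤ.+ b) ℤ.* c ℤ.+ (d ℤ.+ e) ≡ (a ℤ.* c ℤ.+ d) ℤ.+ (b ℤ.* c ℤ.+ e)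
  regroup = solve-∀

⊛-assoc : ∀ g h j → (g ⊛ h) ⊛ j ≈ g ⊛ (h ⊛ j)
⊛-assoc g h j zero    = ℤₚ.*-assoc (g 0) (h 0) (j 0)
⊛-assoc g h j (suc k) = trans (⊛-suc (g ⊛ h) j k) (trans
  (cong (ℤ._+_ (g 0 ℤ.* h 0 ℤ.* j (suc k))) (trans
    (⊛-cong {h = j} (⊛-suc g h) (λ _ → refl) k) (trans
    (⊛-distribʳ j (scale (g 0) (tailF h)) (tailF g ⊛ h) k)
    (cong₂ ℤ._+_ (scale-⊛ (g 0) (tailF h) j k) (⊛-assoc (tailF g) h j k))))) (trans
  (factor (g 0) (h 0) (j (suc k)) ((tailF h ⊛ j) k) ((tailF g ⊛ (h ⊛ j)) k)) (trans
  (cong (λ z → g 0 ℤ.* z ℤ.+ (tailF g ⊛ (h ⊛ j)) k) (sym (⊛-suc h j k)))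
  (sym (⊛-suc g (h ⊛ j) k)))))
  where
  factor : ∀ a b c d e → a ℤ.* b ℤ.* c ℤ.+ (a ℤ.* d ℤ.+ e) ≡ a ℤ.* (b ℤ.* c ℤ.+ d) ℤ.+ e
  factor = solve-∀

-- Peeling the constant terms off both factors lowers the index by two, so there are two base cases.
⊛-comm : ∀ g h → g ⊛ h ≈ h ⊛ g
⊛-comm g h zero          = ℤₚ.*-comm (g 0) (h 0)
⊛-comm g h (suc zero)    = swap (g 0) (g 1) (h 0) (h 1)
  where
  swap : ∀ a b c d → b ℤ.* c ℤ.+ a ℤ.* d ≡ d ℤ.* a ℤ.+ c ℤ.* b
  swap = solve-∀
⊛-comm g h (suc (suc k)) = trans (⊛-suc g h (suc k)) (trans
  (cong (ℤ._+_ (g 0 ℤ.* h (suc (suc k)))) (trans (⊛-comm (tailF g) h (suc k)) (trans (⊛-suc h (tailF g) k)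
    (cong (ℤ._+_ (h 0 ℤ.* g (suc (suc k)))) (⊛-comm (tailF h) (tailF g) k))))) (trans
  (exchange (g 0 ℤ.* h (suc (suc k))) (h 0 ℤ.* g (suc (suc k))) ((tailF g ⊛ tailF h) k)) (trans
  (cong (ℤ._+_ (h 0 ℤ.* g (suc (suc k)))) (sym (trans (⊛-comm (tailF h) g (suc k)) (⊛-suc g (tailF h) k))))
  (sym (⊛-suc h g (suc k))))))
  where
  exchange : ∀ a b c → a ℤ.+ (b ℤ.+ c) ≡ b ℤ.+ (a ℤ.+ c)
  exchange = solve-∀

constF-⊛ : ∀ c g → constF c ⊛ g ≈ scale c g
constF-⊛ c g zero    = refl
constF-⊛ c g (suc k) = trans (⊛-suc (constF c) g k) (trans (cong (ℤ._+_ (c ℤ.* g (suc k)))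
  (vanish k)) (ℤₚ.+-identityʳ _))
  where
  vanish : ∀ k → (tailF (constF c) ⊛ g) k ≡ + 0
  vanish zero    = refl
  vanish (suc k) = trans (⊛-suc (tailF (constF c)) g k) (trans (ℤₚ.+-identityˡ _) (vanish k))

⊛-identityˡ : ∀ g → oneF ⊛ g ≈ g
⊛-identityˡ g k = trans (constF-⊛ (+ 1) g k) (ℤₚ.*-identityˡ (g k))

⊛-identityʳ : ∀ g → g ⊛ oneF ≈ g
⊛-identityʳ g k = trans (⊛-comm g oneF k) (⊛-identityˡ g k)

⊛-distribˡ : ∀ h g g′ → h ⊛ (g ⊕ g′) ≈ h ⊛ g ⊕ h ⊛ g′
⊛-distribˡ h g g′ k = trans (⊛-comm h (g ⊕ g′) k) (trans (⊛-distribʳ h g g′ k)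
  (cong₂ ℤ._+_ (⊛-comm g h k) (⊛-comm g′ h k)))

FPS-ring : CommutativeRing 0ℓ 0ℓ
FPS-ring = record
  { Carrier = FPS ; _≈_ = _≈_ ; _+_ = _⊕_ ; _*_ = _⊛_ ; -_ = scale ℤ.-1ℤ ; 0# = zeroF ; 1# = oneF
  ; isCommutativeRing = record
    { isRing = record
      { +-isAbelianGroup = record
        { isGroup = record
          { isMonoid = record
            { isSemigroup = record
              { isMagma = record
                { isEquivalence = record
                  { refl = λ _ → refl ; sym = λ p k → sym (p k) ; trans = λ p r k → trans (p k) (r k) }
                ; ∙-cong = λ p r k → cong₂ ℤ._+_ (p k) (r k) }
              ; assoc = λ g h j k → ℤₚ.+-assoc (g k) (h k) (j k) }
            ; identity = (λ g k → trans (cong (ℤ._+ g k) (zeroF-at k)) (ℤₚ.+-identityˡ (g k)))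
                       , (λ g k → trans (cong (ℤ._+_ (g k)) (zeroF-at k)) (ℤₚ.+-identityʳ (g k))) }
          ; inverse = (λ g k → trans (cancel (g k)) (sym (zeroF-at k)))
                    , (λ g k → trans (cancel′ (g k)) (sym (zeroF-at k)))
          ; ⁻¹-cong = λ p k → cong (ℤ.-1ℤ ℤ.*_) (p k) }
        ; comm = λ g h k → ℤₚ.+-comm (g k) (h k) }
      ; *-cong = ⊛-cong
      ; *-assoc = ⊛-assoc
      ; *-identity = ⊛-identityˡ , ⊛-identityʳ
      ; distrib = ⊛-distribˡ , ⊛-distribʳ }
    ; *-comm = ⊛-comm } }
  where
  cancel : ∀ a → ℤ.-1ℤ ℤ.* a ℤ.+ a ≡ + 0
  cancel a = trans (cong (ℤ._+ a) (ℤₚ.-1*i≡-i a)) (ℤₚ.+-inverseˡ a)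
  cancel′ : ∀ a → a ℤ.+ ℤ.-1ℤ ℤ.* a ≡ + 0
  cancel′ a = trans (cong (ℤ._+_ a) (ℤₚ.-1*i≡-i a)) (ℤₚ.+-inverseʳ a)

conv : FPS → ℕ → List ℤ → ℤ
conv a j []       = + 0
conv a j (b ∷ bs) = a j ℤ.* b ℤ.+ conv a (suc j) bs

-- The helper of inv is private: the hole in the type of convTail≡conv is filled by its use in inv-step.
mutual
  inv-step : ∀ a k → inv a (suc k) ≡ ℤ.- conv a 1 (invList a k)
  inv-step a k with 1 | invList a k
  ... | j | bs = cong ℤ.-_ (convTail≡conv a j bs)

  convTail≡conv : ∀ a j bs → _ ≡ conv a j bs
  convTail≡conv a j []       = refl
  convTail≡conv a j (b ∷ bs) = cong (ℤ._+_ (a j ℤ.* b)) (convTail≡conv a (suc j) bs)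

-- `invList a k` runs from b_k down to b_0 while the coefficients of `a` run upwards from i, which
-- is the pairing of a Cauchy product.
conv-invList : ∀ a i k → conv a i (invList a k) ≡ ((λ j → a (i + j)) ⊛ inv a) k
conv-invList a i zero    = trans (ℤₚ.+-identityʳ _) (cong (λ j → a j ℤ.* + 1) (sym (ℕₚ.+-identityʳ i)))
conv-invList a i (suc k) = trans
  (cong₂ (λ j c → a j ℤ.* inv a (suc k) ℤ.+ c) (sym (ℕₚ.+-identityʳ i)) (trans (conv-invList a (suc i) k)
    (⊛-cong {h = inv a} (λ j → cong a (sym (ℕₚ.+-suc i j))) (λ _ → refl) k)))
  (sym (⊛-suc (λ j → a (i + j)) (inv a) k))

⊛-inv : ∀ a → a 0 ≡ + 1 → a ⊛ inv a ≈ oneF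
⊛-inv a a₀≡1 zero    = trans (cong (ℤ._* + 1) a₀≡1) refl
⊛-inv a a₀≡1 (suc k) = trans (⊛-suc a (inv a) k) (trans
  (cong₂ (λ c d → c ℤ.* d ℤ.+ (tailF a ⊛ inv a) k) a₀≡1 (trans (inv-step a k) (cong ℤ.-_ (conv-invList a 1 k))))
  (cancel ((tailF a ⊛ inv a) k)))
  where
  cancel : ∀ b → + 1 ℤ.* (ℤ.- b) ℤ.+ b ≡ + 0
  cancel = solve-∀

module F = CommutativeRing FPS-ring

open import Algebra.Properties.Semiring.Exp F.semiring using (^-homo-*; ^-assocʳ; ^-congʳ)
open import Algebra.Properties.CommutativeSemiring.Exp F.commutativeSemiring using (^-distrib-*)
open import Algebra.Properties.Group F.+-group using (∙-cancelʳ)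

constF-+ : ∀ a b → constF (a ℤ.+ b) ≈ constF a ⊕ constF b
constF-+ a b zero    = refl
constF-+ a b (suc _) = refl

constF-* : ∀ a b → constF (a ℤ.* b) ≈ constF a ⊛ constF b
constF-* a b zero    = refl
constF-* a b (suc k) = sym (trans (constF-⊛ a (constF b) (suc k)) (ℤₚ.*-zeroʳ a))

open PolyEval FPS-ring constF public
open Correct (λ _ → refl) (λ _ → refl) constF-+ constF-* public

shiftQ-cong≤ : ∀ s n {g h : FPS} → (∀ k → k ≤ n → g k ≡ h k) → shiftQ s g n ≡ shiftQ s h n
shiftQ-cong≤ zero    n       p = p n ℕₚ.≤-refl
shiftQ-cong≤ (suc s) zero    p = refl
shiftQ-cong≤ (suc s) (suc n) p = shiftQ-cong≤ s n (λ k k≤n → p k (ℕₚ.m≤n⇒m≤1+n k≤n))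

shiftQ-cong : ∀ s {g h : FPS} → g ≈ h → shiftQ s g ≈ shiftQ s h
shiftQ-cong s p n = shiftQ-cong≤ s n (λ k _ → p k)

shiftQ-⊕ : ∀ s g h → shiftQ s (g ⊕ h) ≈ shiftQ s g ⊕ shiftQ s h
shiftQ-⊕ zero    g h k       = refl
shiftQ-⊕ (suc s) g h zero    = refl
shiftQ-⊕ (suc s) g h (suc k) = shiftQ-⊕ s g h k

shiftQ-scale : ∀ s c g → shiftQ s (scale c g) ≈ scale c (shiftQ s g)
shiftQ-scale zero    c g k       = refl
shiftQ-scale (suc s) c g zero    = sym (ℤₚ.*-zeroʳ c)
shiftQ-scale (suc s) c g (suc k) = shiftQ-scale s c g k

shiftQ-suc : ∀ s g → shiftQ (suc s) g ≈ shiftQ 1 (shiftQ s g)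
shiftQ-suc s g zero    = refl
shiftQ-suc s g (suc k) = refl

shiftQ1-⊛ : ∀ g h → shiftQ 1 g ⊛ h ≈ shiftQ 1 (g ⊛ h)
shiftQ1-⊛ g h zero    = refl
shiftQ1-⊛ g h (suc k) = trans (⊛-suc (shiftQ 1 g) h k) (ℤₚ.+-identityˡ _)

shiftQ-⊛ : ∀ s g h → shiftQ s g ⊛ h ≈ shiftQ s (g ⊛ h)
shiftQ-⊛ zero    g h = F.refl
shiftQ-⊛ (suc s) g h = F.trans (F.*-congʳ {h} (shiftQ-suc s g)) (F.trans (shiftQ1-⊛ (shiftQ s g) h)
  (F.trans (shiftQ-cong 1 (shiftQ-⊛ s g h)) (F.sym (shiftQ-suc s (g ⊛ h)))))

q : FPS
q = shiftQ 1 oneF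

shiftQ≈q^ : ∀ s g → shiftQ s g ≈ q ^ s ⊛ g
shiftQ≈q^ zero    g = F.sym (F.*-identityˡ g)
shiftQ≈q^ (suc s) g = F.trans (shiftQ-suc s g) (F.trans (shiftQ-cong 1 (shiftQ≈q^ s g))
  (F.sym (F.trans (F.*-assoc q (q ^ s) g) (F.trans (shiftQ1-⊛ oneF (q ^ s ⊛ g)) (shiftQ-cong 1 (F.*-identityˡ _))))))

q^-shiftQ : ∀ s → q ^ s ≈ shiftQ s oneF
q^-shiftQ s = F.trans (F.sym (F.*-identityʳ (q ^ s))) (F.sym (shiftQ≈q^ s oneF))

Ord : ℕ → FPS → Set
Ord N g = ∀ k → k < N → g k ≡ + 0

Ord-⊛ˡ : ∀ {N} g h → Ord N h → Ord N (g ⊛ h)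
Ord-⊛ˡ g h o k k<N = trans (⊛-cong≤ k {g} {g} {h} {zeroF} (λ _ _ → refl)
  (λ j j≤k → trans (o j (ℕₚ.≤-<-trans j≤k k<N)) (sym (zeroF-at j)))) (trans (F.zeroʳ g k) (zeroF-at k))

Ord-cong : ∀ {N g h} → g ≈ h → Ord N g → Ord N h
Ord-cong p o k k<N = trans (sym (p k)) (o k k<N)

Ord-≤ : ∀ {M N g} → M ≤ N → Ord N g → Ord M g
Ord-≤ M≤N o k k<M = o k (ℕₚ.<-≤-trans k<M M≤N)

Ord-shiftQ : ∀ s {N g} → Ord N g → Ord (s + N) (shiftQ s g)
Ord-shiftQ zero    o k       k<        = o k k<
Ord-shiftQ (suc s) o zero    _         = refl
Ord-shiftQ (suc s) o (suc k) (s≤s k<)  = Ord-shiftQ s o k k<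

Ord-unshiftQ : ∀ s {N} g → Ord (s + N) (shiftQ s g) → Ord N g
Ord-unshiftQ zero    g o k k<N = o k k<N
Ord-unshiftQ (suc s) g o k k<N = Ord-unshiftQ s g (λ j j< → o (suc j) (s≤s j<)) k k<N

Ord-q^ : ∀ n g → Ord n (q ^ n ⊛ g)
Ord-q^ n g = Ord-cong (shiftQ≈q^ n g) (λ k k<n → Ord-shiftQ n {0} {g} (λ _ ()) k (subst (k <_) (sym (ℕₚ.+-identityʳ n)) k<n))

infix 4 _≈[≤_]_
_≈[≤_]_ : FPS → ℕ → FPS → Set
g ≈[≤ n ] h = ∀ k → k ≤ n → g k ≡ h k

≈[≤]-⊛ : ∀ {n g g′ h h′} → g ≈[≤ n ] g′ → h ≈[≤ n ] h′ → g ⊛ h ≈[≤ n ] g′ ⊛ h′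
≈[≤]-⊛ p r k k≤n = ⊛-cong≤ k (λ j j≤k → p j (ℕₚ.≤-trans j≤k k≤n)) (λ j j≤k → r j (ℕₚ.≤-trans j≤k k≤n))

inv-unique : ∀ g h → g 0 ≡ + 1 → g ⊛ h ≈ oneF → h ≈ inv g
inv-unique g h g₀ gh = F.trans (F.sym (F.*-identityʳ h)) (F.trans (F.*-congˡ {h} (F.sym (⊛-inv g g₀)))
  (F.trans (solve 3 (λ g h i → h :* (g :* i) , g :* h :* i) refl g h (inv g))
  (F.trans (F.*-congʳ {inv g} gh) (F.*-identityˡ (inv g)))))

-- This replaces division throughout. Together with the cancellation of `q` and of nonzero integers
-- it covers every factor that has to be removed, without an appeal to absence of zero divisors.
unit-cancelˡ : ∀ u {g h} → u 0 ≡ + 1 → u ⊛ g ≈ u ⊛ h → g ≈ h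
unit-cancelˡ u {g} {h} u₀ p = F.trans (F.sym (undo g)) (F.trans (F.*-congˡ {inv u} p) (undo h))
  where
  undo : ∀ g → inv u ⊛ (u ⊛ g) ≈ g
  undo g = F.trans (solve 3 (λ u i g → i :* (u :* g) , u :* i :* g) refl u (inv u) g)
    (F.trans (F.*-congʳ {g} (⊛-inv u u₀)) (F.*-identityˡ g))

Ord-unit : ∀ {N} u g → u 0 ≡ + 1 → Ord N (u ⊛ g) → Ord N g
Ord-unit u g u₀ o = Ord-cong (F.trans (solve 3 (λ u i g → i :* (u :* g) , u :* i :* g) refl u (inv u) g)
    (F.trans (F.*-congʳ {g} (⊛-inv u u₀)) (F.*-identityˡ g))) (Ord-⊛ˡ (inv u) (u ⊛ g) o)

q-cancelˡ : ∀ {g h} → q ⊛ g ≈ q ⊛ h → g ≈ h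
q-cancelˡ {g} {h} p k = trans (sym (F.*-identityˡ g k)) (trans (trans (sym (shiftQ1-⊛ oneF g (suc k)))
  (trans (p (suc k)) (shiftQ1-⊛ oneF h (suc k)))) (F.*-identityˡ h k))

constF-cancelˡ : ∀ c .{{_ : ℤ.NonZero c}} {g h} → constF c ⊛ g ≈ constF c ⊛ h → g ≈ h
constF-cancelˡ c {g} {h} p k = ℤₚ.*-cancelˡ-≡ c (g k) (h k)
  (trans (sym (constF-⊛ c g k)) (trans (p k) (constF-⊛ c h k)))

-- Substitution and dissection

-- str r g c has the coefficients of g spaced r + 1 apart, the first one at index c.
str : ℕ → FPS → ℕ → FPS
str r g zero    zero    = g 0
str r g zero    (suc n) = str r (tailF g) r n
str r g (suc c) zero    = + 0
str r g (suc c) (suc n) = str r g c n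

-- The substitution q ↦ q^r; stretch 0 is a junk value.
stretch : ℕ → FPS → FPS
stretch zero    g = g
stretch (suc r) g = str r g 0

str-shiftQ : ∀ r g c → str r g c ≈ shiftQ c (str r g 0)
str-shiftQ r g zero    n       = refl
str-shiftQ r g (suc c) zero    = refl
str-shiftQ r g (suc c) (suc n) = str-shiftQ r g c n

str-cong : ∀ r {g h} c → g ≈ h → str r g c ≈ str r h c
str-cong r zero    p zero    = p 0
str-cong r zero    p (suc n) = str-cong r r (λ k → p (suc k)) n
str-cong r (suc c) p zero    = refl
str-cong r (suc c) p (suc n) = str-cong r c p n

stretch-cong : ∀ r {g h} → g ≈ h → stretch r g ≈ stretch r h
stretch-cong zero    p = p
stretch-cong (suc r) p = str-cong r 0 p

str-cong≤ : ∀ r {g h} c n → g ≈[≤ n ] h → str r g c n ≡ str r h c n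
str-cong≤ r zero    zero    p = p 0 z≤n
str-cong≤ r zero    (suc n) p = str-cong≤ r r n (λ k k≤n → p (suc k) (s≤s k≤n))
str-cong≤ r (suc c) zero    p = refl
str-cong≤ r (suc c) (suc n) p = str-cong≤ r c n (λ k k≤n → p k (ℕₚ.m≤n⇒m≤1+n k≤n))

stretch-≈[≤] : ∀ r {n g h} → g ≈[≤ n ] h → stretch r g ≈[≤ n ] stretch r h
stretch-≈[≤] zero    p k k≤n = p k k≤n
stretch-≈[≤] (suc r) p k k≤n = str-cong≤ r 0 k (λ j j≤k → p j (ℕₚ.≤-trans j≤k k≤n))

str-⊕ : ∀ r g h c → str r (g ⊕ h) c ≈ str r g c ⊕ str r h c
str-⊕ r g h zero    zero    = refl
str-⊕ r g h zero    (suc n) = str-⊕ r (tailF g) (tailF h) r n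
str-⊕ r g h (suc c) zero    = refl
str-⊕ r g h (suc c) (suc n) = str-⊕ r g h c n

stretch-⊕ : ∀ r g h → stretch r (g ⊕ h) ≈ stretch r g ⊕ stretch r h
stretch-⊕ zero    g h = F.refl
stretch-⊕ (suc r) g h = str-⊕ r g h 0

str-scale : ∀ r a g c → str r (scale a g) c ≈ scale a (str r g c)
str-scale r a g zero    zero    = refl
str-scale r a g zero    (suc n) = str-scale r a (tailF g) r n
str-scale r a g (suc c) zero    = sym (ℤₚ.*-zeroʳ a)
str-scale r a g (suc c) (suc n) = str-scale r a g c n

stretch-scale : ∀ r a g → stretch r (scale a g) ≈ scale a (stretch r g)
stretch-scale zero    a g = F.refl
stretch-scale (suc r) a g = str-scale r a g 0

str-zero : ∀ r g c → (∀ k → g k ≡ + 0) → ∀ n → str r g c n ≡ + 0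
str-zero r g zero    z zero    = z 0
str-zero r g zero    z (suc n) = str-zero r (tailF g) r (λ k → z (suc k)) n
str-zero r g (suc c) z zero    = refl
str-zero r g (suc c) z (suc n) = str-zero r g c z n

stretch-constF : ∀ r c → stretch r (constF c) ≈ constF c
stretch-constF zero    c k       = refl
stretch-constF (suc r) c zero    = refl
stretch-constF (suc r) c (suc k) = str-zero r (tailF (constF c)) r (λ _ → refl) k

-- Strong induction on the index, with n as its bound: once the constant term of g is split off, the
-- product with the tail occurs shifted by r + 1, hence only at smaller indices.
stretch-⊛ : ∀ r g h → stretch r (g ⊛ h) ≈ stretch r g ⊛ stretch r h
stretch-⊛ zero    g h = F.refl
stretch-⊛ (suc r) g h n = below n n ℕₚ.≤-refl g h
  where
  S : FPS → FPS
  S g = str r g 0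
  below : ∀ n k → k ≤ n → ∀ g h → S (g ⊛ h) k ≡ (S g ⊛ S h) k
  below n       zero    _         g h = refl
  below (suc n) (suc k) (s≤s k≤n) g h = trans (str-cong r r (⊛-suc g h) k) (trans
    (str-⊕ r (scale (g 0) (tailF h)) (tailF g ⊛ h) r k) (trans
    (cong₂ ℤ._+_ (str-scale r (g 0) (tailF h) r k) (trans (str-shiftQ r (tailF g ⊛ h) r k)
      (trans (shiftQ-cong≤ r k (λ j j≤k → below n j (ℕₚ.≤-trans j≤k k≤n) (tailF g) h))
      (trans (sym (shiftQ-⊛ r (S (tailF g)) (S h) k))
        (⊛-cong {h = S h} (λ j → sym (str-shiftQ r (tailF g) r j)) (λ _ → refl) k)))))
    (sym (⊛-suc (S g) (S h) k))))

stretch-^ : ∀ r g n → stretch r (g ^ n) ≈ stretch r g ^ n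
stretch-^ r g zero    = stretch-constF r (+ 1)
stretch-^ r g (suc n) = F.trans (stretch-⊛ r g (g ^ n)) (F.*-congˡ {stretch r g} (stretch-^ r g n))

str-q : ∀ r → str r q 0 ≈ shiftQ (suc r) oneF
str-q r zero    = refl
str-q r (suc n) = trans (str-shiftQ r oneF r n) (shiftQ-cong r (stretch-constF (suc r) (+ 1)) n)

stretch-q : ∀ r → stretch (suc r) q ≈ q ^ suc r
stretch-q r = F.trans (str-q r) (F.sym (q^-shiftQ (suc r)))

Ord-stretch : ∀ r {N} g → Ord N g → Ord (suc r * N) (stretch (suc r) g)
Ord-stretch r {N} g o = go N g o 0
  where
  go : ∀ N g → Ord N g → ∀ c k → k < c + suc r * N → str r g c k ≡ + 0
  go zero    g o zero    k       k<       = contradiction (subst (k <_) (ℕₚ.*-zeroʳ r) k<) λ ()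
  go (suc N) g o zero    zero    _        = o 0 (s≤s z≤n)
  go (suc N) g o zero    (suc k) k<       = go N (tailF g) (λ j j< → o (suc j) (s≤s j<)) r k
    (ℕₚ.≤-pred (subst (suc (suc k) ≤_) (ℕₚ.*-suc (suc r) N) k<))
  go N       g o (suc c) zero    _        = refl
  go N       g o (suc c) (suc k) (s≤s k<) = go N g o c k k<

-- `comp 0` is `U5` by definition, so the rules for `comp` serve for `U5` as well.
comp : ℕ → FPS → FPS
comp i g k = g (i + 5 * k)

five-suc : ∀ i k → i + 5 * suc k ≡ 5 + (i + 5 * k)
five-suc i k = trans (cong (i ℕ.+_) (ℕₚ.*-suc 5 k)) (trans (sym (ℕₚ.+-assoc i 5 (5 * k)))
  (trans (cong (ℕ._+ 5 * k) (ℕₚ.+-comm i 5)) (ℕₚ.+-assoc 5 i (5 * k))))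

-- A series in q⁵ preserves residues mod 5. Splitting off the constant term of g leaves a factor q⁵,
-- which lowers k by one; at k = 0 that part contributes nothing because i < 5.
comp-stretch⊛ : ∀ i → i < 5 → ∀ g h → comp i (stretch 5 g ⊛ h) ≈ g ⊛ comp i h
comp-stretch⊛ i i<5 g h k = trans (split (i + 5 * k)) (go k)
  where
  split : stretch 5 g ⊛ h ≈ scale (g 0) h ⊕ shiftQ 5 (stretch 5 (tailF g) ⊛ h)
  split = F.trans (F.*-congʳ {h} pieces) (F.trans (F.distribʳ h (constF (g 0)) (shiftQ 5 (stretch 5 (tailF g))))
    (F.+-cong (constF-⊛ (g 0) h) (shiftQ-⊛ 5 (stretch 5 (tailF g)) h)))
    where
    pieces : stretch 5 g ≈ constF (g 0) ⊕ shiftQ 5 (stretch 5 (tailF g))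
    pieces zero    = sym (ℤₚ.+-identityʳ (g 0))
    pieces (suc n) = trans (str-shiftQ 4 (tailF g) 4 n) (sym (ℤₚ.+-identityˡ _))
  below-5 : ∀ i → i < 5 → ∀ h → shiftQ 5 h (i + 0) ≡ + 0
  below-5 0 _ h = refl
  below-5 1 _ h = refl
  below-5 2 _ h = refl
  below-5 3 _ h = refl
  below-5 4 _ h = refl
  below-5 (suc (suc (suc (suc (suc _))))) (s≤s (s≤s (s≤s (s≤s (s≤s ()))))) h
  go : ∀ k → (scale (g 0) h ⊕ shiftQ 5 (stretch 5 (tailF g) ⊛ h)) (i + 5 * k) ≡ (g ⊛ comp i h) k
  go zero    = trans (cong (ℤ._+_ (g 0 ℤ.* h (i + 0))) (below-5 i i<5 (stretch 5 (tailF g) ⊛ h))) (ℤₚ.+-identityʳ _)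
  go (suc k) = trans (cong (ℤ._+_ (g 0 ℤ.* comp i h (suc k)))
      (trans (cong (shiftQ 5 (stretch 5 (tailF g) ⊛ h)) (five-suc i k)) (comp-stretch⊛ i i<5 (tailF g) h k)))
    (sym (⊛-suc g (comp i h) k))

comp-cong : ∀ i {g h} → g ≈ h → comp i g ≈ comp i h
comp-cong i p k = p (i + 5 * k)

comp-ext : ∀ {g h} → (∀ i → i < 5 → comp i g ≈ comp i h) → g ≈ h
comp-ext {g} {h} p n = subst (λ j → g j ≡ h j) (sym n≡) (p (n % 5) (m%n<n n 5) (n / 5))
  where
  n≡ : n ≡ n % 5 + 5 * (n / 5)
  n≡ = trans (m≡m%n+[m/n]*n n 5) (cong (n % 5 ℕ.+_) (ℕₚ.*-comm (n / 5) 5))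

residue : ∀ {i j k l} → i < 5 → j < 5 → i + 5 * k ≡ j + 5 * l → i ≡ j
residue {i} {j} {k} {l} i<5 j<5 p = trans (sym (mod i k i<5)) (trans (cong (_% 5) p) (mod j l j<5))
  where
  mod : ∀ i k → i < 5 → (i + 5 * k) % 5 ≡ i
  mod i k i<5 = trans (cong (λ m → (i + m) % 5) (ℕₚ.*-comm 5 k)) (trans ([m+kn]%n≡m%n i k 5) (m<n⇒m%n≡m i<5))

shiftQ-constF-≢ : ∀ s c n → n ≢ s → shiftQ s (constF c) n ≡ + 0
shiftQ-constF-≢ zero    c zero    n≢s = contradiction refl n≢s
shiftQ-constF-≢ zero    c (suc n) n≢s = refl
shiftQ-constF-≢ (suc s) c zero    n≢s = refl
shiftQ-constF-≢ (suc s) c (suc n) n≢s = shiftQ-constF-≢ s c n (λ p → n≢s (cong suc p))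

shiftQ-constF-≡ : ∀ s c → shiftQ s (constF c) s ≡ c
shiftQ-constF-≡ zero    c = refl
shiftQ-constF-≡ (suc s) c = shiftQ-constF-≡ s c

comp-q^-≢ : ∀ i j → i < 5 → j < 5 → i ≢ j → comp i (q ^ j) ≈ zeroF
comp-q^-≢ i j i<5 j<5 i≢j k = trans (q^-shiftQ j (i + 5 * k)) (trans
  (shiftQ-constF-≢ j (+ 1) (i + 5 * k) (λ p → i≢j (residue {i} {j} {k} {0} i<5 j<5 (trans p (sym (ℕₚ.+-identityʳ j))))))
  (sym (zeroF-at k)))

comp-q^-≡ : ∀ i → i < 5 → comp i (q ^ i) ≈ oneF
comp-q^-≡ i i<5 zero    = trans (q^-shiftQ i (i + 0)) (trans (cong (shiftQ i oneF) (ℕₚ.+-identityʳ i)) (shiftQ-constF-≡ i (+ 1)))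
comp-q^-≡ i i<5 (suc k) = trans (q^-shiftQ i (i + 5 * suc k)) (shiftQ-constF-≢ i (+ 1) (i + 5 * suc k)
  (λ p → contradiction (ℕₚ.+-cancelˡ-≡ i (5 * suc k) 0 (trans p (sym (ℕₚ.+-identityʳ i)))) λ ()))

dissect : FPS → FPS → FPS → FPS → FPS → FPS
dissect g₀ g₁ g₂ g₃ g₄ = stretch 5 g₀ ⊛ q ^ 0 ⊕ stretch 5 g₁ ⊛ q ^ 1 ⊕ stretch 5 g₂ ⊛ q ^ 2 ⊕ stretch 5 g₃ ⊛ q ^ 3 ⊕ stretch 5 g₄ ⊛ q ^ 4

module _ (g₀ g₁ g₂ g₃ g₄ : FPS) where
  private
    D : FPS
    D = dissect g₀ g₁ g₂ g₃ g₄

    part : ∀ i → i < 5 → comp i D ≈ g₀ ⊛ comp i (q ^ 0) ⊕ g₁ ⊛ comp i (q ^ 1) ⊕ g₂ ⊛ comp i (q ^ 2) ⊕ g₃ ⊛ comp i (q ^ 3) ⊕ g₄ ⊛ comp i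
        (q ^ 4)
    part i i<5 k = cong₂ ℤ._+_ (cong₂ ℤ._+_ (cong₂ ℤ._+_ (cong₂ ℤ._+_ (comp-stretch⊛ i i<5 g₀ (q ^ 0) k)
      (comp-stretch⊛ i i<5 g₁ (q ^ 1) k)) (comp-stretch⊛ i i<5 g₂ (q ^ 2) k)) (comp-stretch⊛ i i<5 g₃ (q ^ 3) k))
          (comp-stretch⊛ i i<5 g₄ (q ^ 4) k)

    0<5 : 0 < 5
    0<5 = s≤s z≤n
    1<5 : 1 < 5
    1<5 = s≤s (s≤s z≤n)
    2<5 : 2 < 5
    2<5 = s≤s (s≤s (s≤s z≤n))
    3<5 : 3 < 5
    3<5 = s≤s (s≤s (s≤s (s≤s z≤n)))
    4<5 : 4 < 5
    4<5 = s≤s (s≤s (s≤s (s≤s (s≤s z≤n))))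

    kill : ∀ g i j → i < 5 → j < 5 → i ≢ j → g ⊛ comp i (q ^ j) ≈ zeroF
    kill g i j i<5 j<5 i≢j = F.trans (F.*-congˡ {g} (comp-q^-≢ i j i<5 j<5 i≢j)) (F.zeroʳ g)

    keep : ∀ g i → i < 5 → g ⊛ comp i (q ^ i) ≈ g
    keep g i i<5 = F.trans (F.*-congˡ {g} (comp-q^-≡ i i<5)) (F.*-identityʳ g)

    assemble : ∀ i → i < 5 → ∀ {h₀ h₁ h₂ h₃ h₄} → g₀ ⊛ comp i (q ^ 0) ≈ h₀ → g₁ ⊛ comp i (q ^ 1) ≈ h₁ →
      g₂ ⊛ comp i (q ^ 2) ≈ h₂ → g₃ ⊛ comp i (q ^ 3) ≈ h₃ → g₄ ⊛ comp i (q ^ 4) ≈ h₄ → comp i D ≈ h₀ ⊕ h₁ ⊕ h₂ ⊕ h₃ ⊕ h₄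
    assemble i i<5 p₀ p₁ p₂ p₃ p₄ = F.trans (part i i<5) (F.+-cong (F.+-cong (F.+-cong (F.+-cong p₀ p₁) p₂) p₃) p₄)

  comp₀-dissect : comp 0 D ≈ g₀
  comp₀-dissect = F.trans (assemble 0 0<5 (keep g₀ 0 0<5) (kill g₁ 0 1 0<5 1<5
      λ ()) (kill g₂ 0 2 0<5 2<5 λ ()) (kill g₃ 0 3 0<5 3<5 λ ()) (kill g₄ 0 4 0<5 4<5 λ ()))
    (solve 1 (λ g → g :+ :0 :+ :0 :+ :0 :+ :0 , g) refl g₀)

  comp₁-dissect : comp 1 D ≈ g₁
  comp₁-dissect = F.trans (assemble 1 1<5 (kill g₀ 1 0 1<5 0<5 λ ()) (keep g₁ 1 1<5) (kill g₂ 1 2 1<5 2<5 λ ()) (kill g₃ 1 3 1<5 3<5 λ ()) (kill g₄ 1 4 1<5 4<5 λ ()))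
    (solve 1 (λ g → :0 :+ g :+ :0 :+ :0 :+ :0 , g) refl g₁)

  comp₂-dissect : comp 2 D ≈ g₂
  comp₂-dissect = F.trans (assemble 2 2<5 (kill g₀ 2 0 2<5 0<5 λ ()) (kill g₁ 2 1 2<5 1<5 λ ()) (keep g₂ 2 2<5) (kill g₃ 2 3 2<5 3<5 λ ()) (kill g₄ 2 4 2<5 4<5 λ ()))
    (solve 1 (λ g → :0 :+ :0 :+ g :+ :0 :+ :0 , g) refl g₂)

  comp₃-dissect : comp 3 D ≈ g₃
  comp₃-dissect = F.trans (assemble 3 3<5 (kill g₀ 3 0 3<5 0<5 λ ()) (kill g₁ 3 1 3<5 1<5 λ ()) (kill g₂ 3 2 3<5 2<5 λ ()) (keep g₃ 3 3<5) (kill g₄ 3 4 3<5 4<5 λ ()))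
    (solve 1 (λ g → :0 :+ :0 :+ :0 :+ g :+ :0 , g) refl g₃)

  comp₄-dissect : comp 4 D ≈ g₄
  comp₄-dissect = F.trans (assemble 4 4<5 (kill g₀ 4 0 4<5 0<5 λ ()) (kill g₁ 4 1 4<5 1<5 λ ()) (kill g₂ 4 2 4<5 2<5 λ ()) (kill g₃ 4 3 4<5 3<5 λ ()) (keep g₄ 4 4<5))
    (solve 1 (λ g → :0 :+ :0 :+ :0 :+ :0 :+ g , g) refl g₄)

comp-dissect : ∀ g → g ≈ dissect (comp 0 g) (comp 1 g) (comp 2 g) (comp 3 g) (comp 4 g)
comp-dissect g = comp-ext λ
  { 0 _ → F.sym (comp₀-dissect g₀ g₁ g₂ g₃ g₄)
  ; 1 _ → F.sym (comp₁-dissect g₀ g₁ g₂ g₃ g₄)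
  ; 2 _ → F.sym (comp₂-dissect g₀ g₁ g₂ g₃ g₄)
  ; 3 _ → F.sym (comp₃-dissect g₀ g₁ g₂ g₃ g₄)
  ; 4 _ → F.sym (comp₄-dissect g₀ g₁ g₂ g₃ g₄)
  ; (suc (suc (suc (suc (suc _))))) (s≤s (s≤s (s≤s (s≤s (s≤s ()))))) }
  where
  g₀ = comp 0 g
  g₁ = comp 1 g
  g₂ = comp 2 g
  g₃ = comp 3 g
  g₄ = comp 4 g

-- Euler products as limits of finite products

q^-+ : ∀ {l} m n → l ≡ m + n → q ^ l ≈ q ^ m ⊛ q ^ n
q^-+ m n refl = ^-homo-* q m n

oneMinusQ≈ : ∀ m → oneMinusQ m ≈ oneF F.+ F.- (q ^ m)
oneMinusQ≈ m = F.+-congˡ {oneF} (F.-‿cong (F.sym (q^-shiftQ m)))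

^-0 : ∀ g n → g 0 ≡ + 1 → (g ^ n) 0 ≡ + 1
^-0 g zero    p = refl
^-0 g (suc n) p = cong₂ ℤ._*_ p (^-0 g n p)

q^suc-0 : ∀ n → (q ^ suc n) 0 ≡ + 0
q^suc-0 n = q^-shiftQ (suc n) 0

stretch-oneMinusQ : ∀ r m → stretch (suc r) (oneMinusQ m) ≈ oneMinusQ (suc r * m)
stretch-oneMinusQ r m = F.trans (stretch-⊕ (suc r) oneF _) (F.+-cong (stretch-constF (suc r) (+ 1))
  (F.trans (stretch-scale (suc r) ℤ.-1ℤ (shiftQ m oneF)) (F.-‿cong (F.trans (stretch-cong (suc r) (F.sym (q^-shiftQ m)))
  (F.trans (stretch-^ (suc r) q m) (F.trans (^-congˡ m (stretch-q r)) (F.trans (^-assocʳ q (suc r) m) (q^-shiftQ (suc r * m)))))))))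

stretch-eulerPartial : ∀ r s N → stretch (suc r) (eulerPartial s N) ≈ eulerPartial (suc r * s) N
stretch-eulerPartial r s zero    = stretch-constF (suc r) (+ 1)
stretch-eulerPartial r s (suc N) = F.trans (stretch-⊛ (suc r) (eulerPartial s N) _) (F.*-cong (stretch-eulerPartial r s N)
  (F.trans (stretch-oneMinusQ r (s * suc N)) (λ k → cong (λ m → oneMinusQ m k) (sym (ℕₚ.*-assoc (suc r) s (suc N))))))

-- A factor of index above k is 1 up to terms beyond q^k, so taking N factors instead of k does not
-- affect coefficient k.
f≈eulerPartial : ∀ r N → f (suc r) ≈[≤ N ] eulerPartial (suc r) N
f≈eulerPartial r zero    zero z≤n = refl
f≈eulerPartial r (suc N) k k≤ with ℕₚ.m≤n⇒m<n∨m≡n k≤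
... | inj₂ refl = refl
... | inj₁ (s≤s k≤N) = trans (f≈eulerPartial r N k k≤N) (sym (trans
  (≈[≤]-⊛ {N} {eulerPartial (suc r) N} {eulerPartial (suc r) N} (λ _ _ → refl) low k k≤N) (F.*-identityʳ (eulerPartial (suc r) N) k)))
  where
  low : oneMinusQ (suc r * suc N) ≈[≤ N ] oneF
  low j j≤N = trans (cong (λ c → oneF j ℤ.+ ℤ.-1ℤ ℤ.* c) (shiftQ-constF-≢ (suc r * suc N) (+ 1) j
    (ℕₚ.<⇒≢ (ℕₚ.<-≤-trans (s≤s j≤N) (ℕₚ.m≤m+n (suc N) _))))) (ℤₚ.+-identityʳ (oneF j))

≈[≤]⇒≈ : ∀ {g h} → (∀ n → g ≈[≤ n ] h) → g ≈ h
≈[≤]⇒≈ p k = p k k ℕₚ.≤-refl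

stretch-f : ∀ r s → stretch (suc r) (f (suc s)) ≈ f (suc r * suc s)
stretch-f r s = ≈[≤]⇒≈ {stretch (suc r) (f (suc s))} λ n k k≤n → trans (stretch-≈[≤] (suc r) (f≈eulerPartial s n) k k≤n)
  (trans (stretch-eulerPartial r (suc s) n k) (sym (f≈eulerPartial (s + r * suc s) n k k≤n)))

E : ℕ → FPS
E = eulerPartial 1

E-suc : ∀ n → E (suc n) ≈ E n ⊛ (oneF F.+ F.- (q ^ suc n))
E-suc n = F.*-congˡ {E n} (F.trans (λ k → cong (λ m → oneMinusQ m k) (ℕₚ.+-identityʳ (suc n))) (oneMinusQ≈ (suc n)))

E-0 : ∀ n → E n 0 ≡ + 1
E-0 zero    = refl
E-0 (suc n) = trans (ℤₚ.*-identityʳ _) (E-0 n)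

-- The theta series of f 1 and f 1² / f 2

sg : ℕ → FPS
sg n = constF ℤ.-1ℤ ^ n

tri : ℕ → ℕ
tri zero    = 0
tri (suc n) = suc n + tri n

sumF-Ord : ∀ n (t : ℕ → FPS) m → (∀ s → Ord (suc n) (t (suc s))) → sumF t m ≈[≤ n ] t 0
sumF-Ord n t zero    o k k≤n = refl
sumF-Ord n t (suc m) o k k≤n = trans (cong₂ ℤ._+_ (sumF-Ord n t m o k k≤n) (o m k (s≤s k≤n))) (ℤₚ.+-identityʳ _)

-- Grouping the sum over |j| ≤ M by ±j matches the pair of terms that each step of the telescoping
-- proofs adds.
zsF : ℕ → (ℤ → FPS) → FPS
zsF zero    g = g (+ 0)
zsF (suc M) g = zsF M g ⊕ (g (+ suc M) ⊕ g -[1+ M ])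

-- The generalized pentagonal number j (3j - 1) / 2, written without division; `pent2` gives the
-- familiar form.
pent : ℤ → ℕ
pent (+ 0)      = 0
pent (+ suc n)  = suc n * suc n + tri n
pent -[1+ n ]   = suc n * suc n + tri (suc n)

pentTerm : ℤ → FPS
pentTerm j = sg ∣ j ∣ ⊛ q ^ pent j

-- Shanks's telescoping proof of the pentagonal number theorem.
module Pentagonal where

  I : ℕ → FPS
  I n = inv (E n)

  E⊛I : ∀ n → E n ⊛ I n ≈ oneF
  E⊛I n = ⊛-inv (E n) (E-0 n)

  I-suc : ∀ n → I n ≈ I (suc n) ⊛ (oneF F.+ F.- (q ^ suc n))
  I-suc n = F.sym (inv-unique (E n) _ (E-0 n) (F.trans (solve 3 (λ e i a → e :* (i :* a) , e :* a :* i) refl (E n) (I (suc n)) _)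
    (F.trans (F.*-congʳ {I (suc n)} (F.sym (E-suc n))) (E⊛I (suc n)))))

  t : ℕ → ℕ → FPS
  t n s = sg s ⊛ (E n ⊛ (I s ⊛ q ^ (s * n + tri s)))

  -- Replacing E n by E (n+1) multiplies each summand by 1 - q^(n+1) and shifts its power of q;
  -- consecutive summands then cancel and one boundary term is left.
  telescope : ∀ n m → sumF (t (suc n)) m ≈ sumF (t n) m F.+ F.- (sg m ⊛ (E n ⊛ (I m ⊛ q ^ (suc m * suc n + tri m))))
  telescope n zero = F.trans (F.*-congˡ {sg 0} (F.*-congʳ {I 0 ⊛ q ^ 0} (E-suc n))) (F.trans
    (solve 3 (λ e i b → :1 :* (e :* (:1 :- b) :* (i :* :1)) ,
      :1 :* (e :* (i :* :1)) :- :1 :* (e :* (i :* b))) refl (E n) (I 0) (q ^ suc n))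
    (F.+-congˡ {t n 0} (F.-‿cong (F.*-congˡ {sg 0} (F.*-congˡ {E n} (F.*-congˡ {I 0} (^-congʳ q (sym (e₀ n)))))))))
    where
    e₀ : ∀ n → suc n + 0 + 0 ≡ suc n
    e₀ = solveℕ-∀
  telescope n (suc m) = F.trans (F.+-cong (F.trans (telescope n m) (F.+-congˡ {sumF (t n) m} (F.-‿cong (F.*-congˡ {sg m} (F.*-congˡ {E n}
      (F.*-cong (I-suc m) (^-congʳ q (e₁ m n (tri m)))))))))
      (F.*-congˡ {sg (suc m)} (F.*-cong (E-suc n) (F.*-congˡ {I (suc m)} (q^-+ (suc m * n + tri (suc m)) (suc m) (e₂ m n (tri m)))))))
    (F.trans (solve 7 (λ T σ e i Z a b → T :- σ :* (e :* (i :* (:1 :- a) :* Z)) :+ con ℤ.-1ℤ :* σ :* (e :* (:1 :- b) :* (i :* (Z :* a))) ,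
        T :+ con ℤ.-1ℤ :* σ :* (e :* (i :* Z)) :- con ℤ.-1ℤ :* σ :* (e :* (i :* (Z :* (a :* b))))) refl
        (sumF (t n) m) (sg m) (E n) (I (suc m)) (q ^ (suc m * n + tri (suc m))) (q ^ suc m) (q ^ suc n))
    (F.+-congˡ {sumF (t n) (suc m)} (F.-‿cong (F.*-congˡ {sg (suc m)} (F.*-congˡ {E n} (F.*-congˡ {I (suc m)} (F.sym
      (F.trans (q^-+ (suc m * n + tri (suc m)) (suc m + suc n) (e₃ m n (tri m)))
          (F.*-congˡ {q ^ (suc m * n + tri (suc m))} (^-homo-* q (suc m) (suc n)))))))))))
    where
    e₁ : ∀ m n t → suc m * suc n + t ≡ suc m * n + (suc m + t)
    e₁ = solveℕ-∀
    e₂ : ∀ m n t → suc m * suc n + (suc m + t) ≡ suc m * n + (suc m + t) + suc m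
    e₂ = solveℕ-∀
    e₃ : ∀ m n t → suc (suc m) * suc n + (suc m + t) ≡ suc m * n + (suc m + t) + (suc m + suc n)
    e₃ = solveℕ-∀

  -- At m = n the quotients of Euler products become 1, so the boundary term and the new last
  -- summand are bare powers of q: the pentagonal terms of n + 1 and of -(n + 1).
  diagonal : ∀ n → sumF (t n) n ≈ zsF n pentTerm
  diagonal zero    = F.trans (F.*-congˡ {sg 0} (F.trans (F.sym (F.*-assoc (E 0) (I 0) oneF)) (F.*-congʳ {oneF} (E⊛I 0))))
    (solve 0 (:1 :* (:1 :* :1) , :1 :* :1) refl)
  diagonal (suc n) = F.trans (F.+-cong (telescope n n) (absorb (suc n) (q ^ (suc n * suc n + tri (suc n)))))
    (F.trans (F.+-congʳ {sg (suc n) ⊛ q ^ (suc n * suc n + tri (suc n))}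
        (F.+-cong (diagonal n) (F.-‿cong (absorb n (q ^ (suc n * suc n + tri n))))))
    (solve 4 (λ Z σ a b → Z :- σ :* a :+ con ℤ.-1ℤ :* σ :* b , Z :+ (con ℤ.-1ℤ :* σ :* a :+ con ℤ.-1ℤ :* σ :* b)) refl
      (zsF n pentTerm) (sg n) (q ^ (suc n * suc n + tri n)) (q ^ (suc n * suc n + tri (suc n)))))
    where
    absorb : ∀ n a → sg n ⊛ (E n ⊛ (I n ⊛ a)) ≈ sg n ⊛ a
    absorb n a = F.*-congˡ {sg n} (F.trans (F.sym (F.*-assoc (E n) (I n) a)) (F.trans (F.*-congʳ {a} (E⊛I n)) (F.*-identityˡ a)))

  high : ∀ n s → Ord (suc n) (t n (suc s))
  high n s = Ord-⊛ˡ (sg (suc s)) _ (Ord-⊛ˡ (E n) _ (Ord-⊛ˡ (I (suc s)) _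
      (Ord-≤ (bound n s) (Ord-cong (F.*-identityʳ _) (Ord-q^ (suc s * n + tri (suc s)) oneF)))))
    where
    bound : ∀ n s → suc n ≤ suc s * n + tri (suc s)
    bound n s = subst (_≤ suc s * n + tri (suc s)) (ℕₚ.+-comm n 1) (ℕₚ.+-mono-≤ (ℕₚ.m≤m+n n (s * n)) (s≤s z≤n))

  -- The summand s = 0 is E n itself, and every later one begins beyond q^n.
  low : ∀ n → E n ≈[≤ n ] zsF n pentTerm
  low n k k≤n = trans (sym (leading k)) (trans (sym (sumF-Ord n (t n) n (high n) k k≤n)) (diagonal n k))
    where
    leading : t n 0 ≈ E n
    leading = F.trans (F.*-identityˡ _) (F.trans (F.*-congˡ {E n} (F.trans (F.*-identityʳ (I 0))
        (F.sym (inv-unique oneF oneF refl (F.*-identityˡ oneF))))) (F.*-identityʳ (E n)))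

f1≈pentagonal : ∀ n → f 1 ≈[≤ n ] zsF n pentTerm
f1≈pentagonal n k k≤n = trans (f≈eulerPartial 0 n k k≤n) (Pentagonal.low n k k≤n)

squareTerm : ℤ → FPS
squareTerm j = sg ∣ j ∣ ⊛ q ^ (∣ j ∣ * ∣ j ∣)

-- Coefficient k needs only |n| ≤ k because n² ≥ |n|.
φ : FPS
φ k = zsF k squareTerm k

zsF-extend : ∀ (g : ℤ → FPS) → (∀ n → Ord (suc n) (g (+ suc n))) → (∀ n → Ord (suc n) (g -[1+ n ])) →
             ∀ n k → k ≤ n → zsF n g k ≡ zsF k g k
zsF-extend g o o′ zero    zero    z≤n = refl
zsF-extend g o o′ (suc n) k k≤ with ℕₚ.m≤n⇒m<n∨m≡n k≤
... | inj₂ refl = refl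
... | inj₁ (s≤s k≤n) = trans (cong₂ ℤ._+_ (zsF-extend g o o′ n k k≤n) (cong₂ ℤ._+_ (o n k (s≤s k≤n)) (o′ n k (s≤s k≤n)))) (ℤₚ.+-identityʳ _)

φ≈squares : ∀ n → φ ≈[≤ n ] zsF n squareTerm
φ≈squares n k k≤n = sym (zsF-extend squareTerm high high n k k≤n)
  where
  high : ∀ n → Ord (suc n) (sg (suc n) ⊛ q ^ (suc n * suc n))
  high n = Ord-⊛ˡ (sg (suc n)) _ (Ord-≤ (ℕₚ.m≤m+n (suc n) _) (Ord-cong (F.*-identityʳ _) (Ord-q^ (suc n * suc n) oneF)))

-- Shanks's telescoping proof of Gauss's identity for Σ (-1)^n q^{n²}.
module Squares where

  1+q^ 1-q^ : ℕ → FPS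
  1+q^ n = oneF ⊕ q ^ n
  1-q^ n = oneF F.+ F.- (q ^ n)

  1+q^-0 : ∀ n → 1+q^ (suc n) 0 ≡ + 1
  1+q^-0 n = cong (ℤ._+_ (+ 1)) (q^suc-0 n)

  1-q^-0 : ∀ n → 1-q^ (suc n) 0 ≡ + 1
  1-q^-0 n = cong (λ c → + 1 ℤ.+ ℤ.-1ℤ ℤ.* c) (q^suc-0 n)

  -- `P n` is the product of (1 - q^i)/(1 + q^i) over 1 ≤ i ≤ n, `N n` that of 1 + q^i, and `J n`
  -- that of (1 + q^(i-1))/(1 - q^i). The factor 1 + q⁰ = 2 in `J` produces the double contribution
  -- of ±n. `W n` is the common part of `P n` and `P (suc n)`.
  P W N J : ℕ → FPS
  P zero    = oneF
  P (suc n) = W n ⊛ 1-q^ (suc n)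
  W n       = P n ⊛ inv (1+q^ (suc n))
  N zero    = oneF
  N (suc n) = N n ⊛ 1+q^ (suc n)
  J zero    = oneF
  J (suc n) = J n ⊛ 1+q^ n ⊛ inv (1-q^ (suc n))

  W⊛1+q^ : ∀ n → W n ⊛ 1+q^ (suc n) ≈ P n
  W⊛1+q^ n = F.trans (solve 3 (λ p i a → p :* i :* a , p :* (a :* i)) refl (P n) (inv (1+q^ (suc n))) (1+q^ (suc n)))
    (F.trans (F.*-congˡ {P n} (⊛-inv (1+q^ (suc n)) (1+q^-0 n))) (F.*-identityʳ (P n)))

  J⊛1-q^ : ∀ n → J (suc n) ⊛ 1-q^ (suc n) ≈ J n ⊛ 1+q^ n
  J⊛1-q^ n = F.trans (solve 3 (λ p i a → p :* i :* a , p :* (a :* i)) refl (J n ⊛ 1+q^ n) (inv (1-q^ (suc n))) (1-q^ (suc n)))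
    (F.trans (F.*-congˡ {J n ⊛ 1+q^ n} (⊛-inv (1-q^ (suc n)) (1-q^-0 n))) (F.*-identityʳ (J n ⊛ 1+q^ n)))

  t : ℕ → ℕ → FPS
  t n s = sg s ⊛ (P n ⊛ (J s ⊛ q ^ (s * suc n)))

  telescope : ∀ n m → sumF (t (suc n)) m ≈ sumF (t n) m F.+ F.- (sg m ⊛ (W n ⊛ ((J m ⊛ 1+q^ m) ⊛ q ^ (suc m * suc n))))
  telescope n zero = F.trans
    (solve 2 (λ w b → :1 :* (w :* (:1 :- b) :* (:1 :* :1)) ,
      :1 :* (w :* (:1 :+ b) :* (:1 :* :1)) :- :1 :* (w :* (:1 :* (:1 :+ :1) :* b))) refl (W n) (q ^ suc n))
    (F.+-cong (F.*-congˡ {sg 0} (F.*-congʳ {J 0 ⊛ q ^ 0} (W⊛1+q^ n)))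
      (F.-‿cong (F.*-congˡ {sg 0} (F.*-congˡ {W n} (F.*-congˡ {J 0 ⊛ 1+q^ 0} (^-congʳ q (sym (ℕₚ.+-identityʳ (suc n)))))))))
  telescope n (suc m) = F.trans (F.+-cong (F.trans (telescope n m) (F.+-congˡ {sumF (t n) m} (F.-‿cong (F.*-congˡ {sg m} (F.*-congˡ {W n}
      (F.*-congʳ {Z} (F.sym (J⊛1-q^ m))))))))
      (F.*-congˡ {sg (suc m)} (F.*-congˡ {P (suc n)} (F.*-congˡ {J (suc m)} (q^-+ (suc m * suc n) (suc m) (e₁ m n))))))
    (F.trans (solve 7 (λ T σ w j Z a b → T :- σ :* (w :* (j :* (:1 :- a) :* Z)) :+ con ℤ.-1ℤ :* σ :* (w :* (:1 :- b) :* (j :* (Z :* a))) ,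
        T :+ con ℤ.-1ℤ :* σ :* (w :* (:1 :+ b) :* (j :* Z)) :- con ℤ.-1ℤ :* σ :* (w :* (j :* (:1 :+ a) :* (Z :* b)))) refl
        (sumF (t n) m) (sg m) (W n) (J (suc m)) Z (q ^ suc m) (q ^ suc n))
    (F.+-cong (F.+-congˡ {sumF (t n) m} (F.*-congˡ {sg (suc m)} (F.*-congʳ {J (suc m) ⊛ Z} (W⊛1+q^ n))))
      (F.-‿cong (F.*-congˡ {sg (suc m)} (F.*-congˡ {W n} (F.*-congˡ {J (suc m) ⊛ 1+q^ (suc m)}
          (F.sym (q^-+ (suc m * suc n) (suc n) (e₂ m n)))))))))
    where
    Z = q ^ (suc m * suc n)
    e₁ : ∀ m n → suc m * suc (suc n) ≡ suc m * suc n + suc m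
    e₁ = solveℕ-∀
    e₂ : ∀ m n → suc (suc m) * suc n ≡ suc m * suc n + suc n
    e₂ = solveℕ-∀

  JP≈2 : ∀ m → J m ⊛ 1+q^ m ⊛ P m ≈ constF (+ 2)
  JP≈2 zero    = solve 0 (:1 :* (:1 :+ :1) :* :1 , con (+ 2)) refl
  JP≈2 (suc m) = F.trans (solve 4 (λ j a w b → j :* a :* (w :* b) , j :* b :* (w :* a)) refl (J (suc m)) (1+q^ (suc m)) (W m)
      (1-q^ (suc m)))
    (F.trans (F.*-cong (J⊛1-q^ m) (W⊛1+q^ m)) (JP≈2 m))

  -- The boundary term and the new last summand differ by the factor -q^(n+1). Their sum restores 1
  -- + q^(n+1), which turns `W n` into `P n`, and by `JP≈2` only twice a power of q remains.
  diagonal : ∀ n → sumF (t n) n ≈ zsF n squareTerm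
  diagonal zero    = solve 0 (:1 :* (:1 :* (:1 :* :1)) , :1 :* :1) refl
  diagonal (suc n) = F.trans (F.+-cong (F.trans (telescope n n) (F.+-cong (diagonal n)
      (F.-‿cong (F.*-congˡ {sg n} (F.sym (F.*-assoc (W n) A Z))))))
      (F.*-congˡ {sg (suc n)} (F.trans (F.*-congˡ {P (suc n)} (F.*-congˡ {J (suc n)} (q^-+ (suc n * suc n) (suc n) (e₁ n))))
        (F.trans (solve 5 (λ w b j Z a → w :* b :* (j :* (Z :* a)) , w :* (j :* b) :* (Z :* a)) refl (W n) (1-q^ (suc n)) (J (suc n)) Z
            (q ^ suc n))
          (F.*-congʳ {Z ⊛ q ^ suc n} (F.*-congˡ {W n} (J⊛1-q^ n)))))))
    (F.trans (solve 5 (λ T σ V Z a → T :- σ :* (V :* Z) :+ con ℤ.-1ℤ :* σ :* (V :* (Z :* a)) , T :+ con ℤ.-1ℤ :* σ :*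
        (V :* (:1 :+ a) :* Z)) refl
      (zsF n squareTerm) (sg n) (W n ⊛ A) Z (q ^ suc n))
    (F.trans (F.+-congˡ {zsF n squareTerm} (F.*-congˡ {sg (suc n)} (F.*-congʳ {Z}
        (F.trans (solve 3 (λ w a b → w :* a :* b , a :* (w :* b)) refl (W n) A (1+q^ (suc n)))
      (F.trans (F.*-congˡ {A} (W⊛1+q^ n)) (JP≈2 n))))))
    (solve 3 (λ T σ Z → T :+ σ :* (con (+ 2) :* Z) , T :+ (σ :* Z :+ σ :* Z)) refl (zsF n squareTerm) (sg (suc n)) Z)))
    where
    A = J n ⊛ 1+q^ n
    Z = q ^ (suc n * suc n)
    e₁ : ∀ n → suc n * suc (suc n) ≡ suc n * suc n + suc n
    e₁ = solveℕ-∀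

  high : ∀ n s → Ord (suc n) (t n (suc s))
  high n s = Ord-⊛ˡ (sg (suc s)) _ (Ord-⊛ˡ (P n) _ (Ord-⊛ˡ (J (suc s)) _ (Ord-≤ (ℕₚ.m≤m+n (suc n) _)
    (Ord-cong (F.*-identityʳ _) (Ord-q^ (suc s * suc n) oneF)))))

  low : ∀ n → P n ≈[≤ n ] zsF n squareTerm
  low n k k≤n = trans (sym (leading k)) (trans (sym (sumF-Ord n (t n) n (high n) k k≤n)) (diagonal n k))
    where
    leading : t n 0 ≈ P n
    leading = solve 1 (λ p → :1 :* (p :* (:1 :* :1)) , p) refl (P n)

  P⊛N : ∀ n → P n ⊛ N n ≈ E n
  P⊛N zero    = F.*-identityˡ oneF
  P⊛N (suc n) = F.trans (solve 4 (λ w b m a → w :* b :* (m :* a) , w :* a :* m :* b) refl (W n) (1-q^ (suc n)) (N n) (1+q^ (suc n)))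
    (F.trans (F.*-congʳ {1-q^ (suc n)} (F.trans (F.*-congʳ {N n} (W⊛1+q^ n)) (P⊛N n))) (F.sym (E-suc n)))

  E⊛N : ∀ n → eulerPartial 2 n ≈ E n ⊛ N n
  E⊛N zero    = F.sym (F.*-identityˡ oneF)
  E⊛N (suc n) = F.trans (F.*-cong (E⊛N n) (F.trans (oneMinusQ≈ (2 * suc n))
      (F.+-congˡ {oneF} (F.-‿cong (F.trans (q^-+ (suc n) (suc n + 0) refl)
      (F.*-congˡ {q ^ suc n} (^-congʳ q (ℕₚ.+-identityʳ (suc n)))))))))
    (F.trans (solve 3 (λ e m a → e :* m :* (:1 :- a :* a) , e :* (:1 :- a) :* (m :* (:1 :+ a))) refl (E n) (N n) (q ^ suc n))
    (F.*-congʳ {N (suc n)} (F.sym (E-suc n))))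

-- `P n` times `N n` is the n-th partial product of `f 1`, and that partial product times `N n` is
-- the one of `f 2`; hence `P` approximates the quotient of f 1 squared by f 2.
gauss : f 1 ⊛ f 1 ≈ f 2 ⊛ φ
gauss = ≈[≤]⇒≈ {f 1 ⊛ f 1} λ n k k≤n → trans (≈[≤]-⊛ {n} {f 1} {E n} {f 1} {E n} (f≈eulerPartial 0 n) (f≈eulerPartial 0 n) k k≤n)
  (trans (F.trans (F.*-congˡ {E n} (F.sym (P⊛N n))) (F.trans (solve 3 (λ e p m → e :* (p :* m) , e :* m :* p) refl (E n) (P n) (N n))
    (F.*-congʳ {P n} (F.sym (E⊛N n)))) k)
  (sym (≈[≤]-⊛ {n} {f 2} {eulerPartial 2 n} {φ} {P n} (f≈eulerPartial 1 n) (λ j j≤n → trans (φ≈squares n j j≤n) (sym (low n j j≤n))) k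
      k≤n)))
  where open Squares

-- Finitely supported sums over ℤ

zs : ℕ → (ℤ → ℤ) → ℤ
zs zero    g = g (+ 0)
zs (suc M) g = zs M g ℤ.+ (g (+ suc M) ℤ.+ g -[1+ M ])

zsF-at : ∀ M g k → zsF M g k ≡ zs M (λ n → g n k)
zsF-at zero    g k = refl
zsF-at (suc M) g k = cong (ℤ._+ (g (+ suc M) k ℤ.+ g -[1+ M ] k)) (zsF-at M g k)

zs-cong≤ : ∀ M {g h : ℤ → ℤ} → (∀ n → ∣ n ∣ ≤ M → g n ≡ h n) → zs M g ≡ zs M h
zs-cong≤ zero    p = p (+ 0) z≤n
zs-cong≤ (suc M) p = cong₂ ℤ._+_ (zs-cong≤ M (λ n n≤ → p n (ℕₚ.m≤n⇒m≤1+n n≤))) (cong₂ ℤ._+_ (p _ ℕₚ.≤-refl) (p _ ℕₚ.≤-refl))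

zs-cong : ∀ M {g h : ℤ → ℤ} → (∀ n → g n ≡ h n) → zs M g ≡ zs M h
zs-cong M p = zs-cong≤ M (λ n _ → p n)

zs-+ : ∀ M g h → zs M (λ n → g n ℤ.+ h n) ≡ zs M g ℤ.+ zs M h
zs-+ zero    g h = refl
zs-+ (suc M) g h = trans (cong (ℤ._+ (g (+ suc M) ℤ.+ h (+ suc M) ℤ.+ (g -[1+ M ] ℤ.+ h -[1+ M ]))) (zs-+ M g h))
  (regroup (zs M g) (zs M h) (g (+ suc M)) (h (+ suc M)) (g -[1+ M ]) (h -[1+ M ]))
  where
  regroup : ∀ a b c d e j → (a ℤ.+ b) ℤ.+ ((c ℤ.+ d) ℤ.+ (e ℤ.+ j)) ≡ (a ℤ.+ (c ℤ.+ e)) ℤ.+ (b ℤ.+ (d ℤ.+ j))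
  regroup = solve-∀

zs-swap : ∀ M N (g : ℤ → ℤ → ℤ) → zs M (λ n → zs N (λ m → g n m)) ≡ zs N (λ m → zs M (λ n → g n m))
zs-swap zero    N g = refl
zs-swap (suc M) N g = trans (cong₂ ℤ._+_ (zs-swap M N g) (sym (zs-+ N (g (+ suc M)) (g -[1+ M ]))))
  (sym (zs-+ N (λ m → zs M (λ n → g n m)) _))

zs-negate : ∀ M g → zs M (λ n → g (ℤ.- n)) ≡ zs M g
zs-negate zero    g = refl
zs-negate (suc M) g = cong₂ ℤ._+_ (zs-negate M g) (ℤₚ.+-comm (g -[1+ M ]) (g (+ suc M)))

zs-zero : ∀ M {g : ℤ → ℤ} → (∀ n → g n ≡ + 0) → zs M g ≡ + 0
zs-zero zero    z = z (+ 0)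
zs-zero (suc M) z = cong₂ ℤ._+_ (zs-zero M z) (cong₂ ℤ._+_ (z _) (z _))

Supp : ℕ → (ℤ → ℤ) → Set
Supp B g = ∀ n → B < ∣ n ∣ → g n ≡ + 0

zs-supp : ∀ {B} M g → Supp B g → B ≤ M → zs M g ≡ zs B g
zs-supp zero    g s z≤n = refl
zs-supp (suc M) g s B≤ with ℕₚ.m≤n⇒m<n∨m≡n B≤
... | inj₂ refl = refl
... | inj₁ (s≤s B≤M) = trans (cong₂ ℤ._+_ (zs-supp M g s B≤M) (cong₂ ℤ._+_ (s _ (s≤s B≤M)) (s _ (s≤s B≤M)))) (ℤₚ.+-identityʳ _)

-- Moving the window one step lets M + 1 in and -M out.
zs-step : ∀ M g → zs M (λ n → g (+ 1 ℤ.+ n)) ≡ zs M g ℤ.+ (g (+ suc M) ℤ.- g (ℤ.- (+ M)))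
zs-step zero    g = cancel (g (+ 0)) (g (+ 1))
  where
  cancel : ∀ a b → b ≡ a ℤ.+ (b ℤ.- a)
  cancel = solve-∀
zs-step (suc M) g = trans (cong₂ (λ a n → a ℤ.+ (g (+ suc (suc M)) ℤ.+ g n)) (zs-step M g) (ℤₚ.[1+m]⊖[1+n]≡m⊖n 0 M))
  (trans (cong (λ n → zs M g ℤ.+ (g (+ suc M) ℤ.- g (ℤ.- (+ M))) ℤ.+ (g (+ suc (suc M)) ℤ.+ g n)) (0⊖ M))
  (regroup (zs M g) (g (+ suc M)) (g (ℤ.- (+ M))) (g (+ suc (suc M))) (g -[1+ M ])))
  where
  0⊖ : ∀ n → 0 ℤ.⊖ n ≡ ℤ.- (+ n)
  0⊖ zero    = refl
  0⊖ (suc n) = refl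
  regroup : ∀ z a b c d → z ℤ.+ (a ℤ.- b) ℤ.+ (c ℤ.+ b) ≡ z ℤ.+ (a ℤ.+ d) ℤ.+ (c ℤ.- d)
  regroup = solve-∀

zs-shift⁺ : ∀ B c M g → Supp B g → B + c ≤ M → zs M (λ n → g (+ c ℤ.+ n)) ≡ zs M g
zs-shift⁺ B zero    M g s le = zs-cong M (λ n → cong g (ℤₚ.+-identityˡ n))
zs-shift⁺ B (suc c) M g s le = trans (zs-cong M (λ n → cong g (move (+ c) n))) (trans (zs-step M (λ n → g (+ c ℤ.+ n)))
  (trans (cong₂ (λ a b → zs M (λ n → g (+ c ℤ.+ n)) ℤ.+ (a ℤ.- b)) (s _ right) (s _ left))
  (trans (ℤₚ.+-identityʳ _) (zs-shift⁺ B c M g s (ℕₚ.≤-trans (ℕₚ.n≤1+n _) B+c<M)))))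
  where
  B+c<M : B + c < M
  B+c<M = subst (_≤ M) (ℕₚ.+-suc B c) le
  move : ∀ c n → + 1 ℤ.+ c ℤ.+ n ≡ c ℤ.+ (+ 1 ℤ.+ n)
  move = solve-∀
  right : B < c + suc M
  right = ℕₚ.≤-trans (s≤s (ℕₚ.≤-trans (ℕₚ.m≤m+n B c) (ℕₚ.<⇒≤ B+c<M))) (ℕₚ.m≤n+m (suc M) c)
  left : B < ∣ + c ℤ.+ ℤ.- (+ M) ∣
  left = subst (B <_) (sym (trans (cong ∣_∣ (trans (ℤₚ.[+m]-[+n]≡m⊖n c M) (ℤₚ.⊖-≤ c≤M))) (ℤₚ.∣-i∣≡∣i∣ (+ (M ∸ c)))))
    (subst (_≤ M ∸ c) (ℕₚ.m+n∸n≡m (suc B) c) (ℕₚ.∸-monoˡ-≤ c B+c<M))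
    where
    c≤M : c ≤ M
    c≤M = ℕₚ.≤-trans (ℕₚ.m≤n+m c B) (ℕₚ.<⇒≤ B+c<M)

zs-shift : ∀ B c M g → Supp B g → B + ∣ c ∣ ≤ M → zs M (λ n → g (c ℤ.+ n)) ≡ zs B g
zs-shift B (+ c)    M g s le = trans (zs-shift⁺ B c M g s le) (zs-supp M g s (ℕₚ.≤-trans (ℕₚ.m≤m+n B c) le))
zs-shift B -[1+ c ] M g s le = trans (sym (zs-negate M (λ n → g (-[1+ c ] ℤ.+ n))))
  (trans (zs-cong M (λ n → cong g (sym (ℤₚ.neg-distrib-+ (+ suc c) n))))
  (trans (zs-shift⁺ B (suc c) M (λ n → g (ℤ.- n)) (λ n n> → s (ℤ.- n) (subst (B <_) (sym (ℤₚ.∣-i∣≡∣i∣ n)) n>)) le)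
  (trans (zs-negate M g) (zs-supp M g s (ℕₚ.≤-trans (ℕₚ.m≤m+n B (suc c)) le)))))

byResidue : (ℤ → ℤ) → ℤ → ℤ
byResidue g l = g (+ 0 ℤ.+ + 5 ℤ.* l) ℤ.+ (g (+ 1 ℤ.+ + 5 ℤ.* l) ℤ.+ g (ℤ.- (+ 1) ℤ.+ + 5 ℤ.* l))
  ℤ.+ (g (+ 2 ℤ.+ + 5 ℤ.* l) ℤ.+ g (ℤ.- (+ 2) ℤ.+ + 5 ℤ.* l))

-- With the balanced residues 0, ±1, ±2 the window |n| ≤ 5M + 2 consists exactly of the blocks
-- around 5l with |l| ≤ M, so no boundary terms arise.
zs-residues : ∀ M g → zs (2 + 5 * M) g ≡ zs M (byResidue g)
zs-residues zero    g = refl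
zs-residues (suc M) g = trans (cong (λ n → zs n g) (five-suc 2 M)) (trans
  (cong₂ ℤ._+_ (cong₂ ℤ._+_ (cong₂ ℤ._+_ (cong₂ ℤ._+_ (cong₂ ℤ._+_ (zs-residues M g)
    (cong₂ ℤ._+_ (at (pos 3)) (at (neg 2)))) (cong₂ ℤ._+_ (at (pos 4)) (at (neg 3)))) (cong₂ ℤ._+_ (at (pos 5)) (at (neg 4))))
    (cong₂ ℤ._+_ (at (pos 6)) (at (neg 5)))) (cong₂ ℤ._+_ (at (pos 7)) (at (neg 6))))
  (regroup (zs M (byResidue g)) (g (up (ℤ.- (+ 2)))) (g (down (+ 2))) (g (up ℤ.-1ℤ)) (g (down (+ 1))) (g (up (+ 0))) (g (down (+ 0)))
    (g (up (+ 1))) (g (down ℤ.-1ℤ)) (g (up (+ 2))) (g (down (ℤ.- (+ 2))))))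
  where
  up down : ℤ → ℤ
  up c   = c ℤ.+ + 5 ℤ.* (+ 1 ℤ.+ + M)
  down c = c ℤ.+ + 5 ℤ.* (ℤ.- (+ 1 ℤ.+ + M))
  at : ∀ {m n} → m ≡ n → g m ≡ g n
  at = cong g
  lin : ∀ j → + (j + 5 * M) ≡ + j ℤ.+ + 5 ℤ.* + M
  lin j = trans (ℤₚ.pos-+ j (5 * M)) (cong (ℤ._+_ (+ j)) (ℤₚ.pos-* 5 M))
  pos : ∀ j → + (j + 5 * M) ≡ (+ j ℤ.- + 5) ℤ.+ + 5 ℤ.* (+ 1 ℤ.+ + M)
  pos j = trans (lin j) (shift (+ j) (+ M))
    where
    shift : ∀ j m → j ℤ.+ + 5 ℤ.* m ≡ (j ℤ.- + 5) ℤ.+ + 5 ℤ.* (+ 1 ℤ.+ m)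
    shift = solve-∀
  neg : ∀ j → -[1+ j + 5 * M ] ≡ (+ 4 ℤ.- + j) ℤ.+ + 5 ℤ.* (ℤ.- (+ 1 ℤ.+ + M))
  neg j = trans (cong (λ m → ℤ.- (+ 1 ℤ.+ m)) (lin j)) (shift (+ j) (+ M))
    where
    shift : ∀ j m → ℤ.- (+ 1 ℤ.+ (j ℤ.+ + 5 ℤ.* m)) ≡ (+ 4 ℤ.- j) ℤ.+ + 5 ℤ.* (ℤ.- (+ 1 ℤ.+ m))
    shift = solve-∀
  regroup : ∀ z p₁ n₁ p₂ n₂ p₃ n₃ p₄ n₄ p₅ n₅ →
    z ℤ.+ (p₁ ℤ.+ n₁) ℤ.+ (p₂ ℤ.+ n₂) ℤ.+ (p₃ ℤ.+ n₃) ℤ.+ (p₄ ℤ.+ n₄) ℤ.+ (p₅ ℤ.+ n₅) ≡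
    z ℤ.+ ((p₃ ℤ.+ (p₄ ℤ.+ p₂) ℤ.+ (p₅ ℤ.+ p₁)) ℤ.+ (n₃ ℤ.+ (n₂ ℤ.+ n₄) ℤ.+ (n₁ ℤ.+ n₅)))
  regroup = solve-∀

five-bound : ∀ c k l → ∣ c ∣ ≤ 4 → k < ∣ l ∣ → k < ∣ c ℤ.+ + 5 ℤ.* l ∣
five-bound c k l c≤4 k<l = ℕₚ.+-cancelʳ-< 4 k _ (begin-strict
  k + 4                              <⟨ ℕₚ.+-monoˡ-< 4 k<l ⟩
  ∣ l ∣ + 4                          ≤⟨ ℕₚ.+-monoʳ-≤ ∣ l ∣ (ℕₚ.m≤m*n 4 ∣ l ∣ {{ℕ.>-nonZero (ℕₚ.≤-<-trans z≤n k<l)}}) ⟩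
  5 * ∣ l ∣                          ≡⟨ ℤₚ.abs-* (+ 5) l ⟨
  ∣ + 5 ℤ.* l ∣                        ≡⟨ cong ∣_∣ (cancel c (+ 5 ℤ.* l)) ⟩
  ∣ (c ℤ.+ + 5 ℤ.* l) ℤ.+ (ℤ.- c) ∣    ≤⟨ ℤₚ.∣i+j∣≤∣i∣+∣j∣ (c ℤ.+ + 5 ℤ.* l) (ℤ.- c) ⟩
  ∣ c ℤ.+ + 5 ℤ.* l ∣ + ∣ ℤ.- c ∣    ≤⟨ ℕₚ.+-monoʳ-≤ _ (subst (_≤ 4) (sym (ℤₚ.∣-i∣≡∣i∣ c)) c≤4) ⟩
  ∣ c ℤ.+ + 5 ℤ.* l ∣ + 4            ∎)
  where
  open ℕₚ.≤-Reasoning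
  cancel : ∀ a b → b ≡ (a ℤ.+ b) ℤ.+ (ℤ.- a)
  cancel = solve-∀

-- Theta series and an identity of two-dimensional lattice sums

sq : ℤ → ℕ
sq n = ∣ n ∣ * ∣ n ∣

+sq : ∀ n → + sq n ≡ n ℤ.* n
+sq (+ n)    = ℤₚ.pos-* n n
+sq -[1+ n ] = refl

n≤sq : ∀ n → ∣ n ∣ ≤ sq n
n≤sq n with ∣ n ∣
... | zero  = z≤n
... | suc m = ℕₚ.m≤m+n (suc m) _

-- As n and n² have the same parity, the sign of a term of `φ` can be absorbed into a power of -q.
-- Identities between quadratic forms then transfer to terms without separate account of signs.
mon : ℕ → FPS
mon e = (constF ℤ.-1ℤ ⊛ q) ^ e

mon-q^ : ∀ e → mon e ≈ sg e ⊛ q ^ e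
mon-q^ e = ^-distrib-* (constF ℤ.-1ℤ) q e

sg-constF : ∀ n → ∃[ c ] sg n ≈ constF c
sg-constF zero    = + 1 , F.refl
sg-constF (suc n) with sg-constF n
... | c , p = ℤ.- (+ 1) ℤ.* c , F.trans (F.*-congˡ {constF ℤ.-1ℤ} p) (F.sym (constF-* ℤ.-1ℤ c))

monomial-≢ : ∀ a e n → n ≢ e → (sg a ⊛ q ^ e) n ≡ + 0
monomial-≢ a e n n≢e with sg-constF a
... | c , p = trans (F.trans (F.*-congʳ {q ^ e} p) (constF-⊛ c (q ^ e)) n)
  (trans (cong (c ℤ.*_) (trans (q^-shiftQ e n) (shiftQ-constF-≢ e (+ 1) n n≢e))) (ℤₚ.*-zeroʳ c))

mon-≢ : ∀ e n → n ≢ e → mon e n ≡ + 0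
mon-≢ e n n≢e = trans (mon-q^ e n) (monomial-≢ e e n n≢e)

θ : (ℤ → ℕ) → FPS
θ e k = zs k (λ n → mon (e n) k)

-- Growth of the exponents under which the window |n| ≤ k in `θ e k` omits nothing.
Big : (ℤ → ℕ) → Set
Big e = ∀ k n → k < ∣ n ∣ → k < e n

θ-at : ∀ e → Big e → ∀ k M → k ≤ M → θ e k ≡ zs M (λ n → mon (e n) k)
θ-at e b k M k≤M = sym (zs-supp M _ (λ n k<n → mon-≢ (e n) k (ℕₚ.<⇒≢ (b k n k<n))) k≤M)

zsF-⊛ : ∀ M g h → zsF M g ⊛ h ≈ zsF M (λ n → g n ⊛ h)
zsF-⊛ zero    g h = F.refl
zsF-⊛ (suc M) g h = F.trans (F.distribʳ h (zsF M g) (g (+ suc M) ⊕ g -[1+ M ]))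
    (F.+-cong (zsF-⊛ M g h) (F.distribʳ h (g (+ suc M)) (g -[1+ M ])))

⊛-zsF : ∀ M g h → h ⊛ zsF M g ≈ zsF M (λ n → h ⊛ g n)
⊛-zsF zero    g h = F.refl
⊛-zsF (suc M) g h = F.trans (F.distribˡ h (zsF M g) (g (+ suc M) ⊕ g -[1+ M ]))
    (F.+-cong (⊛-zsF M g h) (F.distribˡ h (g (+ suc M)) (g -[1+ M ])))

-- The two windows are independent because the change of variables in `lattice` needs them of
-- different size.
θ-⊛ : ∀ e e′ → Big e → Big e′ → ∀ k M N → k ≤ M → k ≤ N →
      (θ e ⊛ θ e′) k ≡ zs M (λ n → zs N (λ m → mon (e n + e′ m) k))
θ-⊛ e e′ b b′ k M N k≤M k≤N = trans
  (≈[≤]-⊛ {k} {θ e} {zsF M (λ n → mon (e n))} {θ e′} {zsF N (λ m → mon (e′ m))} (truncate e b M k≤M) (truncate e′ b′ N k≤N) k ℕₚ.≤-refl)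
  (trans (zsF-⊛ M (λ n → mon (e n)) (zsF N (λ m → mon (e′ m))) k) (trans (zsF-at M _ k)
  (zs-cong M (λ n → trans (⊛-zsF N (λ m → mon (e′ m)) (mon (e n)) k) (trans (zsF-at N _ k)
  (zs-cong N (λ m → sym (^-homo-* (constF ℤ.-1ℤ ⊛ q) (e n) (e′ m) k))))))))
  where
  truncate : ∀ e → Big e → ∀ M → k ≤ M → θ e ≈[≤ k ] zsF M (λ n → mon (e n))
  truncate e b M k≤M j j≤k = trans (θ-at e b j M (ℕₚ.≤-trans j≤k k≤M)) (sym (zsF-at M _ j))

sg-square : ∀ n → sg (n * n) ≈ sg n
sg-square zero    = F.refl
sg-square (suc n) = F.trans (F.trans (^-congʳ (constF ℤ.-1ℤ) (expand n)) (F.trans (^-homo-* (constF ℤ.-1ℤ) (suc (n + n)) (n * n))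
    (F.*-cong (F.*-congˡ {constF ℤ.-1ℤ} (^-homo-* (constF ℤ.-1ℤ) n n)) (sg-square n))))
  (F.trans (F.*-congʳ {sg n} (F.*-congˡ {constF ℤ.-1ℤ} (sg² n))) (F.*-congʳ {sg n} (F.*-identityʳ _)))
  where
  expand : ∀ n → suc n * suc n ≡ suc (n + n) + n * n
  expand = solveℕ-∀
  sg² : ∀ n → sg n ⊛ sg n ≈ oneF
  sg² zero    = F.*-identityˡ oneF
  sg² (suc n) = F.trans (solve 1 (λ s → con ℤ.-1ℤ :* s :* (con ℤ.-1ℤ :* s) , s :* s) refl (sg n)) (sg² n)

big-sq : ∀ c → ∣ c ∣ ≤ 4 → Big (λ l → sq (c ℤ.+ + 5 ℤ.* l))
big-sq c c≤4 k l k<l = ℕₚ.<-≤-trans (five-bound c k l c≤4 k<l) (n≤sq (c ℤ.+ + 5 ℤ.* l))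

φ≈θ : φ ≈ θ sq
φ≈θ k = trans (zsF-at k squareTerm k) (zs-cong k (λ n → sym (F.trans (mon-q^ (sq n)) (F.*-congʳ {q ^ sq n} (sg-square ∣ n ∣)) k)))

big-sq₀ : Big sq
big-sq₀ k n k<n = ℕₚ.<-≤-trans k<n (n≤sq n)

θ₅ : ℤ → FPS
θ₅ c = θ (λ l → sq (c ℤ.+ + 5 ℤ.* l))

zs-sum₅ : ∀ M (a b c d e : ℤ → ℤ) → zs M (λ n → a n ℤ.+ (b n ℤ.+ c n) ℤ.+ (d n ℤ.+ e n)) ≡
  zs M a ℤ.+ (zs M b ℤ.+ zs M c) ℤ.+ (zs M d ℤ.+ zs M e)
zs-sum₅ M a b c d e = trans (zs-+ M (λ n → a n ℤ.+ (b n ℤ.+ c n)) (λ n → d n ℤ.+ e n))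
  (cong₂ ℤ._+_ (trans (zs-+ M a (λ n → b n ℤ.+ c n)) (cong (ℤ._+_ (zs M a)) (zs-+ M b c))) (zs-+ M d e))

zs-byResidue : ∀ M g → zs M (byResidue g) ≡ zs M (λ l → g (+ 0 ℤ.+ + 5 ℤ.* l)) ℤ.+
    (zs M (λ l → g (+ 1 ℤ.+ + 5 ℤ.* l)) ℤ.+ zs M (λ l → g (ℤ.- (+ 1) ℤ.+ + 5 ℤ.* l)))
  ℤ.+ (zs M (λ l → g (+ 2 ℤ.+ + 5 ℤ.* l)) ℤ.+ zs M (λ l → g (ℤ.- (+ 2) ℤ.+ + 5 ℤ.* l)))
zs-byResidue M g = zs-sum₅ M (λ l → g (+ 0 ℤ.+ + 5 ℤ.* l)) (λ l → g (+ 1 ℤ.+ + 5 ℤ.* l)) (λ l → g (ℤ.- (+ 1) ℤ.+ + 5 ℤ.* l))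
  (λ l → g (+ 2 ℤ.+ + 5 ℤ.* l)) (λ l → g (ℤ.- (+ 2) ℤ.+ + 5 ℤ.* l))

k≤2+5k : ∀ k → k ≤ 2 + 5 * k
k≤2+5k k = ℕₚ.≤-trans (ℕₚ.m≤n*m k 5) (ℕₚ.m≤n+m (5 * k) 2)

φ-residues : φ ≈ θ₅ (+ 0) ⊕ (θ₅ (+ 1) ⊕ θ₅ ℤ.-1ℤ) ⊕ (θ₅ (+ 2) ⊕ θ₅ (ℤ.- (+ 2)))
φ-residues k = trans (φ≈θ k) (trans (θ-at sq big-sq₀ k (2 + 5 * k) (k≤2+5k k))
  (trans (zs-residues k (λ n → mon (sq n) k)) (zs-byResidue k (λ n → mon (sq n) k))))

-- Both sides sum over the sublattice m ≡ 2n (mod 5) of ℤ², which is {(u+2v, 2u-v)}.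
lattice : ∀ k → (θ (λ n → 5 * sq n) ⊛ θ (λ n → 5 * sq n)) k ≡
  (θ₅ (+ 0) ⊛ θ₅ (+ 0) ⊕ (θ₅ (+ 1) ⊛ θ₅ (+ 2) ⊕ θ₅ ℤ.-1ℤ ⊛ θ₅ (ℤ.- (+ 2))) ⊕ (θ₅ (+ 2) ⊛ θ₅ (+ 4) ⊕ θ₅ (ℤ.- (+ 2)) ⊛ θ₅ (ℤ.- (+ 4)))) k
lattice k = trans (θ-⊛ _ _ big₅ big₅ k (7 * k) (3 * k) (ℕₚ.m≤n*m k 7) (ℕₚ.m≤n*m k 3))
  (trans (zs-cong (7 * k) (λ u → zs-cong (3 * k) (λ v → cong (λ e → mon e k) (rotate u v))))
  (trans (zs-swap (7 * k) (3 * k) _)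
  (trans (zs-cong≤ (3 * k) (λ v v≤ → trans (zs-cong (7 * k) (λ u → cong (C (+ 2 ℤ.* v ℤ.+ u)) (unrotate u v)))
    (zs-shift k (+ 2 ℤ.* v) (7 * k) (λ u → C u (+ 2 ℤ.* u ℤ.- + 5 ℤ.* v)) (λ u k<u → C-left u (+ 2 ℤ.* u ℤ.- + 5 ℤ.* v) k<u) (wide v v≤))))
  (trans (zs-swap (3 * k) k _)
  (trans (sym (zs-supp (2 + 5 * k) _ (λ u k<u → zs-zero (3 * k) (λ v → C-left u (+ 2 ℤ.* u ℤ.- + 5 ℤ.* v) k<u)) (k≤2+5k k)))
  (trans (zs-residues k (λ u → zs (3 * k) (λ v → C u (+ 2 ℤ.* u ℤ.- + 5 ℤ.* v))))
      (trans (zs-byResidue k (λ u → zs (3 * k) (λ v → C u (+ 2 ℤ.* u ℤ.- + 5 ℤ.* v))))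
  (cong₂ ℤ._+_ (cong₂ ℤ._+_ (class (+ 0) z≤n z≤n) (cong₂ ℤ._+_ (class (+ 1) (s≤s z≤n) (s≤s (s≤s z≤n)))
      (class ℤ.-1ℤ (s≤s z≤n) (s≤s (s≤s z≤n)))))
    (cong₂ ℤ._+_ (class (+ 2) (s≤s (s≤s z≤n)) ℕₚ.≤-refl) (class (ℤ.- (+ 2)) (s≤s (s≤s z≤n)) ℕₚ.≤-refl))))))))))
  where
  big₅ : Big (λ n → 5 * sq n)
  big₅ k n k<n = ℕₚ.<-≤-trans (big-sq₀ k n k<n) (ℕₚ.m≤n*m (sq n) 5)

  C : ℤ → ℤ → ℤ
  C n m = mon (sq n + sq m) k

  C-left : ∀ n m → k < ∣ n ∣ → C n m ≡ + 0
  C-left n m k<n = mon-≢ _ k (ℕₚ.<⇒≢ (ℕₚ.<-≤-trans (big-sq₀ k n k<n) (ℕₚ.m≤m+n (sq n) (sq m))))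

  C-right : ∀ n m → k < ∣ m ∣ → C n m ≡ + 0
  C-right n m k<m = mon-≢ _ k (ℕₚ.<⇒≢ (ℕₚ.<-≤-trans (big-sq₀ k m k<m) (ℕₚ.m≤n+m (sq m) (sq n))))

  -- Multiplication by a Gaussian integer of norm 5 multiplies u² + v² by 5.
  rotate : ∀ u v → 5 * sq u + 5 * sq v ≡ sq (+ 2 ℤ.* v ℤ.+ u) + sq (+ 2 ℤ.* u ℤ.- v)
  rotate u v = ℤₚ.+-injective (trans (trans (ℤₚ.pos-+ (5 * sq u) (5 * sq v)) (cong₂ ℤ._+_ (five u) (five v)))
    (trans (identity u v) (sym (trans (ℤₚ.pos-+ (sq (+ 2 ℤ.* v ℤ.+ u)) _) (cong₂ ℤ._+_ (+sq (+ 2 ℤ.* v ℤ.+ u)) (+sq (+ 2 ℤ.* u ℤ.- v)))))))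
    where
    five : ∀ n → + (5 * sq n) ≡ + 5 ℤ.* (n ℤ.* n)
    five n = trans (ℤₚ.pos-* 5 (sq n)) (cong (+ 5 ℤ.*_) (+sq n))
    identity : ∀ u v → + 5 ℤ.* (u ℤ.* u) ℤ.+ + 5 ℤ.* (v ℤ.* v) ≡
      (+ 2 ℤ.* v ℤ.+ u) ℤ.* (+ 2 ℤ.* v ℤ.+ u) ℤ.+ (+ 2 ℤ.* u ℤ.- v) ℤ.* (+ 2 ℤ.* u ℤ.- v)
    identity = solve-∀

  unrotate : ∀ u v → + 2 ℤ.* u ℤ.- v ≡ + 2 ℤ.* (+ 2 ℤ.* v ℤ.+ u) ℤ.- + 5 ℤ.* v
  unrotate = solve-∀

  -- The windows 7k and 3k leave room for two shears: the shift by 2l with |l| ≤ k needs k + 2k for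
  -- v, and then the shift by 2v needs k + 2 · 3k for u.
  wide : ∀ v → ∣ v ∣ ≤ 3 * k → k + ∣ + 2 ℤ.* v ∣ ≤ 7 * k
  wide v v≤ = subst (λ a → k + a ≤ 7 * k) (sym (ℤₚ.abs-* (+ 2) v)) (ℕₚ.≤-trans (ℕₚ.+-monoʳ-≤ k (ℕₚ.*-monoʳ-≤ 2 v≤))
      (ℕₚ.≤-reflexive (seven k)))
    where
    seven : ∀ k → k + 2 * (3 * k) ≡ 7 * k
    seven = solveℕ-∀

  class : ∀ c → ∣ c ∣ ≤ 2 → ∣ + 2 ℤ.* c ∣ ≤ 4 →
    zs k (λ l → zs (3 * k) (λ v → C (c ℤ.+ + 5 ℤ.* l) (+ 2 ℤ.* (c ℤ.+ + 5 ℤ.* l) ℤ.- + 5 ℤ.* v))) ≡ (θ₅ c ⊛ θ₅ (+ 2 ℤ.* c)) k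
  class c c≤2 2c≤4 = sym (trans (θ-⊛ _ _ (big-sq c (ℕₚ.≤-trans c≤2 (s≤s (s≤s z≤n)))) (big-sq (+ 2 ℤ.* c) 2c≤4) k k k ℕₚ.≤-refl ℕₚ.≤-refl)
    (zs-cong≤ k (λ l l≤k → sym (trans (sym (zs-negate (3 * k) _)) (trans
      (zs-cong (3 * k) (λ v → cong (C (c ℤ.+ + 5 ℤ.* l)) (reindex c l v)))
      (zs-shift k (+ 2 ℤ.* l) (3 * k) (λ v → C (c ℤ.+ + 5 ℤ.* l) (+ 2 ℤ.* c ℤ.+ + 5 ℤ.* v))
        (λ v k<v → C-right (c ℤ.+ + 5 ℤ.* l) (+ 2 ℤ.* c ℤ.+ + 5 ℤ.* v) (five-bound (+ 2 ℤ.* c) k v 2c≤4 k<v)) (narrow l l≤k)))))))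
    where
    reindex : ∀ c l v → + 2 ℤ.* (c ℤ.+ + 5 ℤ.* l) ℤ.- + 5 ℤ.* (ℤ.- v) ≡ + 2 ℤ.* c ℤ.+ + 5 ℤ.* (+ 2 ℤ.* l ℤ.+ v)
    reindex = solve-∀
    narrow : ∀ l → ∣ l ∣ ≤ k → k + ∣ + 2 ℤ.* l ∣ ≤ 3 * k
    narrow l l≤k = subst (λ a → k + a ≤ 3 * k) (sym (ℤₚ.abs-* (+ 2) l)) (ℕₚ.+-monoʳ-≤ k (ℕₚ.*-monoʳ-≤ 2 l≤k))

-- Dissections modulo 5

comp-zero : ∀ i g → (∀ k → g (i + 5 * k) ≡ + 0) → comp i g ≈ zeroF
comp-zero i g z k = trans (z k) (sym (zeroF-at k))

+lin : ∀ i k → + (i + 5 * k) ≡ + i ℤ.+ + 5 ℤ.* + k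
+lin i k = trans (ℤₚ.pos-+ i (5 * k)) (cong (ℤ._+_ (+ i)) (ℤₚ.pos-* 5 k))

-- All exponents (c + 5l)² are ≡ c² (mod 5).
θ₅-comp : ∀ c i → ¬ (+ 5 ℤ∣.∣ (c ℤ.* c ℤ.- + i)) → comp i (θ₅ c) ≈ zeroF
θ₅-comp c i ∤ = comp-zero i (θ₅ c) λ k → zs-zero (i + 5 * k) λ l →
  mon-≢ (sq (c ℤ.+ + 5 ℤ.* l)) (i + 5 * k) λ p → ∤ (ℤ∣.divides (+ k ℤ.- + 2 ℤ.* c ℤ.* l ℤ.- + 5 ℤ.* (l ℤ.* l))
    (trans (cong (ℤ._-_ (c ℤ.* c)) (solve-i (+ i) (+ k) _ (trans (sym (+lin i k)) (trans (cong +_ p) (+sq (c ℤ.+ + 5 ℤ.* l))))))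
        (expand c (+ k) l)))
  where
  solve-i : ∀ i k s → i ℤ.+ + 5 ℤ.* k ≡ s → i ≡ s ℤ.- + 5 ℤ.* k
  solve-i i k s refl = cancel i k
    where
    cancel : ∀ i k → i ≡ i ℤ.+ + 5 ℤ.* k ℤ.- + 5 ℤ.* k
    cancel = solve-∀
  expand : ∀ c k l → c ℤ.* c ℤ.- ((c ℤ.+ + 5 ℤ.* l) ℤ.* (c ℤ.+ + 5 ℤ.* l) ℤ.- + 5 ℤ.* k) ≡ (k ℤ.- + 2 ℤ.* c ℤ.* l ℤ.- + 5 ℤ.* (l ℤ.* l))
      ℤ.* + 5
  expand = solve-∀

stretch-zsF : ∀ r M g → stretch r (zsF M g) ≈ zsF M (λ n → stretch r (g n))
stretch-zsF r zero    g = F.refl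
stretch-zsF r (suc M) g = F.trans (stretch-⊕ r (zsF M g) _) (F.+-cong (stretch-zsF r M g) (stretch-⊕ r (g (+ suc M)) (g -[1+ M ])))

stretch5-mon : ∀ e → stretch 5 (mon e) ≈ mon (5 * e)
stretch5-mon e = F.trans (stretch-^ 5 nq e) (F.trans (^-congˡ e base) (^-assocʳ nq 5 e))
  where
  nq = constF ℤ.-1ℤ ⊛ q
  base : stretch 5 nq ≈ nq ^ 5
  base = F.trans (stretch-⊛ 5 (constF ℤ.-1ℤ) q) (F.trans (F.*-cong (stretch-constF 5 _) (stretch-q 4))
    (solve 1 (λ q → con ℤ.-1ℤ :* q :^ 5 , (con ℤ.-1ℤ :* q) :^ 5) refl q))

stretch5-θ : ∀ e → Big e → stretch 5 (θ e) ≈ θ (λ n → 5 * e n)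
stretch5-θ e b k = trans (stretch-≈[≤] 5 {k} {θ e} {zsF k (λ n → mon (e n))}
    (λ j j≤k → trans (θ-at e b j k j≤k) (sym (zsF-at k (λ n → mon (e n)) j))) k ℕₚ.≤-refl)
  (trans (stretch-zsF 5 k (λ n → mon (e n)) k) (trans (zsF-at k (λ n → stretch 5 (mon (e n))) k) (zs-cong k (λ n → stretch5-mon (e n) k))))

θ-cong : ∀ e e′ → (∀ n → e n ≡ e′ n) → θ e ≈ θ e′
θ-cong e e′ p k = zs-cong k (λ n → cong (λ a → mon a k) (p n))

-- `φ₀` is defined as φ at q⁵; it is also the component 0 of `φ`, since the indices n = 5l
-- contribute q^(25 l²). The squares mod 5 leave only the components 0, 1 and 4.
φ₀ φ₁ φ₄ : FPS
φ₀ = stretch 5 φ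
φ₁ = comp 1 φ
φ₄ = comp 4 φ

φ₀≈θ : φ₀ ≈ θ (λ n → 5 * sq n)
φ₀≈θ = F.trans (stretch-cong 5 φ≈θ) (stretch5-θ sq big-sq₀)

stretch-φ₀ : stretch 5 φ₀ ≈ θ₅ (+ 0)
stretch-φ₀ = F.trans (stretch-cong 5 φ₀≈θ) (F.trans (stretch5-θ (λ n → 5 * sq n) big) (θ-cong (λ n → 5 * (5 * sq n)) _ λ n →
  trans (twice n) (cong (λ m → m * m) (sym (trans (cong ∣_∣ (ℤₚ.+-identityˡ (+ 5 ℤ.* n))) (ℤₚ.abs-* (+ 5) n))))))
  where
  big : Big (λ n → 5 * sq n)
  big k n k<n = ℕₚ.<-≤-trans (big-sq₀ k n k<n) (ℕₚ.m≤n*m (sq n) 5)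
  twice : ∀ n → 5 * (5 * sq n) ≡ (5 * ∣ n ∣) * (5 * ∣ n ∣)
  twice n = square ∣ n ∣
    where
    square : ∀ a → 5 * (5 * (a * a)) ≡ (5 * a) * (5 * a)
    square = solveℕ-∀

θ₅-shift : ∀ c d s → ∣ d ∣ ≤ 4 → (∀ l → c ℤ.+ + 5 ℤ.* l ≡ d ℤ.+ + 5 ℤ.* (s ℤ.+ l)) → ∣ c ∣ ≤ 4 → θ₅ c ≈ θ₅ d
θ₅-shift c d s d≤4 p c≤4 k = trans (θ-at _ (big-sq c c≤4) k (k + ∣ s ∣) (ℕₚ.m≤m+n k ∣ s ∣))
  (trans (zs-cong (k + ∣ s ∣) (λ l → cong (λ n → mon (sq n) k) (p l)))
  (zs-shift k s (k + ∣ s ∣) (λ l → mon (sq (d ℤ.+ + 5 ℤ.* l)) k)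
    (λ l k<l → mon-≢ _ k (ℕₚ.<⇒≢ (big-sq d d≤4 k l k<l))) ℕₚ.≤-refl))

-- The terms of `φ` with exponents ≡ 1 and ≡ 4 (mod 5), still as series in q: q φ₁(q⁵) and q⁴
-- φ₄(q⁵).
A₁ A₄ : FPS
A₁ = θ₅ (+ 1) ⊕ θ₅ ℤ.-1ℤ
A₄ = θ₅ (+ 2) ⊕ θ₅ (ℤ.- (+ 2))

-- Since 4 ≡ -1 and -4 ≡ 1 (mod 5), the four mixed products of `lattice` are those of (θ₅ 1 + θ₅
-- (-1)) (θ₅ 2 + θ₅ (-2)).
lattice-split : φ₀ ⊛ φ₀ ≈ stretch 5 φ₀ ⊛ stretch 5 φ₀ ⊕ A₁ ⊛ A₄
lattice-split = F.trans (F.*-cong φ₀≈θ φ₀≈θ) (F.trans lattice (F.trans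
  (F.+-congˡ {θ₅ (+ 0) ⊛ θ₅ (+ 0) ⊕ (θ₅ (+ 1) ⊛ θ₅ (+ 2) ⊕ θ₅ ℤ.-1ℤ ⊛ θ₅ (ℤ.- (+ 2)))}
    (F.+-cong (F.*-congˡ {θ₅ (+ 2)} (θ₅-shift (+ 4) ℤ.-1ℤ (+ 1) (s≤s z≤n) up ℕₚ.≤-refl))
      (F.*-congˡ {θ₅ (ℤ.- (+ 2))} (θ₅-shift (ℤ.- (+ 4)) (+ 1) ℤ.-1ℤ (s≤s z≤n) down ℕₚ.≤-refl))))
  (F.trans (solve 5 (λ o a b c d → o :* o :+ (a :* c :+ b :* d) :+ (c :* b :+ d :* a) , o :* o :+ (a :+ b) :* (c :+ d)) refl
    (θ₅ (+ 0)) (θ₅ (+ 1)) (θ₅ ℤ.-1ℤ) (θ₅ (+ 2)) (θ₅ (ℤ.- (+ 2))))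
  (F.+-congʳ {A₁ ⊛ A₄} (F.*-cong (F.sym stretch-φ₀) (F.sym stretch-φ₀))))))
  where
  up : ∀ l → + 4 ℤ.+ + 5 ℤ.* l ≡ ℤ.- (+ 1) ℤ.+ + 5 ℤ.* (+ 1 ℤ.+ l)
  up = solve-∀
  down : ∀ l → ℤ.- (+ 4) ℤ.+ + 5 ℤ.* l ≡ + 1 ℤ.+ + 5 ℤ.* (ℤ.- (+ 1) ℤ.+ l)
  down = solve-∀

dissect-cong : ∀ {g₀ g₁ g₂ g₃ g₄ h₀ h₁ h₂ h₃ h₄} → g₀ ≈ h₀ → g₁ ≈ h₁ → g₂ ≈ h₂ → g₃ ≈ h₃ → g₄ ≈ h₄ →
  dissect g₀ g₁ g₂ g₃ g₄ ≈ dissect h₀ h₁ h₂ h₃ h₄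
dissect-cong p₀ p₁ p₂ p₃ p₄ = F.+-cong (F.+-cong (F.+-cong (F.+-cong (term 0 p₀) (term 1 p₁)) (term 2 p₂)) (term 3 p₃)) (term 4 p₄)
  where
  term : ∀ i {g h} → g ≈ h → stretch 5 g ⊛ q ^ i ≈ stretch 5 h ⊛ q ^ i
  term i p = F.*-congʳ {q ^ i} (stretch-cong 5 p)

A₁-comp : ∀ i → ¬ (+ 5 ℤ∣.∣ (+ 1 ℤ.- + i)) → comp i A₁ ≈ zeroF
A₁-comp i ∤ = F.trans (F.+-cong (θ₅-comp (+ 1) i ∤) (θ₅-comp ℤ.-1ℤ i ∤)) (F.+-identityˡ zeroF)

A₄-comp : ∀ i → ¬ (+ 5 ℤ∣.∣ (+ 4 ℤ.- + i)) → comp i A₄ ≈ zeroF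
A₄-comp i ∤ = F.trans (F.+-cong (θ₅-comp (+ 2) i ∤) (θ₅-comp (ℤ.- (+ 2)) i ∤)) (F.+-identityˡ zeroF)

φ-comp : ∀ i → comp i φ ≈ comp i (θ₅ (+ 0)) ⊕ comp i A₁ ⊕ comp i A₄
φ-comp i k = φ-residues (i + 5 * k)

comp₀-stretch : ∀ g → comp 0 (stretch 5 g) ≈ g
comp₀-stretch g = F.trans (comp-cong 0 (F.sym (F.*-identityʳ (stretch 5 g)))) (F.trans (comp-stretch⊛ 0 (s≤s z≤n) g oneF)
  (F.trans (F.*-congˡ {g} (comp-q^-≡ 0 (s≤s z≤n))) (F.*-identityʳ g)))

stretch5-injective : ∀ {g h} → stretch 5 g ≈ stretch 5 h → g ≈ h
stretch5-injective {g} {h} p = F.trans (F.sym (comp₀-stretch g)) (F.trans (comp-cong 0 p) (comp₀-stretch h))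

φ-comp₀ : comp 0 φ ≈ φ₀
φ-comp₀ = F.trans (φ-comp 0) (F.trans (F.+-cong (F.+-cong (F.trans (comp-cong 0 (F.sym stretch-φ₀)) (comp₀-stretch φ₀))
  (A₁-comp 0 (from-no (+ 5 ℤ∣.∣? (+ 1 ℤ.- + 0))))) (A₄-comp 0 (from-no (+ 5 ℤ∣.∣? (+ 4 ℤ.- + 0)))))
  (solve 1 (λ a → a :+ :0 :+ :0 , a) refl φ₀))

φ-comp₂ : comp 2 φ ≈ zeroF
φ-comp₂ = F.trans (φ-comp 2) (F.trans (F.+-cong (F.+-cong (θ₅-comp (+ 0) 2 (from-no (+ 5 ℤ∣.∣? (+ 0 ℤ.- + 2))))
  (A₁-comp 2 (from-no (+ 5 ℤ∣.∣? (+ 1 ℤ.- + 2))))) (A₄-comp 2 (from-no (+ 5 ℤ∣.∣? (+ 4 ℤ.- + 2)))))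
  (solve 0 (:0 :+ :0 :+ :0 , :0) refl))

φ-comp₃ : comp 3 φ ≈ zeroF
φ-comp₃ = F.trans (φ-comp 3) (F.trans (F.+-cong (F.+-cong (θ₅-comp (+ 0) 3 (from-no (+ 5 ℤ∣.∣? (+ 0 ℤ.- + 3))))
  (A₁-comp 3 (from-no (+ 5 ℤ∣.∣? (+ 1 ℤ.- + 3))))) (A₄-comp 3 (from-no (+ 5 ℤ∣.∣? (+ 4 ℤ.- + 3)))))
  (solve 0 (:0 :+ :0 :+ :0 , :0) refl))

A₁≈ : A₁ ≈ stretch 5 φ₁ ⊛ q ^ 1
A₁≈ = F.trans (comp-dissect A₁) (F.trans (dissect-cong
    (A₁-comp 0 (from-no (+ 5 ℤ∣.∣? (+ 1 ℤ.- + 0)))) same (A₁-comp 2 (from-no (+ 5 ℤ∣.∣? (+ 1 ℤ.- + 2))))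
    (A₁-comp 3 (from-no (+ 5 ℤ∣.∣? (+ 1 ℤ.- + 3)))) (A₁-comp 4 (from-no (+ 5 ℤ∣.∣? (+ 1 ℤ.- + 4)))))
  (F.trans (F.+-cong (F.+-cong (F.+-cong (F.+-cong (kill 0) (F.refl {stretch 5 φ₁ ⊛ q ^ 1})) (kill 2)) (kill 3)) (kill 4))
    (solve 1 (λ a → :0 :+ a :+ :0 :+ :0 :+ :0 , a) refl (stretch 5 φ₁ ⊛ q ^ 1))))
  where
  same : comp 1 A₁ ≈ φ₁
  same = F.sym (F.trans (φ-comp 1) (F.trans (F.+-cong (F.+-cong (θ₅-comp (+ 0) 1 (from-no (+ 5 ℤ∣.∣? (+ 0 ℤ.- + 1)))) (F.refl {comp 1 A₁}))
      (A₄-comp 1 (from-no (+ 5 ℤ∣.∣? (+ 4 ℤ.- + 1)))))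
    (solve 1 (λ a → :0 :+ a :+ :0 , a) refl (comp 1 A₁))))
  kill : ∀ i → stretch 5 zeroF ⊛ q ^ i ≈ zeroF
  kill i = F.trans (F.*-congʳ {q ^ i} (stretch-constF 5 (+ 0))) (F.zeroˡ (q ^ i))

A₄≈ : A₄ ≈ stretch 5 φ₄ ⊛ q ^ 4
A₄≈ = F.trans (comp-dissect A₄) (F.trans (dissect-cong
    (A₄-comp 0 (from-no (+ 5 ℤ∣.∣? (+ 4 ℤ.- + 0)))) (A₄-comp 1 (from-no (+ 5 ℤ∣.∣? (+ 4 ℤ.- + 1))))
        (A₄-comp 2 (from-no (+ 5 ℤ∣.∣? (+ 4 ℤ.- + 2))))
    (A₄-comp 3 (from-no (+ 5 ℤ∣.∣? (+ 4 ℤ.- + 3)))) same)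
  (F.trans (F.+-cong (F.+-cong (F.+-cong (F.+-cong (kill 0) (kill 1)) (kill 2)) (kill 3)) (F.refl {stretch 5 φ₄ ⊛ q ^ 4}))
    (solve 1 (λ a → :0 :+ :0 :+ :0 :+ :0 :+ a , a) refl (stretch 5 φ₄ ⊛ q ^ 4))))
  where
  same : comp 4 A₄ ≈ φ₄
  same = F.sym (F.trans (φ-comp 4) (F.trans (F.+-cong (F.+-cong (θ₅-comp (+ 0) 4 (from-no (+ 5 ℤ∣.∣? (+ 0 ℤ.- + 4))))
      (A₁-comp 4 (from-no (+ 5 ℤ∣.∣? (+ 1 ℤ.- + 4))))) (F.refl {comp 4 A₄}))
    (solve 1 (λ a → :0 :+ :0 :+ a , a) refl (comp 4 A₄))))
  kill : ∀ i → stretch 5 zeroF ⊛ q ^ i ≈ zeroF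
  kill i = F.trans (F.*-congʳ {q ^ i} (stretch-constF 5 (+ 0))) (F.zeroˡ (q ^ i))

-- `lattice-split` is an identity between series in q⁵, with A₁ A₄ contributing q · q⁴; undoing the
-- substitution leaves the factor q.
φ-square : φ ⊛ φ ≈ φ₀ ⊛ φ₀ ⊕ q ⊛ (φ₁ ⊛ φ₄)
φ-square = stretch5-injective (F.trans (stretch-⊛ 5 φ φ) (F.trans lattice-split (F.trans
  (F.+-congˡ {stretch 5 φ₀ ⊛ stretch 5 φ₀} (F.trans (F.*-cong A₁≈ A₄≈)
    (solve 3 (λ a b q → a :* q :^ 1 :* (b :* q :^ 4) , q :^ 5 :* (a :* b)) refl (stretch 5 φ₁) (stretch 5 φ₄) q)))
  (F.sym (F.trans (stretch-⊕ 5 (φ₀ ⊛ φ₀) (q ⊛ (φ₁ ⊛ φ₄))) (F.+-cong (stretch-⊛ 5 φ₀ φ₀)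
    (F.trans (stretch-⊛ 5 q (φ₁ ⊛ φ₄)) (F.*-cong (stretch-q 4) (stretch-⊛ 5 φ₁ φ₄)))))))))

tri2 : ∀ n → + 2 ℤ.* + tri n ≡ + n ℤ.* (+ n ℤ.+ + 1)
tri2 zero    = refl
tri2 (suc n) = trans (cong (+ 2 ℤ.*_) (ℤₚ.pos-+ (suc n) (tri n))) (trans (ℤₚ.*-distribˡ-+ (+ 2) (+ suc n) (+ tri n))
  (trans (cong (ℤ._+_ (+ 2 ℤ.* + suc n)) (tri2 n)) (step (+ n))))
  where
  step : ∀ n → + 2 ℤ.* (+ 1 ℤ.+ n) ℤ.+ n ℤ.* (n ℤ.+ + 1) ≡ (+ 1 ℤ.+ n) ℤ.* (+ 1 ℤ.+ n ℤ.+ + 1)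
  step = solve-∀

pent2 : ∀ j → + 2 ℤ.* + pent j ≡ j ℤ.* (+ 3 ℤ.* j ℤ.- + 1)
pent2 (+ 0)     = refl
pent2 (+ suc n) = trans (cong (+ 2 ℤ.*_) (ℤₚ.pos-+ (suc n * suc n) (tri n))) (trans (ℤₚ.*-distribˡ-+ (+ 2) (+ (suc n * suc n)) (+ tri n))
  (trans (cong₂ (λ a b → + 2 ℤ.* a ℤ.+ b) (ℤₚ.pos-* (suc n) (suc n)) (tri2 n)) (step (+ n))))
  where
  step : ∀ n → + 2 ℤ.* ((+ 1 ℤ.+ n) ℤ.* (+ 1 ℤ.+ n)) ℤ.+ n ℤ.* (n ℤ.+ + 1) ≡ (+ 1 ℤ.+ n) ℤ.* (+ 3 ℤ.* (+ 1 ℤ.+ n) ℤ.- + 1)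
  step = solve-∀
pent2 -[1+ n ]  = trans (cong (+ 2 ℤ.*_) (ℤₚ.pos-+ (suc n * suc n) (tri (suc n))))
    (trans (ℤₚ.*-distribˡ-+ (+ 2) (+ (suc n * suc n)) (+ tri (suc n)))
  (trans (cong₂ (λ a b → + 2 ℤ.* a ℤ.+ b) (ℤₚ.pos-* (suc n) (suc n)) (tri2 (suc n))) (step (+ n))))
  where
  step : ∀ n → + 2 ℤ.* ((+ 1 ℤ.+ n) ℤ.* (+ 1 ℤ.+ n)) ℤ.+ (+ 1 ℤ.+ n) ℤ.* (+ 1 ℤ.+ n ℤ.+ + 1) ≡ (ℤ.- (+ 1 ℤ.+ n)) ℤ.*
      (+ 3 ℤ.* (ℤ.- (+ 1 ℤ.+ n)) ℤ.- + 1)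
  step = solve-∀

-- The residue of a pentagonal number mod 5 is tested on its double, which is polynomial in j; 2 is
-- invertible mod 5.
pentTerm-comp : ∀ c i → ¬ (+ 5 ℤ∣.∣ (c ℤ.* (+ 3 ℤ.* c ℤ.- + 1) ℤ.- + 2 ℤ.* + i)) → ∀ k l → pentTerm (c ℤ.+ + 5 ℤ.* l) (i + 5 * k) ≡ + 0
pentTerm-comp c i ∤ k l = monomial-≢ ∣ j ∣ (pent j) (i + 5 * k) λ p → ∤
    (ℤ∣.divides (+ 2 ℤ.* + k ℤ.- (+ 6 ℤ.* c ℤ.* l ℤ.- l ℤ.+ + 15 ℤ.* (l ℤ.* l)))
    (trans (cong (ℤ._-_ (c ℤ.* (+ 3 ℤ.* c ℤ.- + 1))) (solve-i (+ i) (+ k) _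
        (trans (cong (+ 2 ℤ.*_) (trans (sym (+lin i k)) (cong +_ p))) (pent2 j)))) (expand c (+ k) l)))
  where
  j = c ℤ.+ + 5 ℤ.* l
  solve-i : ∀ i k s → + 2 ℤ.* (i ℤ.+ + 5 ℤ.* k) ≡ s → + 2 ℤ.* i ≡ s ℤ.- + 10 ℤ.* k
  solve-i i k s refl = cancel i k
    where
    cancel : ∀ i k → + 2 ℤ.* i ≡ + 2 ℤ.* (i ℤ.+ + 5 ℤ.* k) ℤ.- + 10 ℤ.* k
    cancel = solve-∀
  expand : ∀ c k l → c ℤ.* (+ 3 ℤ.* c ℤ.- + 1) ℤ.- ((c ℤ.+ + 5 ℤ.* l) ℤ.* (+ 3 ℤ.* (c ℤ.+ + 5 ℤ.* l) ℤ.- + 1) ℤ.- + 10 ℤ.* k) ≡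
    (+ 2 ℤ.* k ℤ.- (+ 6 ℤ.* c ℤ.* l ℤ.- l ℤ.+ + 15 ℤ.* (l ℤ.* l))) ℤ.* + 5
  expand = solve-∀

f1-residues : ∀ k → f 1 k ≡ zs k (λ l → pentTerm (+ 0 ℤ.+ + 5 ℤ.* l) k) ℤ.+
    (zs k (λ l → pentTerm (+ 1 ℤ.+ + 5 ℤ.* l) k) ℤ.+ zs k (λ l → pentTerm (ℤ.- (+ 1) ℤ.+ + 5 ℤ.* l) k))
  ℤ.+ (zs k (λ l → pentTerm (+ 2 ℤ.+ + 5 ℤ.* l) k) ℤ.+ zs k (λ l → pentTerm (ℤ.- (+ 2) ℤ.+ + 5 ℤ.* l) k))
f1-residues k = trans (f1≈pentagonal (2 + 5 * k) k (k≤2+5k k)) (trans (zsF-at (2 + 5 * k) pentTerm k)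
  (trans (zs-residues k (λ n → pentTerm n k)) (zs-byResidue k (λ n → pentTerm n k))))

-- 0, 2, 4, 10, 14 are the values of c (3c - 1) at c = 0, 1, -1, 2, -2.
f1-comp-zero : ∀ i → ¬ (+ 5 ℤ∣.∣ (+ 0 ℤ.- + 2 ℤ.* + i)) → ¬ (+ 5 ℤ∣.∣ (+ 2 ℤ.- + 2 ℤ.* + i)) → ¬ (+ 5 ℤ∣.∣ (+ 4 ℤ.- + 2 ℤ.* + i)) →
  ¬ (+ 5 ℤ∣.∣ (+ 10 ℤ.- + 2 ℤ.* + i)) → ¬ (+ 5 ℤ∣.∣ (+ 14 ℤ.- + 2 ℤ.* + i)) → comp i (f 1) ≈ zeroF
f1-comp-zero i a b c d e = comp-zero i (f 1) λ k → trans (f1-residues (i + 5 * k))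
  (cong₂ ℤ._+_ (cong₂ ℤ._+_ (vanish (+ 0) a k) (cong₂ ℤ._+_ (vanish (+ 1) b k) (vanish ℤ.-1ℤ c k)))
      (cong₂ ℤ._+_ (vanish (+ 2) d k) (vanish (ℤ.- (+ 2)) e k)))
  where
  vanish : ∀ c → ¬ (+ 5 ℤ∣.∣ (c ℤ.* (+ 3 ℤ.* c ℤ.- + 1) ℤ.- + 2 ℤ.* + i)) → ∀ k → zs (i + 5 * k)
      (λ l → pentTerm (c ℤ.+ + 5 ℤ.* l) (i + 5 * k)) ≡ + 0
  vanish c ∤ k = zs-zero (i + 5 * k) (pentTerm-comp c i ∤ k)

f1-comp₃ : comp 3 (f 1) ≈ zeroF
f1-comp₃ = f1-comp-zero 3 (from-no (+ 5 ℤ∣.∣? (+ 0 ℤ.- + 6))) (from-no (+ 5 ℤ∣.∣? (+ 2 ℤ.- + 6))) (from-no (+ 5 ℤ∣.∣? (+ 4 ℤ.- + 6)))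
  (from-no (+ 5 ℤ∣.∣? (+ 10 ℤ.- + 6))) (from-no (+ 5 ℤ∣.∣? (+ 14 ℤ.- + 6)))

f1-comp₄ : comp 4 (f 1) ≈ zeroF
f1-comp₄ = f1-comp-zero 4 (from-no (+ 5 ℤ∣.∣? (+ 0 ℤ.- + 8))) (from-no (+ 5 ℤ∣.∣? (+ 2 ℤ.- + 8))) (from-no (+ 5 ℤ∣.∣? (+ 4 ℤ.- + 8)))
  (from-no (+ 5 ℤ∣.∣? (+ 10 ℤ.- + 8))) (from-no (+ 5 ℤ∣.∣? (+ 14 ℤ.- + 8)))

sg-5* : ∀ n → sg (5 * n) ≈ sg n
sg-5* n = F.trans (F.sym (^-assocʳ (constF ℤ.-1ℤ) 5 n)) (^-congˡ n (solve 0 (con ℤ.-1ℤ :^ 5 , con ℤ.-1ℤ) refl))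

sg-1+ : ∀ j → sg ∣ + 1 ℤ.+ j ∣ ≈ constF ℤ.-1ℤ ⊛ sg ∣ j ∣
sg-1+ (+ n)          = F.refl
sg-1+ -[1+ zero ]    = solve 0 (:1 , con ℤ.-1ℤ :* (con ℤ.-1ℤ :* :1)) refl
sg-1+ -[1+ suc n ]   = F.trans (^-congʳ (constF ℤ.-1ℤ) (cong ∣_∣ (ℤₚ.[1+m]⊖[1+n]≡m⊖n 0 (suc n))))
  (solve 1 (λ s → s , con ℤ.-1ℤ :* (con ℤ.-1ℤ :* s)) refl (sg (suc n)))

pentTerm₅ : ℤ → FPS
pentTerm₅ l = sg ∣ l ∣ ⊛ q ^ (5 * pent l)

stretch-pentTerm : ∀ l → stretch 5 (pentTerm l) ≈ pentTerm₅ l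
stretch-pentTerm l = F.trans (stretch-⊛ 5 (sg ∣ l ∣) (q ^ pent l)) (F.*-cong
    (F.trans (stretch-^ 5 _ ∣ l ∣) (^-congˡ ∣ l ∣ (stretch-constF 5 _)))
  (F.trans (stretch-^ 5 q (pent l)) (F.trans (^-congˡ (pent l) (stretch-q 4)) (^-assocʳ q 5 (pent l)))))

-- This makes the class j ≡ 1 (mod 5) of the pentagonal series a copy of the whole series in q²⁵,
-- with index -l.
pent-1+5* : ∀ l → pent (+ 1 ℤ.+ + 5 ℤ.* l) ≡ 1 + 5 * (5 * pent (ℤ.- l))
pent-1+5* l = ℤₚ.+-injective (ℤₚ.*-cancelˡ-≡ (+ 2) _ _ (trans (pent2 (+ 1 ℤ.+ + 5 ℤ.* l)) (trans (expand l)
  (trans (cong (λ a → + 2 ℤ.* + 1 ℤ.+ + 25 ℤ.* a) (sym (pent2 (ℤ.- l)))) (trans (regroup (+ pent (ℤ.- l)))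
  (cong (λ a → + 2 ℤ.* (+ 1 ℤ.+ a)) (sym (trans (ℤₚ.pos-* 5 (5 * pent (ℤ.- l))) (cong (+ 5 ℤ.*_) (ℤₚ.pos-* 5 (pent (ℤ.- l))))))))))))
  where
  expand : ∀ l → (+ 1 ℤ.+ + 5 ℤ.* l) ℤ.* (+ 3 ℤ.* (+ 1 ℤ.+ + 5 ℤ.* l) ℤ.- + 1) ≡ + 2 ℤ.* + 1 ℤ.+ + 25 ℤ.*
      ((ℤ.- l) ℤ.* (+ 3 ℤ.* (ℤ.- l) ℤ.- + 1))
  expand = solve-∀
  regroup : ∀ p → + 2 ℤ.* + 1 ℤ.+ + 25 ℤ.* (+ 2 ℤ.* p) ≡ + 2 ℤ.* (+ 1 ℤ.+ + 5 ℤ.* (+ 5 ℤ.* p))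
  regroup = solve-∀

pentTerm-1+5* : ∀ l → pentTerm (+ 1 ℤ.+ + 5 ℤ.* l) ≈ stretch 5 (constF ℤ.-1ℤ ⊛ pentTerm₅ (ℤ.- l)) ⊛ q ^ 1
pentTerm-1+5* l = F.trans (F.*-cong (F.trans (sg-1+ (+ 5 ℤ.* l)) (F.*-congˡ {constF ℤ.-1ℤ}
    (F.trans (^-congʳ _ (ℤₚ.abs-* (+ 5) l)) (F.trans (sg-5* ∣ l ∣)
    (^-congʳ _ (sym (ℤₚ.∣-i∣≡∣i∣ l)))))))
    (F.trans (^-congʳ q (pent-1+5* l)) (F.*-congˡ {q} (F.sym (^-assocʳ q 5 (5 * pent (ℤ.- l)))))))
  (F.trans (solve 4 (λ m s q Z → m :* s :* (q :* Z) , m :* (s :* Z) :* q :^ 1) refl (constF ℤ.-1ℤ) (sg ∣ ℤ.- l ∣) q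
      ((q ^ 5) ^ (5 * pent (ℤ.- l))))
  (F.*-congʳ {q ^ 1} (F.sym (F.trans (stretch-⊛ 5 _ (pentTerm₅ (ℤ.- l))) (F.*-cong (stretch-constF 5 _)
    (F.trans (stretch-⊛ 5 (sg ∣ ℤ.- l ∣) (q ^ (5 * pent (ℤ.- l)))) (F.*-cong
        (F.trans (stretch-^ 5 _ ∣ ℤ.- l ∣) (^-congˡ ∣ ℤ.- l ∣ (stretch-constF 5 _)))
      (F.trans (stretch-^ 5 q (5 * pent (ℤ.- l))) (^-congˡ (5 * pent (ℤ.- l)) (stretch-q 4))))))))))

-- Only j ≡ 1 satisfies j (3j - 1) ≡ 2 (mod 5). Its terms form -q times the pentagonal series at
-- q²⁵; the reversal of l is harmless on a symmetric window.
f1-comp₁ : comp 1 (f 1) ≈ constF ℤ.-1ℤ ⊛ f 5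
f1-comp₁ k = trans (f1-residues (1 + 5 * k)) (trans
  (cong₂ ℤ._+_ (cong₂ ℤ._+_ (vanish (+ 0) (from-no (+ 5 ℤ∣.∣? (+ 0 ℤ.- + 2))))
      (cong₂ ℤ._+_ (zs-cong N (λ l → main l)) (vanish ℤ.-1ℤ (from-no (+ 5 ℤ∣.∣? (+ 4 ℤ.- + 2))))))
    (cong₂ ℤ._+_ (vanish (+ 2) (from-no (+ 5 ℤ∣.∣? (+ 10 ℤ.- + 2)))) (vanish (ℤ.- (+ 2)) (from-no (+ 5 ℤ∣.∣? (+ 14 ℤ.- + 2))))))
  (trans (tidy (zs N (λ l → (constF ℤ.-1ℤ ⊛ pentTerm₅ (ℤ.- l)) k)))
  (trans (zs-negate N (λ l → (constF ℤ.-1ℤ ⊛ pentTerm₅ l) k))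
  (trans (sym (zsF-at N (λ l → constF ℤ.-1ℤ ⊛ pentTerm₅ l) k)) (trans (sym (⊛-zsF N pentTerm₅ (constF ℤ.-1ℤ) k))
  (≈[≤]-⊛ {k} {constF ℤ.-1ℤ} {constF ℤ.-1ℤ} {zsF N pentTerm₅} {f 5} (λ _ _ → refl) (λ j j≤k → sym (trans (sym (stretch-f 4 0 j))
    (trans (stretch-≈[≤] 5 (f1≈pentagonal N) j (ℕₚ.≤-trans j≤k k≤N)) (trans (stretch-zsF 5 N pentTerm j)
    (trans (zsF-at N _ j) (trans (zs-cong N (λ l → stretch-pentTerm l j)) (sym (zsF-at N pentTerm₅ j)))))))) k ℕₚ.≤-refl))))))
  where
  N = 1 + 5 * k
  k≤N : k ≤ N
  k≤N = ℕₚ.≤-trans (ℕₚ.m≤n*m k 5) (ℕₚ.n≤1+n _)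
  vanish : ∀ c → ¬ (+ 5 ℤ∣.∣ (c ℤ.* (+ 3 ℤ.* c ℤ.- + 1) ℤ.- + 2)) → zs N (λ l → pentTerm (c ℤ.+ + 5 ℤ.* l) N) ≡ + 0
  vanish c ∤ = zs-zero N (pentTerm-comp c 1 ∤ k)
  main : ∀ l → pentTerm (+ 1 ℤ.+ + 5 ℤ.* l) N ≡ (constF ℤ.-1ℤ ⊛ pentTerm₅ (ℤ.- l)) k
  main l = trans (pentTerm-1+5* l N) (trans (comp-stretch⊛ 1 (s≤s (s≤s z≤n)) (constF ℤ.-1ℤ ⊛ pentTerm₅ (ℤ.- l)) (q ^ 1) k)
    (trans (F.*-congˡ {constF ℤ.-1ℤ ⊛ pentTerm₅ (ℤ.- l)} (comp-q^-≡ 1 (s≤s (s≤s z≤n))) k)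
        (F.*-identityʳ (constF ℤ.-1ℤ ⊛ pentTerm₅ (ℤ.- l)) k)))
  tidy : ∀ a → + 0 ℤ.+ (a ℤ.+ + 0) ℤ.+ (+ 0 ℤ.+ + 0) ≡ a
  tidy = solve-∀

-- Substitution into expressions and linear combinations of equations

pow≈^ : ∀ g n → pow g n ≈ g ^ n
pow≈^ g zero    = F.refl
pow≈^ g (suc n) = F.*-congˡ {g} (pow≈^ g n)

stretch-eval : ∀ r {n} {ρ ρ′ : Vec FPS n} → Pointwise (λ g h → stretch r g ≈ h) ρ ρ′ → ∀ e → stretch r (⟦ e ⟧ ρ) ≈ ⟦ e ⟧ ρ′
stretch-eval r ps (con c)   = stretch-constF r c
stretch-eval r ps (var i)   = Pointwise.lookup ps i
stretch-eval r {ρ = ρ} ps (e :+ e′) = F.trans (stretch-⊕ r (⟦ e ⟧ ρ) (⟦ e′ ⟧ ρ)) (F.+-cong (stretch-eval r ps e) (stretch-eval r ps e′))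
stretch-eval r {ρ = ρ} ps (e :* e′) = F.trans (stretch-⊛ r (⟦ e ⟧ ρ) (⟦ e′ ⟧ ρ)) (F.*-cong (stretch-eval r ps e) (stretch-eval r ps e′))
stretch-eval r {ρ = ρ} ps (e :- e′) = F.trans (stretch-⊕ r (⟦ e ⟧ ρ) (F.- ⟦ e′ ⟧ ρ)) (F.+-cong (stretch-eval r ps e)
  (F.trans (stretch-scale r ℤ.-1ℤ (⟦ e′ ⟧ ρ)) (F.-‿cong (stretch-eval r ps e′))))
stretch-eval r {ρ = ρ} ps (:- e)    = F.trans (stretch-scale r ℤ.-1ℤ (⟦ e ⟧ ρ)) (F.-‿cong (stretch-eval r ps e))
stretch-eval r {ρ = ρ} ps (e :^ k)  = F.trans (stretch-^ r (⟦ e ⟧ ρ) k) (^-congˡ k (stretch-eval r ps e))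

-- Linear combinations of equations: by (c ∙ p ⊞ c′ ∙ p′) proves l ≈ r once l - r is that combination of the differences.
infixr 5 _∙_
infixl 4 _⊞_

_∙_ : ∀ c {a b} → a ≈ b → c ⊛ a ≈ c ⊛ b
c ∙ p = F.*-congˡ {c} p

_⊞_ : ∀ {a b a′ b′} → a ≈ b → a′ ≈ b′ → a ⊕ a′ ≈ b ⊕ b′
p ⊞ p′ = F.+-cong p p′

by : ∀ {l r a b} → a ≈ b → l ⊕ b ≈ r ⊕ a → l ≈ r
by {l} {r} {a} {b} p h = ∙-cancelʳ b l r (F.trans h (F.+-congˡ {r} p))

-- After the constant term of g is split off, both orders multiply the tail by the same power of q,
-- which gives a strong induction on the index.
stretch-commute : ∀ r s g → stretch (suc r) (stretch (suc s) g) ≈ stretch (suc s) (stretch (suc r) g)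
stretch-commute r s g n = go n n ℕₚ.≤-refl g
  where
  split : ∀ r g → stretch (suc r) g ≈ constF (g 0) ⊕ q ^ suc r ⊛ stretch (suc r) (tailF g)
  split r g = F.trans pieces (F.+-congˡ {constF (g 0)} (shiftQ≈q^ (suc r) (stretch (suc r) (tailF g))))
    where
    pieces : stretch (suc r) g ≈ constF (g 0) ⊕ shiftQ (suc r) (stretch (suc r) (tailF g))
    pieces zero    = sym (ℤₚ.+-identityʳ (g 0))
    pieces (suc n) = trans (str-shiftQ r (tailF g) r n) (sym (ℤₚ.+-identityˡ _))
  both : ∀ r s g → stretch (suc r) (stretch (suc s) g) ≈ constF (g 0) ⊕ q ^ (suc r * suc s) ⊛ stretch (suc r) (stretch (suc s) (tailF g))
  both r s g = F.trans (stretch-cong (suc r) (split s g)) (F.trans (stretch-⊕ (suc r) (constF (g 0)) _)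
      (F.+-cong (stretch-constF (suc r) (g 0))
    (F.trans (stretch-⊛ (suc r) (q ^ suc s) _) (F.*-congʳ {stretch (suc r) (stretch (suc s) (tailF g))}
        (F.trans (stretch-^ (suc r) q (suc s))
      (F.trans (^-congˡ (suc s) (stretch-q r)) (^-assocʳ q (suc r) (suc s))))))))
  go : ∀ n k → k ≤ n → ∀ g → stretch (suc r) (stretch (suc s) g) k ≡ stretch (suc s) (stretch (suc r) g) k
  go n       zero    _         g = refl
  go (suc n) (suc k) (s≤s k≤n) g = trans (both r s g (suc k)) (trans (cong (ℤ._+_ (+ 0)) (step k k≤n)) (sym (both s r g (suc k))))
    where
    step : ∀ k → k ≤ n → (q ^ (suc r * suc s) ⊛ stretch (suc r) (stretch (suc s) (tailF g))) (suc k) ≡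
      (q ^ (suc s * suc r) ⊛ stretch (suc s) (stretch (suc r) (tailF g))) (suc k)
    step k k≤n = trans (sym (shiftQ≈q^ (suc r * suc s) _ (suc k))) (trans
        (shiftQ-cong≤ (s + r * suc s) k (λ j j≤k → go n j (ℕₚ.≤-trans j≤k k≤n) (tailF g)))
      (trans (cong (λ m → shiftQ m (stretch (suc s) (stretch (suc r) (tailF g))) (suc k)) (ℕₚ.*-comm (suc r) (suc s)))
          (shiftQ≈q^ (suc s * suc r) _ (suc k))))

-- Comparing the components of f 1 squared and f 2 times φ

e₀ e₂ d₀ d₄ : FPS
e₀ = comp 0 (f 1)
e₂ = comp 2 (f 1)
d₀ = stretch 2 e₀
d₄ = stretch 2 e₂

infix 9 ↑_
↑_ : FPS → FPS
↑ g = stretch 5 g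

f25≈↑ : f 25 ≈ ↑ f 5
f25≈↑ = F.sym (stretch-f 4 4)

f50≈↑ : f 50 ≈ ↑ f 10
f50≈↑ = F.sym (stretch-f 4 9)

f1-dissect : f 1 ≈ ↑ e₀ F.+ F.- (q ⊛ ↑ f 5) ⊕ q ^ 2 ⊛ ↑ e₂
f1-dissect = F.trans (comp-dissect (f 1)) (F.trans (dissect-cong (F.refl {e₀}) f1-comp₁ (F.refl {e₂}) f1-comp₃ f1-comp₄)
  (F.trans (F.+-cong (F.+-cong (F.+-cong (F.+-congˡ {↑ e₀ ⊛ q ^ 0} (F.*-congʳ {q ^ 1} (F.trans (stretch-⊛ 5 (constF ℤ.-1ℤ) (f 5))
      (F.*-congʳ {↑ f 5} (stretch-constF 5 _))))) (F.refl {↑ e₂ ⊛ q ^ 2})) (F.*-congʳ {q ^ 3} (stretch-constF 5 (+ 0))))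
          (F.*-congʳ {q ^ 4} (stretch-constF 5 (+ 0))))
    (solve 4 (λ a b c q → a :* q :^ 0 :+ con ℤ.-1ℤ :* b :* q :^ 1 :+ c :* q :^ 2 :+ :0 :* q :^ 3 :+ :0 :* q :^ 4 , a :- q :* b :+ q :^ 2 :*
        c) refl
      (↑ e₀) (↑ f 5) (↑ e₂) q)))

-- `f 2` is `f 1` at q², which doubles the exponents 0, 1, 2 of the dissection; the counterpart of
-- `e₂` therefore sits at exponent 4 and is called `d₄`.
f2-dissect : f 2 ≈ ↑ d₀ F.+ F.- (q ^ 2 ⊛ ↑ f 10) ⊕ q ^ 4 ⊛ ↑ d₄
f2-dissect = F.trans (F.sym (stretch-f 1 0)) (F.trans (stretch-cong 2 f1-dissect) (F.trans
  (stretch-eval 2 {ρ = ↑ e₀ ∷ ↑ f 5 ∷ ↑ e₂ ∷ q ∷ []} {ρ′ = ↑ d₀ ∷ ↑ f 10 ∷ ↑ d₄ ∷ q ^ 2 ∷ []}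
    (stretch-commute 1 4 e₀ ∷ F.trans (stretch-commute 1 4 (f 5)) (stretch-cong 5 (stretch-f 1 4)) ∷ stretch-commute 1 4 e₂ ∷ stretch-q 1 ∷
        [])
    (var zero :- var (suc (suc (suc zero))) :* var (suc zero) :+ var (suc (suc (suc zero))) :^ 2 :* var (suc (suc zero))))
  (solve 4 (λ a b c q → a :- q :^ 2 :* b :+ (q :^ 2) :^ 2 :* c , a :- q :^ 2 :* b :+ q :^ 4 :* c) refl (↑ d₀) (↑ f 10) (↑ d₄) q)))

φ-dissect : φ ≈ ↑ φ₀ ⊕ q ⊛ ↑ φ₁ ⊕ q ^ 4 ⊛ ↑ φ₄
φ-dissect = F.trans (comp-dissect φ) (F.trans (dissect-cong φ-comp₀ (F.refl {φ₁}) φ-comp₂ φ-comp₃ (F.refl {φ₄}))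
  (F.trans (F.+-congʳ {↑ φ₄ ⊛ q ^ 4} (F.+-cong (F.+-congˡ {↑ φ₀ ⊛ q ^ 0 ⊕ ↑ φ₁ ⊛ q ^ 1} (F.*-congʳ {q ^ 2} (stretch-constF 5 (+ 0))))
      (F.*-congʳ {q ^ 3} (stretch-constF 5 (+ 0)))))
    (solve 4 (λ a b c q → a :* q :^ 0 :+ b :* q :^ 1 :+ :0 :* q :^ 2 :+ :0 :* q :^ 3 :+ c :* q :^ 4 , a :+ q :* b :+ q :^ 4 :* c) refl
      (↑ φ₀) (↑ φ₁) (↑ φ₄) q)))

v0 : ∀ {n} → Expr (1 + n)
v0 = var zero
v1 : ∀ {n} → Expr (2 + n)
v1 = var (suc zero)
v2 : ∀ {n} → Expr (3 + n)
v2 = var (suc (suc zero))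
v3 : ∀ {n} → Expr (4 + n)
v3 = var (suc (suc (suc zero)))
v4 : ∀ {n} → Expr (5 + n)
v4 = var (suc (suc (suc (suc zero))))
v5 : ∀ {n} → Expr (6 + n)
v5 = var (suc (suc (suc (suc (suc zero)))))
v6 : ∀ {n} → Expr (7 + n)
v6 = var (suc (suc (suc (suc (suc (suc zero))))))

-- A factor q in `M` records a product of components i and j with i + j ≥ 5.
L₀ L₁ L₂ L₃ L₄ M₀ M₁ M₂ M₃ M₄ : FPS
L₀ = e₀ ⊛ e₀
L₁ = constF (ℤ.- (+ 2)) ⊛ e₀ ⊛ f 5
L₂ = f 5 ⊛ f 5 ⊕ constF (+ 2) ⊛ e₀ ⊛ e₂
L₃ = constF (ℤ.- (+ 2)) ⊛ f 5 ⊛ e₂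
L₄ = e₂ ⊛ e₂
M₀ = d₀ ⊛ φ₀ ⊕ q ⊛ d₄ ⊛ φ₁
M₁ = d₀ ⊛ φ₁ F.+ F.- (q ⊛ f 10 ⊛ φ₄)
M₂ = F.- (f 10 ⊛ φ₀)
M₃ = q ⊛ d₄ ⊛ φ₄ F.+ F.- (f 10 ⊛ φ₁)
M₄ = d₀ ⊛ φ₄ ⊕ d₄ ⊛ φ₀

f1²-dissect : f 1 ⊛ f 1 ≈ dissect L₀ L₁ L₂ L₃ L₄
f1²-dissect = F.trans (F.*-cong f1-dissect f1-dissect) (F.sym (F.trans
  (F.+-cong (F.+-cong (F.+-cong (F.+-cong (term 0 (v0 :* v0)) (term 1 (con (ℤ.- (+ 2)) :* v0 :* v1)))
      (term 2 (v1 :* v1 :+ con (+ 2) :* v0 :* v2)))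
    (term 3 (con (ℤ.- (+ 2)) :* v1 :* v2))) (term 4 (v2 :* v2)))
  (solve 4 (λ a b c q → (a :* a) :* q :^ 0 :+ (con (ℤ.- (+ 2)) :* a :* b) :* q :^ 1 :+ (b :* b :+ con (+ 2) :* a :* c) :* q :^ 2 :+
      (con (ℤ.- (+ 2)) :* b :* c) :* q :^ 3 :+ (c :* c) :* q :^ 4 , (a :- q :* b :+ q :^ 2 :* c) :* (a :- q :* b :+ q :^ 2 :* c)) refl
      (↑ e₀) (↑ f 5) (↑ e₂) q)))
  where
  term : ∀ i (e : Expr 3) → ↑ (⟦ e ⟧ (e₀ ∷ f 5 ∷ e₂ ∷ [])) ⊛ q ^ i ≈ ⟦ e ⟧ (↑ e₀ ∷ ↑ f 5 ∷ ↑ e₂ ∷ []) ⊛ q ^ i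
  term i e = F.*-congʳ {q ^ i} (stretch-eval 5 (F.refl {↑ e₀} ∷ F.refl {↑ f 5} ∷ F.refl {↑ e₂} ∷ []) e)

f2φ-dissect : f 2 ⊛ φ ≈ dissect M₀ M₁ M₂ M₃ M₄
f2φ-dissect = F.trans (F.*-cong f2-dissect φ-dissect) (F.sym (F.trans
  (F.+-cong (F.+-cong (F.+-cong (F.+-cong (term 0 (v0 :* v3 :+ v6 :* v2 :* v4)) (term 1 (v0 :* v4 :- v6 :* v1 :* v5)))
      (term 2 (:- (v1 :* v3))))
    (term 3 (v6 :* v2 :* v5 :- v1 :* v4))) (term 4 (v0 :* v5 :+ v2 :* v3)))
  (solve 7 (λ a b c x y z q → (a :* x :+ q :^ 5 :* c :* y) :* q :^ 0 :+ (a :* y :- q :^ 5 :* b :* z) :* q :^ 1 :+ (:- (b :* x)) :* q :^ 2 :+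
      (q :^ 5 :* c :* z :- b :* y) :* q :^ 3 :+ (a :* z :+ c :* x) :* q :^ 4 , (a :- q :^ 2 :* b :+ q :^ 4 :* c) :*
          (x :+ q :* y :+ q :^ 4 :* z)) refl
      (↑ d₀) (↑ f 10) (↑ d₄) (↑ φ₀) (↑ φ₁) (↑ φ₄) q)))
  where
  term : ∀ i (e : Expr 7) → ↑ (⟦ e ⟧ (d₀ ∷ f 10 ∷ d₄ ∷ φ₀ ∷ φ₁ ∷ φ₄ ∷ q ∷ [])) ⊛ q ^ i ≈ ⟦ e ⟧
      (↑ d₀ ∷ ↑ f 10 ∷ ↑ d₄ ∷ ↑ φ₀ ∷ ↑ φ₁ ∷ ↑ φ₄ ∷ q ^ 5 ∷ []) ⊛ q ^ i
  term i e = F.*-congʳ {q ^ i} (stretch-eval 5 (F.refl {↑ d₀} ∷ F.refl {↑ f 10} ∷ F.refl {↑ d₄} ∷ F.refl {↑ φ₀} ∷ F.refl {↑ φ₁} ∷ F.refl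
      {↑ φ₄} ∷ stretch-q 4 ∷ []) e)

private
  L≈M : dissect L₀ L₁ L₂ L₃ L₄ ≈ dissect M₀ M₁ M₂ M₃ M₄
  L≈M = F.trans (F.sym f1²-dissect) (F.trans gauss f2φ-dissect)

L₁≈M₁ : L₁ ≈ M₁
L₁≈M₁ = F.trans (F.sym (comp₁-dissect L₀ L₁ L₂ L₃ L₄)) (F.trans (comp-cong 1 L≈M) (comp₁-dissect M₀ M₁ M₂ M₃ M₄))
L₂≈M₂ : L₂ ≈ M₂
L₂≈M₂ = F.trans (F.sym (comp₂-dissect L₀ L₁ L₂ L₃ L₄)) (F.trans (comp-cong 2 L≈M) (comp₂-dissect M₀ M₁ M₂ M₃ M₄))
L₃≈M₃ : L₃ ≈ M₃
L₃≈M₃ = F.trans (F.sym (comp₃-dissect L₀ L₁ L₂ L₃ L₄)) (F.trans (comp-cong 3 L≈M) (comp₃-dissect M₀ M₁ M₂ M₃ M₄))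
L₄≈M₄ : L₄ ≈ M₄
L₄≈M₄ = F.trans (F.sym (comp₄-dissect L₀ L₁ L₂ L₃ L₄)) (F.trans (comp-cong 4 L≈M) (comp₄-dissect M₀ M₁ M₂ M₃ M₄))

-- R and S are the Rogers–Ramanujan quotients of q and q², and κ is Ramanujan's parameter k.
R S κ : FPS
R = f 5 ⊛ inv e₀
S = stretch 2 R
κ = q ⊛ R ⊛ S ⊛ S

gauss₅ : f 5 ⊛ f 5 ≈ f 10 ⊛ φ₀
gauss₅ = F.trans (F.*-cong (F.sym (stretch-f 4 0)) (F.sym (stretch-f 4 0)))
    (F.trans (F.sym (stretch-⊛ 5 (f 1) (f 1))) (F.trans (stretch-cong 5 gauss)
  (F.trans (stretch-⊛ 5 (f 2) φ) (F.*-congʳ {φ₀} (stretch-f 4 1)))))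

e₀⊛R : e₀ ⊛ R ≈ f 5
e₀⊛R = F.trans (solve 3 (λ e f i → e :* (f :* i) , f :* (e :* i)) refl e₀ (f 5) (inv e₀))
    (F.trans (F.*-congˡ {f 5} (⊛-inv e₀ refl)) (F.*-identityʳ (f 5)))

d₀⊛S : d₀ ⊛ S ≈ f 10
d₀⊛S = F.trans (F.sym (stretch-⊛ 2 e₀ R)) (F.trans (stretch-cong 2 e₀⊛R) (stretch-f 1 4))

-- Component 2 together with `gauss₅` gives e₀ e₂ = -f₅². This makes the three components of `f 1` a
-- geometric progression up to signs, hence a multiple of 1 - a - a².
e₂≈ : e₂ ≈ F.- (R ⊛ f 5)
e₂≈ = unit-cancelˡ e₀ refl (F.trans e₀e₂ (F.sym (F.trans (solve 3 (λ e r f → e :* (:- (r :* f)) , :- (e :* r :* f)) refl e₀ R (f 5))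
  (F.-‿cong (F.*-congʳ {f 5} e₀⊛R)))))
  where
  e₀e₂ : e₀ ⊛ e₂ ≈ F.- (f 5 ⊛ f 5)
  e₀e₂ = constF-cancelˡ (+ 2) (by (oneF ∙ L₂≈M₂ ⊞ oneF ∙ gauss₅)
    (solve 5 (λ a c f g x → con (+ 2) :* (a :* c) :+ (:1 :* (:- (g :* x)) :+ :1 :* (g :* x)) ,
      con (+ 2) :* (:- (f :* f)) :+ (:1 :* (f :* f :+ con (+ 2) :* a :* c) :+ :1 :* (f :* f))) refl e₀ e₂ (f 5) (f 10) φ₀))

d₄≈ : d₄ ≈ F.- (S ⊛ f 10)
d₄≈ = F.trans (stretch-cong 2 e₂≈) (F.trans (stretch-scale 2 ℤ.-1ℤ (R ⊛ f 5))
    (F.-‿cong (F.trans (stretch-⊛ 2 R (f 5)) (F.*-congˡ {S} (stretch-f 1 4)))))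

-- Component 3, after elimination of `e₂` and `d₄`.
φ₁≈ : φ₁ ≈ F.- (constF (+ 2) ⊛ R ⊛ φ₀ ⊕ q ⊛ S ⊛ φ₄)
φ₁≈ = unit-cancelˡ (f 10) refl (by (oneF ∙ L₃≈M₃ ⊞ constF (ℤ.- (+ 2)) ⊛ R ∙ gauss₅ ⊞ constF (+ 2) ⊛ f 5 ∙ e₂≈ ⊞ q ⊛ φ₄ ∙ d₄≈)
  (solve 10 (λ f g p r x q s z e d →
    g :* p :+ (:1 :* (q :* d :* z :- g :* p) :+ con (ℤ.- (+ 2)) :* r :* (g :* x) :+ con (+ 2) :* f :* (:- (r :* f)) :+ q :* z :*
        (:- (s :* g))) ,
    g :* (:- (con (+ 2) :* r :* x :+ q :* s :* z)) :+ (:1 :* (con (ℤ.- (+ 2)) :* f :* e) :+ con (ℤ.- (+ 2)) :* r :* (f :* f) :+ con (+ 2)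
        :* f :* e :+ q :* z :* d)) refl
    (f 5) (f 10) φ₁ R φ₀ q S φ₄ e₂ d₄))

T : FPS
T = R ⊛ R ⊕ S

-- Component 4 multiplied by `S`, which turns `d₀` into `f 10`.
φ₄≈ : φ₄ ≈ S ⊛ T ⊛ φ₀
φ₄≈ = unit-cancelˡ (f 10) refl (by (F.- S ∙ L₄≈M₄ ⊞ S ⊛ R ⊛ R ∙ gauss₅ ⊞ F.- φ₄ ∙ d₀⊛S ⊞ S ⊛ (e₂ F.+ F.- (R ⊛ f 5)) ∙ e₂≈ ⊞ F.- (S ⊛ φ₀) ∙
    d₄≈)
  (solve 10 (λ f g r x s z e d D h →
    g :* z :+ ((:- s) :* (D :* z :+ d :* x) :+ s :* r :* r :* (g :* x) :+ (:- z) :* g :+ s :* (e :- r :* f) :* (:- (r :* f)) :+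
        (:- (s :* x)) :* (:- (s :* g))) ,
    g :* (s :* (r :* r :+ s) :* x) :+ ((:- s) :* (e :* e) :+ s :* r :* r :* (f :* f) :+ (:- z) :* (D :* s) :+ s :* (e :- r :* f) :* e :+
        (:- (s :* x)) :* d)) refl
    (f 5) (f 10) R φ₀ S φ₄ e₂ d₄ d₀ e₀))

-- Component 1 with the other three inserted. For r₁ = r(q) and r₂ = r(q²) it is Ramanujan's
-- relation r₂ - r₁² = r₁ r₂² (r₂ + r₁²).
S-relation : S ≈ R ⊛ R ⊕ κ ⊛ T
S-relation = unit-cancelˡ (f 10 ⊛ φ₀) refl (constF-cancelˡ (+ 2) (by
    (F.- (R ⊛ S) ∙ L₁≈M₁ ⊞ F.- (constF (+ 2) ⊛ S ⊛ f 5) ∙ e₀⊛R ⊞ F.- (R ⊛ φ₁) ∙ d₀⊛S ⊞ F.- (constF (+ 2) ⊛ S) ∙ gauss₅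
      ⊞ F.- (R ⊛ f 10) ∙ φ₁≈ ⊞ constF (+ 2) ⊛ q ⊛ R ⊛ S ⊛ f 10 ∙ φ₄≈)
    (solve 10 (λ e d f g r s q x p z →
      con (+ 2) :* ((g :* x) :* s) :+ ((:- (r :* s)) :* (d :* p :- q :* g :* z) :+ (:- (con (+ 2) :* s :* f)) :* f :+ (:- (r :* p)) :* g :+
          (:- (con (+ 2) :* s)) :* (g :* x)
        :+ (:- (r :* g)) :* (:- (con (+ 2) :* r :* x :+ q :* s :* z)) :+ con (+ 2) :* q :* r :* s :* g :* (s :* (r :* r :+ s) :* x)) ,
      con (+ 2) :* ((g :* x) :* (r :* r :+ q :* r :* s :* s :* (r :* r :+ s))) :+
          ((:- (r :* s)) :* (con (ℤ.- (+ 2)) :* e :* f) :+ (:- (con (+ 2) :* s :* f)) :* (e :* r) :+ (:- (r :* p)) :* (d :* s)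
        :+ (:- (con (+ 2) :* s)) :* (f :* f) :+ (:- (r :* g)) :* p :+ con (+ 2) :* q :* r :* s :* g :* z)) refl
      e₀ d₀ (f 5) (f 10) R S q φ₀ φ₁ φ₄)))

-- Inserting `φ₁≈` and `φ₄≈` into `φ-square` makes the ratio of the squares of φ and φ₀ rational in
-- q, R and S; modulo `S-relation` it depends on κ alone.
φ-relation : φ ⊛ φ ⊛ (oneF F.+ F.- (κ ⊛ κ)) ≈ φ₀ ⊛ φ₀ ⊛ (oneF F.+ F.- (constF (+ 4) ⊛ κ) F.+ F.- (κ ⊛ κ))
φ-relation = by (m ∙ φ-square ⊞ m ⊛ q ⊛ φ₄ ∙ φ₁≈ ⊞ F.- (m ⊛ q ⊛ (constF (+ 2) ⊛ R ⊛ φ₀ ⊕ q ⊛ S ⊛ (φ₄ ⊕ S ⊛ T ⊛ φ₀))) ∙ φ₄≈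
    ⊞ F.- (φ₀ ⊛ φ₀ ⊛ (q ⊛ R ⊛ S ⊛ (constF (+ 2) ⊛ κ F.+ F.- constF (+ 2)) ⊕ q ⊛ q ⊛ S ⊛ S ⊛ S ⊛ (S F.+ F.- (R ⊛ R) ⊕ κ ⊛ T))) ∙ S-relation)
  (solve 7 (λ r s q x p z v → let t = r :* r :+ s ; k = q :* r :* s :* s ; m = :1 :- k :* k
                                  c = x :* x :* (q :* r :* s :* (con (+ 2) :* k :- con (+ 2)) :+ q :* q :* s :* s :* s :*
                                      (s :- r :* r :+ k :* t)) in
    v :* v :* m :+ (m :* (x :* x :+ q :* (p :* z)) :+ m :* q :* z :* (:- (con (+ 2) :* r :* x :+ q :* s :* z))
      :+ (:- (m :* q :* (con (+ 2) :* r :* x :+ q :* s :* (z :+ s :* t :* x)))) :* (s :* t :* x) :+ (:- c) :* (r :* r :+ k :* t)) ,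
    x :* x :* (:1 :- con (+ 4) :* k :- k :* k) :+ (m :* (v :* v) :+ m :* q :* z :* p
      :+ (:- (m :* q :* (con (+ 2) :* r :* x :+ q :* s :* (z :+ s :* t :* x)))) :* z :+ (:- c) :* s)) refl
    R S q φ₀ φ₁ φ₄ φ)
  where
  m = oneF F.+ F.- (κ ⊛ κ)

-- Eta quotients of level 10

-- a and b are the Rogers–Ramanujan continued fractions of q⁵ and q¹⁰, and K is k at q⁵.
a b K u w α β : FPS
a = q ⊛ ↑ R
b = q ^ 2 ⊛ ↑ S
K = ↑ κ
u = ↑ e₀
w = ↑ d₀
α = oneF F.+ F.- a F.+ F.- (a ⊛ a)
β = oneF F.+ F.- b F.+ F.- (b ⊛ b)

1+ 1- Δ Γ : FPS → FPS
1+ g = oneF ⊕ g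
1- g = oneF F.+ F.- g
Δ g = oneF F.+ F.- (constF (+ 4) ⊛ g) F.+ F.- (g ⊛ g)
Γ g = oneF ⊕ g F.+ F.- (g ⊛ g)

K≈ab² : K ≈ a ⊛ b ⊛ b
K≈ab² = F.trans (stretch-eval 5 {ρ = q ∷ R ∷ S ∷ []} {ρ′ = q ^ 5 ∷ ↑ R ∷ ↑ S ∷ []} (stretch-q 4 ∷ F.refl {↑ R} ∷ F.refl {↑ S} ∷ [])
    (var zero :* var (suc zero) :* var (suc (suc zero)) :* var (suc (suc zero))))
  (solve 3 (λ q r s → q :^ 5 :* r :* s :* s , q :* r :* (q :^ 2 :* s) :* (q :^ 2 :* s)) refl q (↑ R) (↑ S))

b-relation : b ⊛ 1- K ≈ a ⊛ a ⊛ 1+ K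
b-relation = by (q ^ 2 ∙ F.trans (stretch-cong 5 S-relation) (stretch-eval 5 {ρ = R ∷ S ∷ κ ∷ []} {ρ′ = ↑ R ∷ ↑ S ∷ K ∷ []}
    (F.refl {↑ R} ∷ F.refl {↑ S} ∷ F.refl {K} ∷ [])
    (var zero :* var zero :+ var (suc (suc zero)) :* (var zero :* var zero :+ var (suc zero)))))
  (solve 4 (λ q r s k → q :^ 2 :* s :* (:1 :- k) :+ q :^ 2 :* (r :* r :+ k :* (r :* r :+ s)) , q :* r :* (q :* r) :* (:1 :+ k) :+ q :^ 2 :*
      s) refl
    q (↑ R) (↑ S) K)

-- Eliminates `b`: multiply K = a b² by (1 - K)² and use `b-relation` twice.
a⁵-relation : a ^ 5 ⊛ 1+ K ^ 2 ≈ K ⊛ 1- K ^ 2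
a⁵-relation = by (F.- (a ⊛ (b ⊛ 1- K ⊕ a ⊛ a ⊛ 1+ K)) ∙ b-relation ⊞ F.- (1- K ^ 2) ∙ K≈ab²)
  (solve 3 (λ a b k → let p = :1 :+ k ; m = :1 :- k in
    a :^ 5 :* p :^ 2 :+ ((:- (a :* (b :* m :+ a :* a :* p))) :* (a :* a :* p) :+ (:- (m :^ 2)) :* (a :* b :* b)) ,
    k :* m :^ 2 :+ ((:- (a :* (b :* m :+ a :* a :* p))) :* (b :* m) :+ (:- (m :^ 2)) :* k)) refl a b K)

qf25≈ : q ⊛ f 25 ≈ u ⊛ a
qf25≈ = F.trans (F.*-congˡ {q} (F.trans f25≈↑ (F.trans (stretch-cong 5 (F.sym e₀⊛R)) (stretch-⊛ 5 e₀ R))))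
  (solve 3 (λ q u r → q :* (u :* r) , u :* (q :* r)) refl q u (↑ R))

q²f50≈ : q ^ 2 ⊛ f 50 ≈ w ⊛ b
q²f50≈ = F.trans (F.*-congˡ {q ^ 2} (F.trans f50≈↑ (F.trans (stretch-cong 5 (F.sym d₀⊛S)) (stretch-⊛ 5 d₀ S))))
  (solve 3 (λ q u r → q :^ 2 :* (u :* r) , u :* (q :^ 2 :* r)) refl q w (↑ S))

f1≈ : f 1 ≈ u ⊛ α
f1≈ = F.trans f1-dissect (F.trans (F.+-cong (F.+-congˡ {u} (F.-‿cong (F.*-congˡ {q} f5↑))) (F.*-congˡ {q ^ 2} (F.trans (stretch-cong 5 e₂≈)
    (F.trans (stretch-scale 5 ℤ.-1ℤ (R ⊛ f 5)) (F.-‿cong (F.trans (stretch-⊛ 5 R (f 5)) (F.*-congˡ {↑ R} f5↑)))))))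
  (solve 3 (λ q u r → u :- q :* (u :* r) :+ q :^ 2 :* (:- (r :* (u :* r))) , u :* (:1 :- q :* r :- q :* r :* (q :* r))) refl q u (↑ R)))
  where
  f5↑ : ↑ f 5 ≈ u ⊛ ↑ R
  f5↑ = F.trans (stretch-cong 5 (F.sym e₀⊛R)) (stretch-⊛ 5 e₀ R)

f2≈ : f 2 ≈ w ⊛ β
f2≈ = F.trans f2-dissect (F.trans (F.+-cong (F.+-congˡ {w} (F.-‿cong (F.*-congˡ {q ^ 2} f10↑)))
    (F.*-congˡ {q ^ 4} (F.trans (stretch-cong 5 d₄≈)
    (F.trans (stretch-scale 5 ℤ.-1ℤ (S ⊛ f 10)) (F.-‿cong (F.trans (stretch-⊛ 5 S (f 10)) (F.*-congˡ {↑ S} f10↑)))))))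
  (solve 3 (λ q u r → u :- q :^ 2 :* (u :* r) :+ q :^ 4 :* (:- (r :* (u :* r))) , u :* (:1 :- q :^ 2 :* r :- q :^ 2 :* r :* (q :^ 2 :* r)))
      refl q w (↑ S)))
  where
  f10↑ : ↑ f 10 ≈ w ⊛ ↑ S
  f10↑ = F.trans (stretch-cong 5 (F.sym d₀⊛S)) (stretch-⊛ 5 d₀ S)

quotient : ∀ g h → h 0 ≡ + 1 → (g ⊛ inv h) ⊛ h ≈ g
quotient g h h₀ = F.trans (solve 3 (λ g i h → g :* i :* h , g :* (h :* i)) refl g (inv h) h)
    (F.trans (F.*-congˡ {g} (⊛-inv h h₀)) (F.*-identityʳ g))

y z X Y Z : FPS
y = f 10 ⊛ f 2 ^ 3 ⊛ inv (f 5 ^ 3 ⊛ f 1)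
z = f 1 ^ 4 ⊛ f 10 ^ 2 ⊛ inv (f 2 ^ 2 ⊛ f 5 ^ 4)
X = ↑ x
Y = ↑ y
Z = ↑ z

x-eq : x ⊛ (f 1 ^ 3 ⊛ f 5) ≈ q ⊛ (f 2 ⊛ f 10 ^ 3)
x-eq = F.trans (F.*-congʳ {D} (shiftQ≈q^ 1 (f 2 ⊛ pow (f 10) 3 ⊛ inv D))) (F.trans
  (solve 4 (λ q g i h → q :^ 1 :* (g :* i) :* h , q :* (g :* i :* h)) refl q (f 2 ⊛ pow (f 10) 3) (inv D) D)
  (F.*-congˡ {q} (quotient (f 2 ⊛ f 10 ^ 3) D refl)))
  where
  D = f 1 ^ 3 ⊛ f 5

y-eq : y ⊛ (f 5 ^ 3 ⊛ f 1) ≈ f 10 ⊛ f 2 ^ 3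
y-eq = quotient (f 10 ⊛ f 2 ^ 3) (f 5 ^ 3 ⊛ f 1) refl

z-eq : z ⊛ (f 2 ^ 2 ⊛ f 5 ^ 4) ≈ f 1 ^ 4 ⊛ f 10 ^ 2
z-eq = quotient (f 1 ^ 4 ⊛ f 10 ^ 2) (f 2 ^ 2 ⊛ f 5 ^ 4) refl

private
  lift : ∀ g (e e′ : Expr 6) → ⟦ e ⟧ (g ∷ f 1 ∷ f 2 ∷ f 5 ∷ f 10 ∷ q ∷ []) ≈ ⟦ e′ ⟧ (g ∷ f 1 ∷ f 2 ∷ f 5 ∷ f 10 ∷ q ∷ []) →
         ⟦ e ⟧ (↑ g ∷ f 5 ∷ f 10 ∷ f 25 ∷ f 50 ∷ q ^ 5 ∷ []) ≈ ⟦ e′ ⟧ (↑ g ∷ f 5 ∷ f 10 ∷ f 25 ∷ f 50 ∷ q ^ 5 ∷ [])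
  lift g e e′ p = F.trans (F.sym (stretch-eval 5 env e)) (F.trans (stretch-cong 5 p) (stretch-eval 5 env e′))
    where
    env = F.refl {↑ g} ∷ stretch-f 4 0 ∷ stretch-f 4 1 ∷ stretch-f 4 4 ∷ stretch-f 4 9 ∷ stretch-q 4 ∷ []

X-eq : X ⊛ (f 5 ^ 3 ⊛ f 25) ≈ q ^ 5 ⊛ (f 10 ⊛ f 50 ^ 3)
X-eq = lift x (v0 :* (v1 :^ 3 :* v3)) (v5 :* (v2 :* v4 :^ 3)) x-eq

Y-eq : Y ⊛ (f 25 ^ 3 ⊛ f 5) ≈ f 50 ⊛ f 10 ^ 3
Y-eq = lift y (v0 :* (v3 :^ 3 :* v1)) (v4 :* v2 :^ 3) y-eq

Z-eq : Z ⊛ (f 10 ^ 2 ⊛ f 25 ^ 4) ≈ f 5 ^ 4 ⊛ f 50 ^ 2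
Z-eq = lift z (v0 :* (v2 :^ 2 :* v3 :^ 4)) (v1 :^ 4 :* v4 :^ 2) z-eq

b-cancelˡ : ∀ {g h} → b ⊛ g ≈ b ⊛ h → g ≈ h
b-cancelˡ {g} {h} p = unit-cancelˡ (↑ S) refl (q-cancelˡ (q-cancelˡ (F.trans (F.sym (move g)) (F.trans p (move h)))))
  where
  move : ∀ g → b ⊛ g ≈ q ⊛ (q ⊛ (↑ S ⊛ g))
  move g = solve 3 (λ q s g → q :^ 2 :* s :* g , q :* (q :* (s :* g))) refl q (↑ S) g

a-cancelˡ : ∀ {g h} → a ⊛ g ≈ a ⊛ h → g ≈ h
a-cancelˡ {g} {h} p = unit-cancelˡ (↑ R) refl (q-cancelˡ (F.trans (F.sym (F.*-assoc q (↑ R) g)) (F.trans p (F.*-assoc q (↑ R) h))))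

-- With f₁ = uα, f₂ = wβ, q f₂₅ = ua and q² f₅₀ = wb, the factors u and w cancel between an eta
-- quotient at q and one at q⁵. The pairing crosses over: x goes with `Y`, y with `X`, and z with
-- the reciprocal of `Z`. This is why `D` is compared with `E′` at q⁵ and `E′` with `D` at q⁵.
x-up : x ⊛ α ^ 3 ⊛ 1+ K ≈ Y ⊛ a ⊛ 1- K ⊛ β
x-up = b-cancelˡ (unit-cancelˡ (u ^ 3 ⊛ f 5) refl (by
  (b ⊛ 1+ K ∙ x-eq′ ⊞ F.- (1+ K ⊛ q ⊛ β ⊛ f 10 ^ 3) ∙ q²f50≈ ⊞ F.- (q ^ 3 ⊛ 1+ K ⊛ β) ∙ Y-eq
    ⊞ 1+ K ⊛ β ⊛ Y ⊛ f 5 ⊛ ((q ⊛ f 25) ^ 2 ⊕ q ⊛ f 25 ⊛ (u ⊛ a) ⊕ (u ⊛ a) ^ 2) ∙ qf25≈ ⊞ F.- (u ^ 3 ⊛ a ⊛ Y ⊛ f 5 ⊛ β) ∙ b-relation)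
  (solve 14 (λ x α k Y a β b u f g v t w q → let p = :1 :+ k ; m = :1 :- k in
    u :^ 3 :* f :* (b :* (x :* α :^ 3 :* p)) :+ (b :* p :* (q :* ((w :* β) :* g :^ 3)) :+ (:- (p :* q :* β :* g :^ 3)) :* (w :* b) :+
        (:- (q :^ 3 :* p :* β)) :* (t :* g :^ 3)
      :+ p :* β :* Y :* f :* ((q :* v) :^ 2 :+ q :* v :* (u :* a) :+ (u :* a) :^ 2) :* (u :* a) :+ (:- (u :^ 3 :* a :* Y :* f :* β)) :*
          (a :* a :* p)) ,
    u :^ 3 :* f :* (b :* (Y :* a :* m :* β)) :+ (b :* p :* (x :* ((u :* α) :^ 3 :* f)) :+ (:- (p :* q :* β :* g :^ 3)) :* (q :^ 2 :* t) :+
        (:- (q :^ 3 :* p :* β)) :* (Y :* (v :^ 3 :* f))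
      :+ p :* β :* Y :* f :* ((q :* v) :^ 2 :+ q :* v :* (u :* a) :+ (u :* a) :^ 2) :* (q :* v) :+ (:- (u :^ 3 :* a :* Y :* f :* β)) :*
          (b :* m))) refl
    x α K Y a β b u (f 5) (f 10) (f 25) (f 50) w q)))
  where
  x-eq′ : x ⊛ ((u ⊛ α) ^ 3 ⊛ f 5) ≈ q ⊛ ((w ⊛ β) ⊛ f 10 ^ 3)
  x-eq′ = F.trans (F.*-congˡ {x} (F.*-congʳ {f 5} (^-congˡ 3 (F.sym f1≈)))) (F.trans x-eq (F.*-congˡ {q} (F.*-congʳ {f 10 ^ 3} f2≈)))

z-up : z ⊛ Z ⊛ β ^ 2 ⊛ 1- K ^ 2 ≈ α ^ 4 ⊛ 1+ K ^ 2
z-up = a-cancelˡ (a-cancelˡ (a-cancelˡ (a-cancelˡ (unit-cancelˡ (w ^ 2 ⊛ f 5 ^ 4) refl (by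
  (a ^ 4 ⊛ Z ⊛ 1- K ^ 2 ∙ z-eq′ ⊞ F.- (Z ⊛ 1- K ^ 2 ⊛ α ^ 4 ⊛ f 10 ^ 2 ⊛ ((q ⊛ f 25) ^ 2 ⊕ (u ⊛ a) ^ 2) ⊛ (q ⊛ f 25 ⊕ u ⊛ a)) ∙ qf25≈
    ⊞ 1- K ^ 2 ⊛ α ^ 4 ⊛ q ^ 4 ∙ Z-eq ⊞ 1- K ^ 2 ⊛ α ^ 4 ⊛ f 5 ^ 4 ⊛ (q ^ 2 ⊛ f 50 ⊕ w ⊛ b) ∙ q²f50≈ ⊞ α ^ 4 ⊛ f 5 ^ 4 ⊛ w ^ 2 ⊛
        (b ⊛ 1- K ⊕ a ⊛ a ⊛ 1+ K) ∙ b-relation)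
  (solve 14 (λ z Z β k α a b u f g v t w q → let p = :1 :+ k ; m = :1 :- k in
    w :^ 2 :* f :^ 4 :* (a :* (a :* (a :* (a :* (z :* Z :* β :^ 2 :* m :^ 2))))) :+ (a :^ 4 :* Z :* m :^ 2 :* ((u :* α) :^ 4 :* g :^ 2)
      :+ (:- (Z :* m :^ 2 :* α :^ 4 :* g :^ 2 :* ((q :* v) :^ 2 :+ (u :* a) :^ 2) :* (q :* v :+ u :* a))) :* (u :* a)
      :+ m :^ 2 :* α :^ 4 :* q :^ 4 :* (f :^ 4 :* t :^ 2) :+ m :^ 2 :* α :^ 4 :* f :^ 4 :* (q :^ 2 :* t :+ w :* b) :* (w :* b)
      :+ α :^ 4 :* f :^ 4 :* w :^ 2 :* (b :* m :+ a :* a :* p) :* (a :* a :* p)) ,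
    w :^ 2 :* f :^ 4 :* (a :* (a :* (a :* (a :* (α :^ 4 :* p :^ 2))))) :+ (a :^ 4 :* Z :* m :^ 2 :* (z :* ((w :* β) :^ 2 :* f :^ 4))
      :+ (:- (Z :* m :^ 2 :* α :^ 4 :* g :^ 2 :* ((q :* v) :^ 2 :+ (u :* a) :^ 2) :* (q :* v :+ u :* a))) :* (q :* v)
      :+ m :^ 2 :* α :^ 4 :* q :^ 4 :* (Z :* (g :^ 2 :* v :^ 4)) :+ m :^ 2 :* α :^ 4 :* f :^ 4 :* (q :^ 2 :* t :+ w :* b) :* (q :^ 2 :* t)
      :+ α :^ 4 :* f :^ 4 :* w :^ 2 :* (b :* m :+ a :* a :* p) :* (b :* m))) refl
    z Z β K α a b u (f 5) (f 10) (f 25) (f 50) w q))))))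
  where
  z-eq′ : z ⊛ ((w ⊛ β) ^ 2 ⊛ f 5 ^ 4) ≈ (u ⊛ α) ^ 4 ⊛ f 10 ^ 2
  z-eq′ = F.trans (F.*-congˡ {z} (F.*-congʳ {f 5 ^ 4} (^-congˡ 2 (F.sym f2≈)))) (F.trans z-eq (F.*-congʳ {f 10 ^ 2} (^-congˡ 4 f1≈)))

y-up : y ⊛ α ⊛ K ⊛ 1+ K ≈ X ⊛ 1- K ⊛ β ^ 3
y-up = a-cancelˡ (unit-cancelˡ (f 5 ^ 3 ⊛ u) refl (by
  (a ⊛ K ⊛ 1+ K ∙ y-eq′ ⊞ a ⊛ 1+ K ⊛ f 10 ⊛ w ^ 3 ⊛ β ^ 3 ∙ K≈ab² ⊞ F.- (b ⊛ b ⊛ f 10 ⊛ w ^ 3 ⊛ β ^ 3) ∙ b-relation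
    ⊞ F.- (1- K ⊛ f 10 ⊛ β ^ 3 ⊛ ((q ^ 2 ⊛ f 50) ^ 2 ⊕ q ^ 2 ⊛ f 50 ⊛ (w ⊛ b) ⊕ (w ⊛ b) ^ 2)) ∙ q²f50≈
    ⊞ F.- (q ⊛ 1- K ⊛ β ^ 3) ∙ X-eq ⊞ 1- K ⊛ β ^ 3 ⊛ X ⊛ f 5 ^ 3 ∙ qf25≈)
  (solve 14 (λ y X β k α a b u f g v t w q → let p = :1 :+ k ; m = :1 :- k in
    f :^ 3 :* u :* (a :* (y :* α :* k :* p)) :+ (a :* k :* p :* (g :* (w :* β) :^ 3) :+ a :* p :* g :* w :^ 3 :* β :^ 3 :* (a :* b :* b)
      :+ (:- (b :* b :* g :* w :^ 3 :* β :^ 3)) :* (a :* a :* p)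
      :+ (:- (m :* g :* β :^ 3 :* ((q :^ 2 :* t) :^ 2 :+ q :^ 2 :* t :* (w :* b) :+ (w :* b) :^ 2))) :* (w :* b)
      :+ (:- (q :* m :* β :^ 3)) :* (q :^ 5 :* (g :* t :^ 3)) :+ m :* β :^ 3 :* X :* f :^ 3 :* (u :* a)) ,
    f :^ 3 :* u :* (a :* (X :* m :* β :^ 3)) :+ (a :* k :* p :* (y :* (f :^ 3 :* (u :* α))) :+ a :* p :* g :* w :^ 3 :* β :^ 3 :* k
      :+ (:- (b :* b :* g :* w :^ 3 :* β :^ 3)) :* (b :* m)
      :+ (:- (m :* g :* β :^ 3 :* ((q :^ 2 :* t) :^ 2 :+ q :^ 2 :* t :* (w :* b) :+ (w :* b) :^ 2))) :* (q :^ 2 :* t)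
      :+ (:- (q :* m :* β :^ 3)) :* (X :* (f :^ 3 :* v)) :+ m :* β :^ 3 :* X :* f :^ 3 :* (q :* v))) refl
    y X β K α a b u (f 5) (f 10) (f 25) (f 50) w q)))
  where
  y-eq′ : y ⊛ (f 5 ^ 3 ⊛ (u ⊛ α)) ≈ f 10 ⊛ (w ⊛ β) ^ 3
  y-eq′ = F.trans (F.*-congˡ {y} (F.*-congˡ {f 5 ^ 3} (F.sym f1≈))) (F.trans y-eq (F.*-congˡ {f 10} (^-congˡ 3 f2≈)))

-- By `gauss` and `gauss₅`, z is φ²/φ₀².
z-relation : z ⊛ (oneF F.+ F.- (κ ⊛ κ)) ≈ Δ κ
z-relation = unit-cancelˡ (φ₀ ^ 2 ⊛ f 10 ^ 2 ⊛ f 2 ^ 2) refl (by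
  (oneF F.+ F.- (κ ⊛ κ) ∙ z-eq ⊞ F.- (z ⊛ (oneF F.+ F.- (κ ⊛ κ)) ⊛ f 2 ^ 2 ⊛ (f 5 ⊛ f 5 ⊕ f 10 ⊛ φ₀)) ∙ gauss₅
    ⊞ (oneF F.+ F.- (κ ⊛ κ)) ⊛ f 10 ^ 2 ⊛ (f 1 ⊛ f 1 ⊕ f 2 ⊛ φ) ∙ gauss ⊞ f 10 ^ 2 ⊛ f 2 ^ 2 ∙ φ-relation)
  (solve 8 (λ z k x v e d f g → let m = :1 :- k :* k ; δ = :1 :- con (+ 4) :* k :- k :* k in
    x :^ 2 :* g :^ 2 :* d :^ 2 :* (z :* m) :+ (m :* (e :^ 4 :* g :^ 2) :+ (:- (z :* m :* d :^ 2 :* (f :* f :+ g :* x))) :* (g :* x)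
      :+ m :* g :^ 2 :* (e :* e :+ d :* v) :* (d :* v) :+ g :^ 2 :* d :^ 2 :* (x :* x :* δ)) ,
    x :^ 2 :* g :^ 2 :* d :^ 2 :* δ :+ (m :* (z :* (d :^ 2 :* f :^ 4)) :+ (:- (z :* m :* d :^ 2 :* (f :* f :+ g :* x))) :* (f :* f)
      :+ m :* g :^ 2 :* (e :* e :+ d :* v) :* (e :* e) :+ g :^ 2 :* d :^ 2 :* (v :* v :* m))) refl
    z κ φ₀ φ (f 1) (f 2) (f 5) (f 10)))

Z-relation : Z ⊛ (oneF F.+ F.- (K ⊛ K)) ≈ Δ K
Z-relation = F.trans (F.sym (stretch-eval 5 env (v0 :* (:1 :- v1 :* v1)))) (F.trans (stretch-cong 5 z-relation)
  (stretch-eval 5 env (:1 :- con (+ 4) :* v1 :- v1 :* v1)))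
  where
  env : Pointwise (λ g h → stretch 5 g ≈ h) (z ∷ κ ∷ []) (Z ∷ K ∷ [])
  env = F.refl {Z} ∷ F.refl {K} ∷ []

-- Polynomials in a over ℤ[K], with a as the outer and K as the inner variable. By a⁵-relation, multiplying by
-- (1+K)² allows replacing a⁵ by K(1-K)²/(1+K)².
reduce : Poly 2 → Poly 2
reduce p = normᴾ {1} ((:1 :+ var zero) :^ 2) ·ᴾ take 5 p +ᴾ normᴾ {1} (var zero :* (:1 :- var zero) :^ 2) ·ᴾ drop 5 p

reduces : ℕ → Poly 2 → Poly 2
reduces zero    p = p
reduces (suc s) p = reduces s (reduce p)

aK : Vec FPS 2
aK = a ∷ K ∷ []

split-at : ∀ n (p : Poly 2) → ⟦ p ⟧ᴾ aK ≈ ⟦ take n p ⟧ᴾ aK ⊕ a ^ n ⊛ ⟦ drop n p ⟧ᴾ aK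
split-at zero    p       = solve 1 (λ p → p , :0 :+ :1 :* p) refl (⟦ p ⟧ᴾ aK)
split-at (suc n) []      = solve 1 (λ a → :0 , :0 :+ a :* :0) refl (a ^ suc n)
split-at (suc n) (c ∷ p) = F.trans (F.+-congˡ {⟦ c ⟧ᴾ (K ∷ [])} (F.*-congˡ {a} (split-at n p)))
  (solve 5 (λ c a l A d → c :+ a :* (l :+ A :* d) , c :+ a :* l :+ a :* A :* d) refl (⟦ c ⟧ᴾ (K ∷ [])) a (⟦ take n p ⟧ᴾ aK) (a ^ n)
      (⟦ drop n p ⟧ᴾ aK))

reduce-correct : ∀ p → 1+ K ^ 2 ⊛ ⟦ p ⟧ᴾ aK ≈ ⟦ reduce p ⟧ᴾ aK
reduce-correct p = F.trans (by (1+ K ^ 2 ∙ split-at 5 p ⊞ H ∙ a⁵-relation)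
    (solve 5 (λ P L H a k → let s = (:1 :+ k) :^ 2 ; t = k :* (:1 :- k) :^ 2 in
      s :* P :+ (s :* (L :+ a :^ 5 :* H) :+ H :* t) , s :* L :+ t :* H :+ (s :* P :+ H :* (a :^ 5 :* s))) refl (⟦ p ⟧ᴾ aK) L H a K))
  (F.sym (F.trans (+ᴾ-correct (pl ·ᴾ take 5 p) (mi ·ᴾ drop 5 p) aK) (F.+-cong
    (F.trans (·ᴾ-correct pl (take 5 p) a (K ∷ [])) (F.*-congʳ {L} (norm-correct plE (K ∷ []))))
    (F.trans (·ᴾ-correct mi (drop 5 p) a (K ∷ [])) (F.*-congʳ {H} (norm-correct miE (K ∷ [])))))))
  where
  L = ⟦ take 5 p ⟧ᴾ aK
  H = ⟦ drop 5 p ⟧ᴾ aK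
  plE miE : Expr 1
  plE = (:1 :+ var zero) :^ 2
  miE = var zero :* (:1 :- var zero) :^ 2
  pl = normᴾ plE
  mi = normᴾ miE

reduces-correct : ∀ s p → (1+ K ^ 2) ^ s ⊛ ⟦ p ⟧ᴾ aK ≈ ⟦ reduces s p ⟧ᴾ aK
reduces-correct zero    p = F.*-identityˡ (⟦ p ⟧ᴾ aK)
reduces-correct (suc s) p = F.trans (solve 3 (λ k s p → k :* s :* p , s :* (k :* p)) refl (1+ K ^ 2) ((1+ K ^ 2) ^ s) (⟦ p ⟧ᴾ aK))
  (F.trans (F.*-congˡ {(1+ K ^ 2) ^ s} (reduce-correct p)) (reduces-correct s (reduce p)))

vanish : ∀ s p → isZero (reduces s p) ≡ true → ⟦ p ⟧ᴾ aK ≈ zeroF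
vanish s p z = unit-cancelˡ ((1+ K ^ 2) ^ s) (^-0 (1+ K ^ 2) s refl)
  (F.trans (reduces-correct s p) (F.trans (isZero-correct (reduces s p) aK z) (F.sym (F.zeroʳ ((1+ K ^ 2) ^ s)))))

-- Each of the s passes lowers the degree in `a` by up to five, down to 4. Surplus passes only
-- multiply by (1 + K)², so any sufficiently large s works.
proveᴷ : ∀ s (e : Expr 2) → isZero (reduces s (normᴾ e)) ≡ true → ⟦ e ⟧ aK ≈ zeroF
proveᴷ s e z = F.trans (F.sym (norm-correct e aK)) (vanish s (normᴾ e) z)

va vK pE mE αE βE : Expr 2
va = var zero
vK = var (suc zero)
pE = :1 :+ vK
mE = :1 :- vK
αE = :1 :- va :- va :* va
βE = mE :^ 2 :- va :^ 2 :* pE :* mE :- va :^ 4 :* pE :^ 2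

ΔE ΓE : ∀ {n} → Expr n → Expr n
ΔE k = :1 :- con (+ 4) :* k :- k :* k
ΓE k = :1 :+ k :- k :* k

-- β times (1 - K)², with b (1 - K) replaced by a² (1 + K) so that only `a` and `K` remain.
β₂ : FPS
β₂ = ⟦ βE ⟧ aK

β₂-relation : β ⊛ 1- K ^ 2 ≈ β₂
β₂-relation = by (F.- (1- K ⊕ b ⊛ 1- K ⊕ a ⊛ a ⊛ 1+ K) ∙ b-relation)
  (solve 3 (λ a b k → let p = :1 :+ k ; m = :1 :- k in
    (:1 :- b :- b :* b) :* m :^ 2 :+ (:- (m :+ b :* m :+ a :* a :* p)) :* (a :* a :* p) ,
    m :^ 2 :- a :^ 2 :* p :* m :- a :^ 4 :* p :^ 2 :+ (:- (m :+ b :* m :+ a :* a :* p)) :* (b :* m)) refl a b K)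

-- The two identities between eta quotients to be proved are D = 0 and E′ = 0.
D E′ : FPS
D  = z ⊛ (oneF ⊕ constF (+ 4) ⊛ x) F.+ F.- oneF
E′ = constF (+ 4) ⊛ y ⊕ z F.+ F.- constF (+ 5)

↑D : ↑ D ≈ Z ⊛ (oneF ⊕ constF (+ 4) ⊛ X) F.+ F.- oneF
↑D = stretch-eval 5 {ρ = z ∷ x ∷ []} {ρ′ = Z ∷ X ∷ []} (F.refl {Z} ∷ F.refl {X} ∷ [])
    (var zero :* (:1 :+ con (+ 4) :* var (suc zero)) :- :1)

↑E : ↑ E′ ≈ constF (+ 4) ⊛ Y ⊕ Z F.+ F.- constF (+ 5)
↑E = stretch-eval 5 {ρ = y ∷ z ∷ []} {ρ′ = Y ∷ Z ∷ []} (F.refl {Y} ∷ F.refl {Z} ∷ []) (con (+ 4) :* var zero :+ var (suc zero) :- con (+ 5))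

private
  p m δ : FPS
  p = 1+ K
  m = 1- K
  δ = Δ K

  Z-rel : Z ⊛ p ⊛ m ≈ δ
  Z-rel = F.trans (solve 2 (λ z k → z :* (:1 :+ k) :* (:1 :- k) , z :* (:1 :- k :* k)) refl Z K) Z-relation

-- What `D-transfer` still requires after `x-up` and `z-up`, once the terms with `Y` cancel. `Z` is
-- rational in `K`, so this is a polynomial identity in `a` and `K`.
D-identity : α ^ 4 ⊛ p ^ 2 ⊕ (constF (+ 5) F.+ F.- Z) ⊛ (α ⊛ p ⊛ m ⊛ a ⊛ β) ≈ Z ⊛ β ^ 2 ⊛ m ^ 2
D-identity = unit-cancelˡ (p ⊛ m ^ 3) refl (by
  (F.- (α ⊛ p ⊛ m ⊛ a ⊛ β ⊛ m ^ 2 ⊕ m ^ 4 ⊛ β ^ 2) ∙ Z-rel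
    ⊞ (constF (+ 5) ⊛ p ⊛ m F.+ F.- δ) ⊛ α ⊛ p ⊛ m ⊛ a F.+ F.- (δ ⊛ (β ⊛ m ^ 2 ⊕ β₂)) ∙ β₂-relation
    ⊞ oneF ∙ proveᴷ 2 (αE :^ 4 :* pE :^ 3 :* mE :^ 3 :+ (con (+ 5) :* pE :* mE :- (ΔE vK)) :* αE :* pE :* mE :* va :* βE :- (ΔE vK) :* βE
        :^ 2) refl)
  (solve 8 (λ Z β c α a p m δ →
    p :* m :^ 3 :* (α :^ 4 :* p :^ 2 :+ (con (+ 5) :- Z) :* (α :* p :* m :* a :* β)) :+
        ((:- (α :* p :* m :* a :* β :* m :^ 2 :+ m :^ 4 :* β :^ 2)) :* δ
      :+ ((con (+ 5) :* p :* m :- δ) :* α :* p :* m :* a :- δ :* (β :* m :^ 2 :+ c)) :* c :+ :1 :* :0) ,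
    p :* m :^ 3 :* (Z :* β :^ 2 :* m :^ 2) :+ ((:- (α :* p :* m :* a :* β :* m :^ 2 :+ m :^ 4 :* β :^ 2)) :* (Z :* p :* m)
      :+ ((con (+ 5) :* p :* m :- δ) :* α :* p :* m :* a :- δ :* (β :* m :^ 2 :+ c)) :* (β :* m :^ 2)
      :+ :1 :* (α :^ 4 :* p :^ 3 :* m :^ 3 :+ (con (+ 5) :* p :* m :- δ) :* α :* p :* m :* a :* c :- δ :* c :^ 2))) refl
  Z β β₂ α a p m δ))

D-transfer : (Z ⊛ β ^ 2 ⊛ m ^ 2) ⊛ D ≈ a ⊛ ((α ⊛ p ⊛ m ⊛ β) ⊛ ↑ E′)
D-transfer = F.trans (by ((oneF ⊕ constF (+ 4) ⊛ x) ∙ z-up ⊞ constF (+ 4) ⊛ α ⊛ p ∙ x-up ⊞ oneF ∙ D-identity)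
  (solve 9 (λ z x Y Z β α a p m →
    (Z :* β :^ 2 :* m :^ 2) :* (z :* (:1 :+ con (+ 4) :* x) :- :1) :+ ((:1 :+ con (+ 4) :* x) :* (α :^ 4 :* p :^ 2)
      :+ con (+ 4) :* α :* p :* (Y :* a :* m :* β) :+ :1 :* (Z :* β :^ 2 :* m :^ 2)) ,
    a :* ((α :* p :* m :* β) :* (con (+ 4) :* Y :+ Z :- con (+ 5))) :+ ((:1 :+ con (+ 4) :* x) :* (z :* Z :* β :^ 2 :* m :^ 2)
      :+ con (+ 4) :* α :* p :* (x :* α :^ 3 :* p) :+ :1 :* (α :^ 4 :* p :^ 2 :+ (con (+ 5) :- Z) :* (α :* p :* m :* a :* β)))) refl
    z x Y Z β α a p m))
  (F.*-congˡ {a} (F.*-congˡ {α ⊛ p ⊛ m ⊛ β} (F.sym ↑E)))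

-- The analogous remainder of `E-transfer` after the terms with `X` cancel.
E-identity : (oneF F.+ F.- Z) ⊛ β ^ 5 ⊛ m ^ 3 ⊕ α ^ 5 ⊛ K ⊛ p ^ 3 ≈ constF (+ 5) ⊛ Z ⊛ β ^ 2 ⊛ m ^ 2 ⊛ α ⊛ K ⊛ p
E-identity = unit-cancelˡ (p ⊛ m ^ 8) refl (by
  (F.- (m ^ 10 ⊛ β ^ 5 ⊕ constF (+ 5) ⊛ β ^ 2 ⊛ m ^ 9 ⊛ α ⊛ K ⊛ p) ∙ Z-rel
    ⊞ (p ⊛ m F.+ F.- δ) ⊛ (t ^ 4 ⊕ t ^ 3 ⊛ β₂ ⊕ t ^ 2 ⊛ β₂ ^ 2 ⊕ t ⊛ β₂ ^ 3 ⊕ β₂ ^ 4) F.+ F.-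
        (constF (+ 5) ⊛ δ ⊛ m ^ 5 ⊛ α ⊛ K ⊛ p ⊛ (t ⊕ β₂)) ∙ β₂-relation
    ⊞ oneF ∙ proveᴷ 4 ((pE :* mE :- (ΔE vK)) :* βE :^ 5 :+ αE :^ 5 :* vK :* pE :^ 4 :* mE :^ 8 :- con (+ 5) :* (ΔE vK) :* βE :^ 2 :* mE :^
        5 :* αE :* vK :* pE) refl)
  (solve 8 (λ Z β c α k p m δ → let t = β :* m :^ 2
                                    g = (p :* m :- δ) :* (t :^ 4 :+ t :^ 3 :* c :+ t :^ 2 :* c :^ 2 :+ t :* c :^ 3 :+ c :^ 4) :- con (+ 5)
                                        :* δ :* m :^ 5 :* α :* k :* p :* (t :+ c) in
    p :* m :^ 8 :* ((:1 :- Z) :* β :^ 5 :* m :^ 3 :+ α :^ 5 :* k :* p :^ 3) :+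
        ((:- (m :^ 10 :* β :^ 5 :+ con (+ 5) :* β :^ 2 :* m :^ 9 :* α :* k :* p)) :* δ
      :+ g :* c :+ :1 :* :0) ,
    p :* m :^ 8 :* (con (+ 5) :* Z :* β :^ 2 :* m :^ 2 :* α :* k :* p) :+
        ((:- (m :^ 10 :* β :^ 5 :+ con (+ 5) :* β :^ 2 :* m :^ 9 :* α :* k :* p)) :* (Z :* p :* m)
      :+ g :* t :+ :1 :* ((p :* m :- δ) :* c :^ 5 :+ α :^ 5 :* k :* p :^ 4 :* m :^ 8 :- con (+ 5) :* δ :* c :^ 2 :* m :^ 5 :* α :* k :*
          p))) refl
  Z β β₂ α K p m δ))
  where
  t = β ⊛ m ^ 2

E-transfer : K ⊛ ((Z ⊛ β ^ 2 ⊛ m ^ 2 ⊛ α ⊛ p) ⊛ E′) ≈ (β ^ 5 ⊛ m ^ 3) ⊛ ↑ D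
E-transfer = F.trans (by (constF (+ 4) ⊛ Z ⊛ β ^ 2 ⊛ m ^ 2 ∙ y-up ⊞ α ⊛ K ⊛ p ∙ z-up ⊞ oneF ∙ E-identity)
  (solve 9 (λ z y X Z β α k p m →
    k :* ((Z :* β :^ 2 :* m :^ 2 :* α :* p) :* (con (+ 4) :* y :+ z :- con (+ 5))) :+
        (con (+ 4) :* Z :* β :^ 2 :* m :^ 2 :* (X :* m :* β :^ 3)
      :+ α :* k :* p :* (α :^ 4 :* p :^ 2) :+ :1 :* (con (+ 5) :* Z :* β :^ 2 :* m :^ 2 :* α :* k :* p)) ,
    (β :^ 5 :* m :^ 3) :* (Z :* (:1 :+ con (+ 4) :* X) :- :1) :+ (con (+ 4) :* Z :* β :^ 2 :* m :^ 2 :* (y :* α :* k :* p)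
      :+ α :* k :* p :* (z :* Z :* β :^ 2 :* m :^ 2) :+ :1 :* ((:1 :- Z) :* β :^ 5 :* m :^ 3 :+ α :^ 5 :* k :* p :^ 3))) refl
    z y X Z β α K p m))
  (F.*-congˡ {β ^ 5 ⊛ m ^ 3} (F.sym ↑D))

K≈q⁵ : K ≈ q ^ 5 ⊛ (↑ R ⊛ ↑ S ⊛ ↑ S)
K≈q⁵ = F.trans K≈ab² (solve 3 (λ q r s → q :* r :* (q :^ 2 :* s) :* (q :^ 2 :* s) , q :^ 5 :* (r :* s :* s)) refl q (↑ R) (↑ S))

-- E′ is a multiple of D(q⁵)/q⁵ and D of q E′(q⁵), so the order of vanishing of E′ is at least 25 times itself.
E-improve : ∀ N → Ord N E′ → Ord (25 * N) E′
E-improve N o = Ord-unit U E′ refl (Ord-unit (↑ R ⊛ ↑ S ⊛ ↑ S) (U ⊛ E′) refl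
  (Ord-unshiftQ 5 _ (subst (λ n → Ord n (shiftQ 5 (V ⊛ (U ⊛ E′)))) (five N) (Ord-cong (F.sym (F.trans (shiftQ≈q^ 5 (V ⊛ (U ⊛ E′)))
    (F.trans (F.sym (F.*-assoc (q ^ 5) V (U ⊛ E′))) (F.trans (F.*-congʳ {U ⊛ E′} (F.sym K≈q⁵)) E-transfer))))
    (Ord-⊛ˡ (β ^ 5 ⊛ m ^ 3) (↑ D) (Ord-stretch 4 D D-order))))))
  where
  U V : FPS
  U = Z ⊛ β ^ 2 ⊛ m ^ 2 ⊛ α ⊛ p
  V = ↑ R ⊛ ↑ S ⊛ ↑ S
  five : ∀ N → 5 * suc (5 * N) ≡ 5 + 25 * N
  five N = trans (ℕₚ.*-suc 5 (5 * N)) (cong (5 ℕ.+_) (sym (ℕₚ.*-assoc 5 5 N)))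
  D-order : Ord (suc (5 * N)) D
  D-order = Ord-unit (Z ⊛ β ^ 2 ⊛ m ^ 2) D refl (Ord-cong (F.sym (F.trans D-transfer
      (F.trans (F.*-assoc q (↑ R) _) (F.trans (shiftQ1-⊛ oneF _) (shiftQ-cong 1 (F.*-identityˡ _))))))
    (Ord-shiftQ 1 (Ord-⊛ˡ (↑ R) _ (Ord-⊛ˡ (α ⊛ p ⊛ m ⊛ β) (↑ E′) (Ord-stretch 4 E′ o)))))

-- The descent starts because y and z have constant term 1 and 4 + 1 - 5 = 0; from a positive order
-- the factor 25 improves without end.
E-order : ∀ N → Ord (suc N) E′
E-order zero    zero _ = refl
E-order zero    (suc k) (s≤s ())
E-order (suc N) = Ord-≤ (ℕₚ.≤-trans (bound N) (ℕₚ.*-monoˡ-≤ (suc N) {2} {25} (s≤s (s≤s z≤n)))) (E-improve (suc N) (E-order N))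
  where
  bound : ∀ N → suc (suc N) ≤ 2 * suc N
  bound N = subst (suc (suc N) ≤_) (cong suc (sym (ℕₚ.+-suc N (N + 0)))) (s≤s (s≤s (ℕₚ.m≤m+n N _)))

E≈0 : E′ ≈ zeroF
E≈0 k = trans (E-order k k ℕₚ.≤-refl) (sym (zeroF-at k))

D≈0 : D ≈ zeroF
D≈0 = unit-cancelˡ (Z ⊛ β ^ 2 ⊛ m ^ 2) refl (F.trans D-transfer (F.trans
    (F.*-congˡ {a} (F.*-congˡ {α ⊛ p ⊛ m ⊛ β} (F.trans (stretch-cong 5 E≈0) (stretch-constF 5 (+ 0)))))
  (solve 3 (λ a c d → a :* (c :* :0) , d :* :0) refl a (α ⊛ p ⊛ m ⊛ β) (Z ⊛ β ^ 2 ⊛ m ^ 2))))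

-- Eliminating z from `D≈0` and `z-relation` gives 4 x Δ(κ) = (1 - κ²) - Δ(κ) = 4κ.
x-κ : x ⊛ Δ κ ≈ κ
x-κ = constF-cancelˡ (+ 4) (by ((oneF F.+ F.- (κ ⊛ κ)) ∙ D≈0 ⊞ F.- (oneF ⊕ constF (+ 4) ⊛ x) ∙ z-relation)
  (solve 3 (λ x k z → let d = :1 :- con (+ 4) :* k :- k :* k ; o = :1 :- k :* k in
    con (+ 4) :* (x :* d) :+ (o :* :0 :+ (:- (:1 :+ con (+ 4) :* x)) :* d) ,
    con (+ 4) :* k :+ (o :* (z :* (:1 :+ con (+ 4) :* x) :- :1) :+ (:- (:1 :+ con (+ 4) :* x)) :* (z :* o))) refl x κ z))

y-κ : y ⊛ (oneF F.+ F.- (κ ⊛ κ)) ≈ Γ κ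
y-κ = constF-cancelˡ (+ 4) (by ((oneF F.+ F.- (κ ⊛ κ)) ∙ E≈0 ⊞ F.- oneF ∙ z-relation)
  (solve 3 (λ y k z → let d = :1 :- con (+ 4) :* k :- k :* k ; o = :1 :- k :* k in
    con (+ 4) :* (y :* o) :+ (o :* :0 :+ (:- :1) :* d) ,
    con (+ 4) :* (:1 :+ k :- k :* k) :+ (o :* (con (+ 4) :* y :+ z :- con (+ 5)) :+ (:- :1) :* (z :* o))) refl y κ z))

X-K : X ⊛ Δ K ≈ K
X-K = F.trans (F.sym (stretch-eval 5 {ρ = x ∷ κ ∷ []} {ρ′ = X ∷ K ∷ []} (F.refl {X} ∷ F.refl {K} ∷ [])
    (var zero :* (:1 :- con (+ 4) :* var (suc zero) :- var (suc zero) :* var (suc zero)))))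
  (stretch-cong 5 x-κ)

Y-K : Y ⊛ (oneF F.+ F.- (K ⊛ K)) ≈ Γ K
Y-K = F.trans (F.sym (stretch-eval 5 env (var zero :* (:1 :- var (suc zero) :* var (suc zero))))) (F.trans (stretch-cong 5 y-κ)
  (stretch-eval 5 env (:1 :+ var (suc zero) :- var (suc zero) :* var (suc zero))))
  where
  env : Pointwise (λ g h → stretch 5 g ≈ h) (y ∷ κ ∷ []) (Y ∷ K ∷ [])
  env = F.refl {Y} ∷ F.refl {K} ∷ []

-- `Y-K` removes `Y` from `x-up`; then a (1 - K) β is free of b, since b (1 - K) = a² (1 + K) and a
-- b² = K.
x-aK : x ⊛ (α ^ 3 ⊛ p ^ 2 ⊛ m) ≈ Γ K ⊛ (m ⊛ a F.+ F.- (p ⊛ a ^ 3) F.+ F.- (K ⊛ m))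
x-aK = by (p ⊛ m ∙ x-up ⊞ a ⊛ m ⊛ β ∙ Y-K ⊞ F.- (Γ K ⊛ a) ∙ b-relation ⊞ Γ K ⊛ m ∙ K≈ab²)
  (solve 6 (λ x α a b k Y → let p = :1 :+ k ; m = :1 :- k ; γ = :1 :+ k :- k :* k ; β = :1 :- b :- b :* b in
    x :* (α :^ 3 :* p :^ 2 :* m) :+ (p :* m :* (Y :* a :* m :* β) :+ a :* m :* β :* γ :+ (:- (γ :* a)) :* (a :* a :* p) :+ γ :* m :*
        (a :* b :* b)) ,
    γ :* (m :* a :- p :* a :^ 3 :- k :* m) :+ (p :* m :* (x :* α :^ 3 :* p) :+ a :* m :* β :* (Y :* (:1 :- k :* k)) :+ (:- (γ :* a)) :*
        (b :* m) :+ γ :* m :* k)) refl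
    x α a b K Y)

-- The numerator q⁵ f₂₅ f₅₀² is (ua)(wb)² = u w² K, and u w² cancels against the denominator.
Φ-aK : Φ ⊛ (α ⊛ β ^ 2) ≈ K
Φ-aK = unit-cancelˡ (u ⊛ w ^ 2) refl (by (oneF ∙ Φ-eq ⊞ (q ^ 2 ⊛ f 50) ^ 2 ∙ qf25≈ ⊞ u ⊛ a ⊛ (q ^ 2 ⊛ f 50 ⊕ w ⊛ b) ∙ q²f50≈ ⊞ F.-
    (u ⊛ w ^ 2) ∙ K≈ab²)
  (solve 11 (λ Φ α β k u w a b q v t →
    u :* w :^ 2 :* (Φ :* (α :* β :^ 2)) :+ (:1 :* (q :^ 5 :* (v :* t :^ 2)) :+ (q :^ 2 :* t) :^ 2 :* (u :* a) :+ u :* a :*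
        (q :^ 2 :* t :+ w :* b) :* (w :* b) :+ (:- (u :* w :^ 2)) :* (a :* b :* b)) ,
    u :* w :^ 2 :* k :+ (:1 :* (Φ :* ((u :* α) :* (w :* β) :^ 2)) :+ (q :^ 2 :* t) :^ 2 :* (q :* v) :+ u :* a :* (q :^ 2 :* t :+ w :* b) :*
        (q :^ 2 :* t) :+ (:- (u :* w :^ 2)) :* k)) refl
    Φ α β K u w a b q (f 25) (f 50)))
  where
  Φ-eq : Φ ⊛ ((u ⊛ α) ⊛ (w ⊛ β) ^ 2) ≈ q ^ 5 ⊛ (f 25 ⊛ f 50 ^ 2)
  Φ-eq = F.trans (F.*-congˡ {Φ} (F.*-cong (F.sym f1≈) (^-congˡ 2 (F.sym f2≈)))) (F.trans (F.*-congʳ {f 1 ⊛ f 2 ^ 2} (shiftQ≈q^ 5 _))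
    (F.trans (F.*-assoc (q ^ 5) _ (f 1 ⊛ f 2 ^ 2)) (F.*-congˡ {q ^ 5} (quotient (f 25 ⊛ f 50 ^ 2) (f 1 ⊛ f 2 ^ 2) refl))))

-- The modular equation and the initial values

-- The numerator of Σ c_i (n/d)^i over d ^ length, which is one power of d more than necessary.
homogenize : ∀ {k} → List ℤ → Expr k → Expr k → Expr k
homogenize []       n d = :0
homogenize (c ∷ cs) n d = con c :* d :^ suc (length cs) :+ n :* homogenize cs n d

homogenize-correct : ∀ {k} (ρ : Vec FPS k) g n d → g ⊛ ⟦ d ⟧ ρ ≈ ⟦ n ⟧ ρ → ∀ cs →
  ⟦ d ⟧ ρ ^ length cs ⊛ ⟦_⟧ᴾ {1} cs (g ∷ []) ≈ ⟦ homogenize cs n d ⟧ ρ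
homogenize-correct ρ g n d gd []       = F.*-identityˡ zeroF
homogenize-correct ρ g n d gd (c ∷ cs) = by (⟦ d ⟧ ρ ^ length cs ⊛ ⟦_⟧ᴾ {1} cs (g ∷ []) ∙ gd ⊞ ⟦ n ⟧ ρ ∙ homogenize-correct ρ g n d gd cs)
  (solve 7 (λ d D c g G n H → d :* D :* (c :+ g :* G) :+ (D :* G :* n :+ n :* H) , c :* (d :* D) :+ n :* H :+
      (D :* G :* (g :* d) :+ n :* (D :* G))) refl
    (⟦ d ⟧ ρ) (⟦ d ⟧ ρ ^ length cs) (constF c) g (⟦_⟧ᴾ {1} cs (g ∷ [])) (⟦ n ⟧ ρ) (⟦ homogenize cs n d ⟧ ρ))

homogenize₂ : ∀ {k} → List (List ℤ) → Expr k → Expr k → Expr k → Expr k → Expr k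
homogenize₂ []       n d n′ d′ = :0
homogenize₂ (c ∷ cs) n d n′ d′ = homogenize c n′ d′ :* d :^ suc (length cs) :+ n :* homogenize₂ cs n d n′ d′

-- Inner lists of one common length let a single power of the second denominator clear all rows;
-- this explains the padding zeros in `modular`.
homogenize₂-correct : ∀ {k} (ρ : Vec FPS k) g n d h n′ d′ → g ⊛ ⟦ d ⟧ ρ ≈ ⟦ n ⟧ ρ → h ⊛ ⟦ d′ ⟧ ρ ≈ ⟦ n′ ⟧ ρ → ∀ l cs → All
    (λ c → length c ≡ l) cs →
  ⟦ d′ ⟧ ρ ^ l ⊛ ⟦ d ⟧ ρ ^ length cs ⊛ ⟦_⟧ᴾ {2} cs (g ∷ h ∷ []) ≈ ⟦ homogenize₂ cs n d n′ d′ ⟧ ρ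
homogenize₂-correct ρ g n d h n′ d′ gd hd l []       []         = F.zeroʳ (⟦ d′ ⟧ ρ ^ l ⊛ oneF)
homogenize₂-correct ρ g n d h n′ d′ gd hd l (c ∷ cs) (refl ∷ ls) = by
  (⟦ d′ ⟧ ρ ^ l ⊛ ⟦ d ⟧ ρ ^ length cs ⊛ ⟦_⟧ᴾ {2} cs (g ∷ h ∷ []) ∙ gd ⊞ ⟦ n ⟧ ρ ∙ homogenize₂-correct ρ g n d h n′ d′ gd hd l cs ls
    ⊞ ⟦ d ⟧ ρ ^ suc (length cs) ∙ homogenize-correct ρ h n′ d′ hd c)
  (solve 9 (λ E d D c g G n H C → E :* (d :* D) :* (c :+ g :* G) :+ (E :* D :* G :* n :+ n :* H :+ d :* D :* C) ,
      C :* (d :* D) :+ n :* H :+ (E :* D :* G :* (g :* d) :+ n :* (E :* D :* G) :+ d :* D :* (E :* c))) refl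
    (⟦ d′ ⟧ ρ ^ l) (⟦ d ⟧ ρ) (⟦ d ⟧ ρ ^ length cs) (⟦_⟧ᴾ {1} c (h ∷ [])) g (⟦_⟧ᴾ {2} cs (g ∷ h ∷ [])) (⟦ n ⟧ ρ)
        (⟦ homogenize₂ cs n d n′ d′ ⟧ ρ) (⟦ homogenize c n′ d′ ⟧ ρ))

xNum xDen : Expr 2
xNum = ΓE vK :* (mE :* va :- pE :* va :^ 3 :- vK :* mE)
xDen = αE :^ 3 :* (pE :^ 2) :* mE

minus : ℕ → ℤ
minus n = ℤ.- (+ n)

-- The modular equation between x and X, with coefficients listed by powers of x and then of X.
modular : Poly 2
modular =
    (+ 0 ∷ minus 1 ∷ minus 20 ∷ minus 150 ∷ minus 500 ∷ minus 625 ∷ [])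
  ∷ (+ 0 ∷ minus 15 ∷ minus 305 ∷ minus 2325 ∷ minus 7875 ∷ minus 10000 ∷ [])
  ∷ (+ 0 ∷ minus 85 ∷ minus 1750 ∷ minus 13525 ∷ minus 46500 ∷ minus 60000 ∷ [])
  ∷ (+ 0 ∷ minus 215 ∷ minus 4475 ∷ minus 35000 ∷ minus 122000 ∷ minus 160000 ∷ [])
  ∷ (+ 0 ∷ minus 205 ∷ minus 4300 ∷ minus 34000 ∷ minus 120000 ∷ minus 160000 ∷ [])
  ∷ (+ 1 ∷ + 0 ∷ + 0 ∷ + 0 ∷ + 0 ∷ + 0 ∷ []) ∷ []

xDen-eq : x ⊛ ⟦ xDen ⟧ aK ≈ ⟦ xNum ⟧ aK
xDen-eq = F.trans (F.*-congˡ {x} (solve 3 (λ α p m → α :^ 3 :* p :^ 2 :* m , α :^ 3 :* p :^ 2 :* m) refl α (1+ K) (1- K))) x-aK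

modular-equation : ⟦ modular ⟧ᴾ (x ∷ X ∷ []) ≈ zeroF
modular-equation = unit-cancelˡ (Δ K ^ 6 ⊛ ⟦ xDen ⟧ aK ^ 6) refl (F.trans
  (homogenize₂-correct aK x xNum xDen X vK (ΔE vK) xDen-eq X-K 6 modular (refl ∷ refl ∷ refl ∷ refl ∷ refl ∷ refl ∷ []))
  -- Clearing denominators gives degree 36 in `a`, as `xDen` has degree 6; seven passes bring it
  -- down to 4.
  (F.trans (proveᴷ 7 (homogenize₂ modular xNum xDen vK (ΔE vK)) refl) (F.sym (F.zeroʳ (Δ K ^ 6 ⊛ ⟦ xDen ⟧ aK ^ 6)))))

headᴾ : Poly 2 → Poly 1
headᴾ []      = []
headᴾ (c ∷ _) = c

tailᴾ : Poly 2 → Poly 2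
tailᴾ []      = []
tailᴾ (_ ∷ p) = p

headℤ : Poly 1 → ℤ
headℤ []      = + 0
headℤ (c ∷ _) = c

at : Poly 1 → FPS → FPS
at c g = ⟦ c ⟧ᴾ (g ∷ [])

uncons : ∀ p → ⟦ p ⟧ᴾ aK ≈ at (headᴾ p) K ⊕ a ⊛ ⟦ tailᴾ p ⟧ᴾ aK
uncons []      = solve 1 (λ a → :0 , :0 :+ a :* :0) refl a
uncons (c ∷ p) = F.refl {⟦_⟧ᴾ {2} (c ∷ p) aK}

constant : ∀ p → isZero (tailᴾ p) ≡ true → ⟦ p ⟧ᴾ aK ≈ at (headᴾ p) K
constant p z = F.trans (uncons p) (F.trans (F.+-congˡ {at (headᴾ p) K} (F.*-congˡ {a} (isZero-correct (tailᴾ p) aK z)))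
  (solve 2 (λ c a → c :+ a :* :0 , c) refl (at (headᴾ p) K) a))

at-↑ : ∀ c → at c K ≈ ↑ at c κ
at-↑ []      = F.sym (stretch-constF 5 (+ 0))
at-↑ (c ∷ p) = F.sym (F.trans (stretch-⊕ 5 (constF c) (κ ⊛ at p κ)) (F.+-cong (stretch-constF 5 c)
    (F.trans (stretch-⊛ 5 κ (at p κ)) (F.*-congˡ {K} (F.sym (at-↑ p))))))

-- a^i has exponents ≡ i (mod 5) and K has exponents ≡ 0.
comp₀-reduced : ∀ p → isZero (tailᴾ (tailᴾ (tailᴾ (tailᴾ (tailᴾ p))))) ≡ true → comp 0 (⟦ p ⟧ᴾ aK) ≈ at (headᴾ p) κ
comp₀-reduced p z = F.trans (comp-cong 0 (F.trans (F.trans (uncons p) (+a p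
    (F.trans (uncons p₁) (+a p₁ (F.trans (uncons p₂) (+a p₂ (F.trans (uncons p₃)
    (+a p₃ (constant p₄ z)))))))))
    (F.trans (F.+-cong (at-↑ (headᴾ p)) (F.*-congˡ {a} (F.+-cong (at-↑ (headᴾ p₁)) (F.*-congˡ {a} (F.+-cong (at-↑ (headᴾ p₂)) (F.*-congˡ {a}
      (F.+-cong (at-↑ (headᴾ p₃)) (F.*-congˡ {a} (at-↑ (headᴾ p₄))))))))))
    (F.trans (solve 7 (λ q r c₀ c₁ c₂ c₃ c₄ → let a = q :* r in c₀ :+ a :* (c₁ :+ a :* (c₂ :+ a :* (c₃ :+ a :* c₄))) ,
      c₀ :* q :^ 0 :+ c₁ :* r :* q :^ 1 :+ c₂ :* r :^ 2 :* q :^ 2 :+ c₃ :* r :^ 3 :* q :^ 3 :+ c₄ :* r :^ 4 :* q :^ 4) refl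
      q (↑ R) (↑ at (headᴾ p) κ) (↑ at (headᴾ p₁) κ) (↑ at (headᴾ p₂) κ) (↑ at (headᴾ p₃) κ) (↑ at (headᴾ p₄) κ))
    (F.+-cong (F.+-cong (F.+-cong (F.+-congˡ {↑ at (headᴾ p) κ ⊛ q ^ 0} (F.*-congʳ {q ^ 1} (F.sym (stretch-⊛ 5 (at (headᴾ p₁) κ) R))))
      (F.*-congʳ {q ^ 2} (term 2 p₂))) (F.*-congʳ {q ^ 3} (term 3 p₃))) (F.*-congʳ {q ^ 4} (term 4 p₄)))))))
  (comp₀-dissect (at (headᴾ p) κ) (at (headᴾ p₁) κ ⊛ R) (at (headᴾ p₂) κ ⊛ R ^ 2) (at (headᴾ p₃) κ ⊛ R ^ 3) (at (headᴾ p₄) κ ⊛ R ^ 4))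
  where
  p₁ = tailᴾ p
  p₂ = tailᴾ p₁
  p₃ = tailᴾ p₂
  p₄ = tailᴾ p₃
  +a : ∀ p {g h} → g ≈ h → at (headᴾ p) K ⊕ a ⊛ g ≈ at (headᴾ p) K ⊕ a ⊛ h
  +a p r = F.+-congˡ {at (headᴾ p) K} (F.*-congˡ {a} r)
  term : ∀ i p → ↑ at (headᴾ p) κ ⊛ (↑ R) ^ i ≈ ↑ (at (headᴾ p) κ ⊛ R ^ i)
  term i p = F.sym (F.trans (stretch-⊛ 5 (at (headᴾ p) κ) (R ^ i)) (F.*-congˡ {↑ at (headᴾ p) κ} (stretch-^ 5 R i)))

at-0 : ∀ c g → g 0 ≡ + 0 → at c g 0 ≡ headℤ c
at-0 []      g _  = refl
at-0 (c ∷ p) g g₀ = trans (cong (λ e → c ℤ.+ e ℤ.* at p g 0) g₀) (ℤₚ.+-identityʳ c)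

plus² : Poly 1
plus² = normᴾ {1} ((:1 :+ var zero) :^ 2)

at-plus² : at plus² K ≈ 1+ K ^ 2
at-plus² = norm-correct {1} ((:1 :+ var zero) :^ 2) (K ∷ [])

at-plus²^ : ∀ s → at (plus² ^ᴾ s) K ≈ (1+ K ^ 2) ^ s
at-plus²^ s = F.trans (^ᴾ-correct plus² s (K ∷ [])) (^-congˡ s at-plus²)

-- The denominator involves `K` alone, so it is a series in q⁵ and can be pulled out of `U5`.
record Ratio (g : FPS) : Set where
  constructor ratio
  field
    denom : Poly 1
    numer : Poly 2
    eq    : g ⊛ at denom K ≈ ⟦ numer ⟧ᴾ aK

open Ratio

-- Rationalising the denominator: c supplies the remaining factors of the norm of d under
-- multiplication of `a` by fifth roots of unity.
fromFraction : ∀ s (n d c : Poly 2) g → g ⊛ ⟦ d ⟧ᴾ aK ≈ ⟦ n ⟧ᴾ aK → isZero (tailᴾ (reduces s (d *ᴾ c))) ≡ true → Ratio g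
denom (fromFraction s n d c g gd z) = headᴾ (reduces s (d *ᴾ c))
numer (fromFraction s n d c g gd z) = reduces s (n *ᴾ c)
eq (fromFraction s n d c g gd z) = F.trans (F.*-congˡ {g} (F.trans (F.sym (constant (reduces s (d *ᴾ c)) z))
    (F.trans (F.sym (reduces-correct s (d *ᴾ c))) (F.*-congˡ {U} (*ᴾ-correct d c aK)))))
  (F.trans (by (U ⊛ ⟦ c ⟧ᴾ aK ∙ gd) (solve 5 (λ g u d c n → g :* (u :* (d :* c)) :+ u :* c :* n , u :* (n :* c) :+ u :* c :* (g :* d)) refl
    g U (⟦ d ⟧ᴾ aK) (⟦ c ⟧ᴾ aK) (⟦ n ⟧ᴾ aK)))
  (F.trans (F.*-congˡ {U} (F.sym (*ᴾ-correct n c aK))) (reduces-correct s (n *ᴾ c))))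
  where
  U = (1+ K ^ 2) ^ s

multiply : ∀ s {g h} → Ratio g → Ratio h → Ratio (g ⊛ h)
denom (multiply s r t) = denom r *ᴾ denom t *ᴾ plus² ^ᴾ s
numer (multiply s r t) = reduces s (numer r *ᴾ numer t)
eq (multiply s {g} {h} r t) = F.trans (F.*-congˡ {g ⊛ h} (F.trans (*ᴾ-correct (denom r *ᴾ denom t) (plus² ^ᴾ s) (K ∷ []))
    (F.*-cong (*ᴾ-correct (denom r) (denom t) (K ∷ [])) (at-plus²^ s))))
  (F.trans (solve 5 (λ g h k l u → g :* h :* (k :* l :* u) , u :* ((g :* k) :* (h :* l))) refl g h (at (denom r) K) (at (denom t) K) U)
  (F.trans (F.*-congˡ {U} (F.trans (F.*-cong (eq r) (eq t)) (F.sym (*ᴾ-correct (numer r) (numer t) aK))))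
      (reduces-correct s (numer r *ᴾ numer t))))
  where
  U = (1+ K ^ 2) ^ s

-- A reduced numerator is its own dissection mod 5 by powers of `a`, so `U5` keeps the coefficient
-- of a⁰ and turns `K` into `κ`.
U5-ratio : ∀ {g} (r : Ratio g) → isZero (tailᴾ (tailᴾ (tailᴾ (tailᴾ (tailᴾ (numer r)))))) ≡ true → U5 g ⊛ at (denom r) κ ≈ at
    (headᴾ (numer r)) κ
U5-ratio {g} r z = F.trans (F.trans (F.*-comm (U5 g) (at (denom r) κ)) (F.sym (comp-stretch⊛ 0 (s≤s z≤n) (at (denom r) κ) g)))
  (F.trans (comp-cong 0 (F.trans (F.*-comm (↑ at (denom r) κ) g) (F.trans (F.*-congˡ {g} (F.sym (at-↑ (denom r)))) (eq r))))
      (comp₀-reduced (numer r) z))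

private
  vκ : Expr 1
  vκ = var zero

  polyEq : Poly 1 → Poly 1 → Bool
  polyEq c d = isZero {1} (c +ᴾ conᴾ {1} ℤ.-1ℤ *ᴾ d)

  polyEq-correct : ∀ c d g → polyEq c d ≡ true → at c g ≈ at d g
  polyEq-correct c d g z = difference≈0 (F.trans (F.trans (F.+-congˡ {at c g} (F.sym (neg-correct d (g ∷ []))))
      (F.sym (+ᴾ-correct c _ (g ∷ []))))
    (isZero-correct (c +ᴾ conᴾ {1} ℤ.-1ℤ *ᴾ d) (g ∷ []) z))

  evalN : ∀ e → at (normᴾ {1} e) κ ≈ ⟦ e ⟧ (κ ∷ [])
  evalN e = norm-correct {1} e (κ ∷ [])

-- Checked in κ, using x = κ/Δ(κ) and 1 + 5x = Γ(κ)/Δ(κ).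
U5-value : ∀ {g} (r : Ratio g) j (P : Poly 1) → isZero (tailᴾ (tailᴾ (tailᴾ (tailᴾ (tailᴾ (numer r)))))) ≡ true → headℤ (denom r) ≡ + 1 →
  polyEq (headᴾ (numer r) *ᴾ normᴾ {1} (ΓE vκ :^ j :* ΔE vκ :^ length P)) (denom r *ᴾ normᴾ {1} (homogenize P vκ (ΔE vκ) :* ΔE vκ :^ j)) ≡
      true →
  onePlus5x ^ j ⊛ U5 g ≈ at P x
U5-value {g} r j P z k₀ e = unit-cancelˡ (at (denom r) κ ⊛ (Δ κ ^ j ⊛ Δ κ ^ length P)) unit (F.trans
  (by (onePlus5x ^ j ⊛ (Δ κ ^ j ⊛ Δ κ ^ length P) ∙ U5-ratio r z ⊞ at (headᴾ (numer r)) κ ⊛ Δ κ ^ length P ∙ y^j)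
    (solve 7 (λ k d D y u h γ → k :* (d :* D) :* (y :* u) :+ (y :* (d :* D) :* h :+ h :* D :* γ) , h :* (γ :* D) :+
        (y :* (d :* D) :* (u :* k) :+ h :* D :* (d :* y))) refl
      (at (denom r) κ) (Δ κ ^ j) (Δ κ ^ length P) (onePlus5x ^ j) (U5 g) (at (headᴾ (numer r)) κ) (Γ κ ^ j)))
  (F.trans (F.trans (F.*-congˡ {at (headᴾ (numer r)) κ} (F.sym (evalN (ΓE vκ :^ j :* ΔE vκ :^ length P))))
      (F.trans (F.sym (*ᴾ-correct (headᴾ (numer r)) l (κ ∷ [])))
    (F.trans (polyEq-correct (headᴾ (numer r) *ᴾ l) (denom r *ᴾ l′) κ e)
        (F.trans (*ᴾ-correct (denom r) l′ (κ ∷ [])) (F.*-congˡ {at (denom r) κ} (evalN (homogenize P vκ (ΔE vκ) :* ΔE vκ :^ j)))))))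
  (F.trans (F.*-congˡ {at (denom r) κ} (F.*-congʳ {Δ κ ^ j} (F.sym (homogenize-correct (κ ∷ []) x vκ (ΔE vκ) x-κ P))))
    (solve 4 (λ k d D v → k :* (D :* v :* d) , k :* (d :* D) :* v) refl (at (denom r) κ) (Δ κ ^ j) (Δ κ ^ length P) (at P x)))))
  where
  l l′ : Poly 1
  l  = normᴾ {1} (ΓE vκ :^ j :* ΔE vκ :^ length P)
  l′ = normᴾ {1} (homogenize P vκ (ΔE vκ) :* ΔE vκ :^ j)
  y^j : Δ κ ^ j ⊛ onePlus5x ^ j ≈ Γ κ ^ j
  y^j = F.trans (F.sym (^-distrib-* (Δ κ) onePlus5x j)) (^-congˡ j (F.trans (F.*-congˡ {Δ κ} (F.+-congˡ {oneF} (F.sym (constF-⊛ (+ 5) x))))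
    (by (constF (+ 5) ∙ x-κ) (solve 2 (λ x k → let d = :1 :- con (+ 4) :* k :- k :* k in
      d :* (:1 :+ con (+ 5) :* x) :+ con (+ 5) :* k , :1 :+ k :- k :* k :+ con (+ 5) :* (x :* d)) refl x κ))))
  unit : (at (denom r) κ ⊛ (Δ κ ^ j ⊛ Δ κ ^ length P)) 0 ≡ + 1
  unit = cong₂ ℤ._*_ (trans (at-0 (denom r) κ refl) k₀) (cong₂ ℤ._*_ (^-0 (Δ κ) j refl) (^-0 (Δ κ) (length P) refl))

private
  -- (1 - t - t²)(1 + t + 2t² + 3t³ + 5t⁴ - 3t⁵ + 2t⁶ - t⁷ + t⁸) = 1 - 11t⁵ - t¹⁰, at t = a and (cleared of denominators) t = b.
  fibonacci : Expr 2 → Expr 2 → Expr 2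
  fibonacci s t = s :^ 8 :+ s :^ 7 :* t :+ con (+ 2) :* s :^ 6 :* t :^ 2 :+ con (+ 3) :* s :^ 5 :* t :^ 3 :+ con (+ 5) :* s :^ 4 :* t :^ 4
    :- con (+ 3) :* s :^ 3 :* t :^ 5 :+ con (+ 2) :* s :^ 2 :* t :^ 6 :- s :* t :^ 7 :+ t :^ 8

  C₁ C₂ : Expr 2
  C₁ = fibonacci (:1) va
  C₂ = fibonacci mE (va :^ 2 :* pE)

-- α³ times its cofactor is (1 - 11a⁵ - a¹⁰)³, of degree 30 in `a`, hence six passes. In `Φ-ratio`
-- the norms of α and of the square of `βE` have total degree 10 + 40, hence ten.
x-ratio : Ratio x
x-ratio = fromFraction 6 (normᴾ xNum) (normᴾ xDen) (normᴾ (C₁ :^ 3)) x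
  (F.trans (F.*-congˡ {x} (norm-correct xDen aK)) (F.trans xDen-eq (F.sym (norm-correct xNum aK)))) refl

Φ-ratio : Ratio Φ
Φ-ratio = fromFraction 10 (normᴾ (vK :* mE :^ 4)) (normᴾ (αE :* βE :^ 2)) (normᴾ (C₁ :* C₂ :^ 2)) Φ
  (F.trans (F.*-congˡ {Φ} (F.trans (norm-correct (αE :* βE :^ 2) aK) (F.*-congˡ {α} (^-congˡ 2 (F.sym β₂-relation)))))
    (F.trans (by (1- K ^ 4 ∙ Φ-aK) (solve 5 (λ Φ α β m k → Φ :* (α :* (β :* m :^ 2) :^ 2) :+ m :^ 4 :* k , k :* m :^ 4 :+ m :^ 4 :*
        (Φ :* (α :* β :^ 2))) refl Φ α β (1- K) K))
    (F.sym (norm-correct (vK :* mE :^ 4) aK)))) refl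

one-ratio : Ratio oneF
one-ratio = ratio (+ 1 ∷ []) ((+ 1 ∷ []) ∷ []) (solve 2 (λ k a → :1 :* (:1 :+ k :* :0) , (:1 :+ k :* :0) :+ a :* :0) refl K a)

-- Reduced numerators have degree at most 4 in `a`, their products at most 8, so one pass per
-- multiplication suffices.
x^-ratio : ∀ j → Ratio (x ^ j)
x^-ratio zero    = one-ratio
x^-ratio (suc j) = multiply 1 x-ratio (x^-ratio j)

Φx^-ratio : ∀ j → Ratio (Φ ⊛ x ^ j)
Φx^-ratio j = multiply 1 Φ-ratio (x^-ratio j)

-- The initial values U⁽¹⁾(x^j) and (1+5x)⁵ U⁽⁰⁾(x^j) for j < 5, as polynomials in x.
P₁ P₀ : ℕ → Poly 1
P₁ 0 = + 1 ∷ []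
P₁ 1 = + 0 ∷ + 41 ∷ + 860 ∷ + 6800 ∷ + 24000 ∷ + 32000 ∷ []
P₁ 2 = + 0 ∷ + 86 ∷ + 10195 ∷ + 366600 ∷ + 6534800 ∷ + 68384000 ∷ + 450720000 ∷ + 1907200000 ∷ + 5056000000 ∷ + 7680000000 ∷ + 5120000000 ∷
    []
P₁ 3 = + 0 ∷ + 51 ∷ + 27495 ∷ + 2836265 ∷ + 128688900 ∷ + 3343692000 ∷ + 56283680000 ∷ + 656205600000 ∷ + 5502096000000 ∷ + 33821312000000
    ∷ +
  153192960000000 ∷ + 506956800000000 ∷ + 1195008000000000 ∷ + 1904640000000000 ∷ + 1843200000000000 ∷ + 819200000000000 ∷ []
P₁ 4 = + 0 ∷ + 12 ∷ + 32674 ∷ + 8579260 ∷ + 831492275 ∷ + 42958434000 ∷ + 1396773180000 ∷ + 31314949600000 ∷ + 511802288800000 ∷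
    + 6319880448000000 ∷
  + 60349364480000000 ∷ + 452174745600000000 ∷ + 2679038592000000000 ∷ + 12574269440000000000 ∷ + 46561935360000000000 ∷
      + 134544588800000000000 ∷ +
  297365504000000000000 ∷ + 485949440000000000000 ∷ + 553779200000000000000 ∷ + 393216000000000000000 ∷ + 131072000000000000000 ∷ []
P₁ _ = []

P₀ 0 = + 0 ∷ + 1 ∷ + 40 ∷ + 794 ∷ + 9125 ∷ + 64475 ∷ + 286000 ∷ + 780000 ∷ + 1200000 ∷ + 800000 ∷ []
P₀ 1 = + 0 ∷ + 0 ∷ + 121 ∷ + 9484 ∷ + 321025 ∷ + 6327850 ∷ + 81874125 ∷ + 738217500 ∷ + 4780850000 ∷ + 22488800000 ∷ + 76460000000 ∷
    + 183600000000 ∷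
  + 296000000000 ∷ + 288000000000 ∷ + 128000000000 ∷ []
P₀ 2 = + 0 ∷ + 0 ∷ + 140 ∷ + 35245 ∷ + 2808365 ∷ + 117376000 ∷ + 3100037500 ∷ + 56831205625 ∷ + 763507050000 ∷ + 7771895500000 ∷
    + 61182640000000 ∷ +
  376797500000000 ∷ + 1823151200000000 ∷ + 6913681600000000 ∷ + 20347776000000000 ∷ + 45594240000000000 ∷ + 75238400000000000 ∷
      + 86272000000000000 ∷
  + 61440000000000000 ∷ + 20480000000000000 ∷ []
P₀ 3 = + 0 ∷ + 0 ∷ + 64 ∷ + 59136 ∷ + 10547620 ∷ + 850378650 ∷ + 40530512250 ∷ + 1298590915000 ∷ + 30103152240625 ∷ + 528858099450000 ∷ +
  7262462532500000 ∷ + 79624221710000000 ∷ + 707157357820000000 ∷ + 5136043622800000000 ∷ + 30674128864000000000 ∷ + 150938497280000000000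
      ∷ +
  611049315200000000000 ∷ + 2024736448000000000000 ∷ + 5439398912000000000000 ∷ + 11668643840000000000000 ∷ + 19525324800000000000000 ∷ +
  24567808000000000000000 ∷ + 21872640000000000000000 ∷ + 12288000000000000000000 ∷ + 3276800000000000000000 ∷ []
P₀ 4 = + 0 ∷ + 0 ∷ + 13 ∷ + 54342 ∷ + 21645560 ∷ + 3231134475 ∷ + 261994052875 ∷ + 13648364390000 ∷ + 501535624578125 ∷ + 13781722427603125
    ∷ +
  294509461032250000 ∷ + 5030953041631500000 ∷ + 70082663702580000000 ∷ + 807847198383100000000 ∷ + 7788550590672000000000 ∷
      + 63288334721120000000000
  ∷ + 435690966505600000000000 ∷ + 2548759030153600000000000 ∷ + 12682694057728000000000000 ∷ + 53629451281920000000000000 ∷ +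
  192118376960000000000000000 ∷ + 579878492672000000000000000 ∷ + 1462436904960000000000000000 ∷ + 3044539924480000000000000000 ∷ +
  5141902131200000000000000000 ∷ + 6869368832000000000000000000 ∷ + 6987448320000000000000000000 ∷ + 5085593600000000000000000000 ∷ +
  2359296000000000000000000000 ∷ + 524288000000000000000000000 ∷ []
P₀ _ = []

U1-initial : ∀ j → j < 5 → onePlus5x ^ 0 ⊛ U5 (x ^ j) ≈ at (P₁ j) x
U1-initial 0 _ = U5-value (x^-ratio 0) 0 (P₁ 0) refl refl refl
U1-initial 1 _ = U5-value (x^-ratio 1) 0 (P₁ 1) refl refl refl
U1-initial 2 _ = U5-value (x^-ratio 2) 0 (P₁ 2) refl refl refl
U1-initial 3 _ = U5-value (x^-ratio 3) 0 (P₁ 3) refl refl refl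
U1-initial 4 _ = U5-value (x^-ratio 4) 0 (P₁ 4) refl refl refl
U1-initial (suc (suc (suc (suc (suc _))))) (s≤s (s≤s (s≤s (s≤s (s≤s ())))))

U0-initial : ∀ j → j < 5 → onePlus5x ^ 5 ⊛ U5 (Φ ⊛ x ^ j) ≈ at (P₀ j) x
U0-initial 0 _ = U5-value (Φx^-ratio 0) 5 (P₀ 0) refl refl refl
U0-initial 1 _ = U5-value (Φx^-ratio 1) 5 (P₀ 1) refl refl refl
U0-initial 2 _ = U5-value (Φx^-ratio 2) 5 (P₀ 2) refl refl refl
U0-initial 3 _ = U5-value (Φx^-ratio 3) 5 (P₀ 3) refl refl refl
U0-initial 4 _ = U5-value (Φx^-ratio 4) 5 (P₀ 4) refl refl refl
U0-initial (suc (suc (suc (suc (suc _))))) (s≤s (s≤s (s≤s (s≤s (s≤s ())))))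

-- 5-adic valuations

infix 8 5^_
5^_ : ℕ → ℤ
5^ v = (+ 5) ℤ.^ v

-- The condition on a coefficient s of x^i X^l under which s X^l turns the bounds for U(x^{n+i}) into those for U(x^{n+d});
-- the exponent of 5 is ⌈(5l + i - d)/7⌉.
Weight : ℕ → ℕ → ℕ → ℤ → Set
Weight d i l s = s ≡ + 0 ⊎ (d ≤ i + 5 * l × 5^ (((5 * l + i ∸ d) + 6) / 7) ℤ∣.∣ s)

Weights : ℕ → ℕ → ℕ → List ℤ → Set
Weights d i l []       = ⊤
Weights d i l (s ∷ ss) = Weight d i l s × Weights d i (suc l) ss

Weights₂ : ℕ → ℕ → List (List ℤ) → Set
Weights₂ d i []       = ⊤
Weights₂ d i (p ∷ ps) = Weights d i 0 p × Weights₂ d (suc i) ps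

weights? : ∀ d i l ss → Dec (Weights d i l ss)
weights? d i l []       = yes tt
weights? d i l (s ∷ ss) = (s ℤ.≟ + 0 ⊎-dec ((d ℕ.≤? i + 5 * l) ×-dec (_ ℤ∣.∣? s))) ×-dec weights? d i (suc l) ss

weights₂? : ∀ d i ps → Dec (Weights₂ d i ps)
weights₂? d i []       = yes tt
weights₂? d i (p ∷ ps) = weights? d i 0 p ×-dec weights₂? d (suc i) ps

ceil-7 : ∀ n → n ≤ 7 * ((n + 6) / 7)
ceil-7 n = ℕₚ.+-cancelʳ-≤ 6 n _ (subst (λ a → n + 6 ≤ a + 6) (ℕₚ.*-comm ((n + 6) / 7) 7) (begin
  n + 6                                      ≡⟨ m≡m%n+[m/n]*n (n + 6) 7 ⟩
  (n + 6) % 7 + ((n + 6) / 7) * 7      ≤⟨ ℕₚ.+-monoˡ-≤ _ (ℕₚ.≤-pred (m%n<n (n + 6) 7)) ⟩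
  6 + ((n + 6) / 7) * 7                  ≡⟨ ℕₚ.+-comm 6 _ ⟩
  ((n + 6) / 7) * 7 + 6                  ∎))
  where
  open ℕₚ.≤-Reasoning

/7-shift : ∀ {A B} v → A ≤ 7 * v + B → A / 7 ≤ v + B / 7
/7-shift {A} {B} v A≤ = ℕₚ.≤-trans (/-mono-≤ {o = 7} {7} A≤ ℕₚ.≤-refl) (ℕₚ.≤-reflexive (trans (cong (_/ 7) (ℕₚ.+-comm (7 * v) B))
  (trans (cong (λ n → (B + n) / 7) (ℕₚ.*-comm 7 v)) (trans (+-distrib-/-∣ʳ B (n∣m*n v))
      (trans (cong (B / 7 ℕ.+_) (m*n/n≡m v 7)) (ℕₚ.+-comm (B / 7) v))))))

-- The property of π behind both recursions: a factor x^l with coefficient divisible by 5^v carries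
-- the bound for m′ to the bound for m whenever the gain of 5l + m′ - m in 5r - m is covered by 7v.
π-Shift : (ℕ → ℕ → ℕ) → Set
π-Shift π = ∀ m m′ l v r → 5 * l + m′ ≤ 7 * v + m → π m (r + l) ≤ v + π m′ r

-- c = 0 serves `π₁` and c = 2 serves `π₀`.
shift-∸ : ∀ c m m′ l v r → 5 * l + m′ ≤ 7 * v + m → 5 * (r + l) + c ∸ m ≤ 7 * v + (5 * r + c ∸ m′)
shift-∸ c m m′ l v r le = ℕₚ.m≤n+o⇒m∸n≤o (5 * (r + l) + c) m (begin
  5 * (r + l) + c                                 ≡⟨ expand r l c ⟩
  5 * l + (5 * r + c)                           ≤⟨ ℕₚ.+-monoʳ-≤ (5 * l) (ℕₚ.m≤n+m∸n (5 * r + c) m′) ⟩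
  5 * l + (m′ + (5 * r + c ∸ m′))             ≡⟨ ℕₚ.+-assoc (5 * l) m′ _ ⟨
  5 * l + m′ + (5 * r + c ∸ m′)               ≤⟨ ℕₚ.+-monoˡ-≤ _ le ⟩
  7 * v + m + (5 * r + c ∸ m′)                ≡⟨ regroup (7 * v) m (5 * r + c ∸ m′) ⟩
  m + (7 * v + (5 * r + c ∸ m′))              ∎)
  where
  open ℕₚ.≤-Reasoning
  expand : ∀ r l c → 5 * (r + l) + c ≡ 5 * l + (5 * r + c)
  expand = solveℕ-∀
  regroup : ∀ a b c → a + b + c ≡ b + (a + c)
  regroup = solveℕ-∀

π₁-shift : π-Shift π₁
π₁-shift m m′ l v r le = /7-shift v (subst (λ a → 5 * (r + l) ∸ m ≤ 7 * v + (a ∸ m′)) (ℕₚ.+-identityʳ (5 * r))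
  (subst (λ a → a ∸ m ≤ 7 * v + (5 * r + 0 ∸ m′)) (ℕₚ.+-identityʳ (5 * (r + l))) (shift-∸ 0 m m′ l v r le)))

π₀-shift : π-Shift π₀
π₀-shift m m′ l v r le = ℕₚ.m≤n+o⇒m∸n≤o _ 5 (ℕₚ.≤-trans (/7-shift v (shift-∸ 2 m m′ l v r le))
  (ℕₚ.≤-trans (ℕₚ.+-monoʳ-≤ v (ℕₚ.m≤n+m∸n ((5 * r + 2 ∸ m′) / 7) 5)) (ℕₚ.≤-reflexive (regroup v 5 (π₀ m′ r)))))
  where
  regroup : ∀ a b c → a + (b + c) ≡ b + (a + c)
  regroup = solveℕ-∀

5^-+ : ∀ m n → 5^ (m + n) ≡ 5^ m ℤ.* 5^ n
5^-+ m n = ℤₚ.^-distribˡ-+-* (+ 5) m n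

5^-∣ : ∀ {m n} → m ≤ n → 5^ m ℤ∣.∣ 5^ n
5^-∣ {m} {n} m≤n = ℤ∣.divides (5^ (n ∸ m)) (trans (cong 5^_ (sym (ℕₚ.m∸n+n≡m m≤n))) (5^-+ (n ∸ m) m))

∣-* : ∀ {a b c d} → a ℤ∣.∣ b → c ℤ∣.∣ d → a ℤ.* c ℤ∣.∣ b ℤ.* d
∣-* {a} {b} {c} {d} (ℤ∣.divides e refl) (ℤ∣.divides g refl) = ℤ∣.divides (e ℤ.* g) (regroup e a g c)
  where
  regroup : ∀ e a g c → e ℤ.* a ℤ.* (g ℤ.* c) ≡ e ℤ.* g ℤ.* (a ℤ.* c)
  regroup = solve-∀

-- The modular equation reads x⁵ = recursion(x,X), and Q (1+5x) = (1+5X)⁵ is its consequence.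
recursion Q : Poly 2
recursion =
    (+ 0 ∷ + 1 ∷ + 20 ∷ + 150 ∷ + 500 ∷ + 625 ∷ [])
  ∷ (+ 0 ∷ + 15 ∷ + 305 ∷ + 2325 ∷ + 7875 ∷ + 10000 ∷ [])
  ∷ (+ 0 ∷ + 85 ∷ + 1750 ∷ + 13525 ∷ + 46500 ∷ + 60000 ∷ [])
  ∷ (+ 0 ∷ + 215 ∷ + 4475 ∷ + 35000 ∷ + 122000 ∷ + 160000 ∷ [])
  ∷ (+ 0 ∷ + 205 ∷ + 4300 ∷ + 34000 ∷ + 120000 ∷ + 160000 ∷ []) ∷ []
Q =
    (+ 1 ∷ minus 3100 ∷ minus 62250 ∷ minus 467500 ∷ minus 1559375 ∷ minus 1950000 ∷ [])
  ∷ (minus 5 ∷ minus 31375 ∷ minus 641875 ∷ minus 4928125 ∷ minus 16812500 ∷ minus 21500000 ∷ [])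
  ∷ (+ 25 ∷ minus 108750 ∷ minus 2259375 ∷ minus 17625000 ∷ minus 61250000 ∷ minus 80000000 ∷ [])
  ∷ (minus 125 ∷ minus 128125 ∷ minus 2687500 ∷ minus 21250000 ∷ minus 75000000 ∷ minus 100000000 ∷ [])
  ∷ (+ 625 ∷ []) ∷ []

xX : Vec FPS 2
xX = x ∷ X ∷ []

modulo : ∀ (P P′ C : Poly 2) → isZero {2} (P +ᴾ conᴾ {2} ℤ.-1ℤ *ᴾ (P′ +ᴾ C *ᴾ modular)) ≡ true → ⟦ P ⟧ᴾ xX ≈ ⟦ P′ ⟧ᴾ xX
modulo P P′ C z = F.trans (difference≈0 {⟦ P ⟧ᴾ xX} {⟦ P′ +ᴾ C *ᴾ modular ⟧ᴾ xX}
    (F.trans (F.+-congˡ {⟦ P ⟧ᴾ xX} (F.sym (neg-correct (P′ +ᴾ C *ᴾ modular) xX)))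
    (F.trans (F.sym (+ᴾ-correct P (conᴾ {2} ℤ.-1ℤ *ᴾ (P′ +ᴾ C *ᴾ modular)) xX))
        (isZero-correct {2} (P +ᴾ conᴾ {2} ℤ.-1ℤ *ᴾ (P′ +ᴾ C *ᴾ modular)) xX z))))
  (F.trans (+ᴾ-correct P′ (C *ᴾ modular) xX) (F.trans (F.+-congˡ {⟦ P′ ⟧ᴾ xX}
      (F.trans (*ᴾ-correct C modular xX) (F.trans (F.*-congˡ {⟦ C ⟧ᴾ xX} modular-equation) (F.zeroʳ (⟦ C ⟧ᴾ xX)))))
    (F.+-identityʳ (⟦ P′ ⟧ᴾ xX))))

x⁵≈ : x ^ 5 ≈ ⟦ recursion ⟧ᴾ xX
x⁵≈ = F.trans (F.sym (norm-correct {2} (var zero :^ 5) xX)) (modulo (normᴾ {2} (var zero :^ 5)) recursion (conᴾ {2} (+ 1)) refl)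

Q⊛1+5x : ⟦ Q ⟧ᴾ xX ⊛ (oneF ⊕ constF (+ 5) ⊛ x) ≈ (oneF ⊕ constF (+ 5) ⊛ X) ^ 5
Q⊛1+5x = F.trans (F.*-congˡ {⟦ Q ⟧ᴾ xX} (F.sym (norm-correct {2} (:1 :+ con (+ 5) :* var zero) xX)))
    (F.trans (F.sym (*ᴾ-correct Q (normᴾ {2} (:1 :+ con (+ 5) :* var zero)) xX))
  -- At x = -1/5 the modular polynomial equals -(1 + 5X)⁵/5⁵. So (1 + 5X)⁵ plus 3125 times it is
  -- divisible by 1 + 5x, and `Q` is the quotient.
  (F.trans (modulo (Q *ᴾ normᴾ {2} (:1 :+ con (+ 5) :* var zero)) (normᴾ {2} ((:1 :+ con (+ 5) :* var (suc zero)) :^ 5))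
      (conᴾ {2} (+ 3125)) refl)
  (norm-correct {2} ((:1 :+ con (+ 5) :* var (suc zero)) :^ 5) xX)))

recursion-weights : Weights₂ 5 0 recursion
recursion-weights = from-yes (weights₂? 5 0 recursion)

Q-weights : Weights₂ 0 0 Q
Q-weights = from-yes (weights₂? 0 0 Q)

-- π is a lower bound for 5-adic valuations and 5r ≥ m + o is the range of summation.
module Admissible (π : ℕ → ℕ → ℕ) (π-shift : π-Shift π) (o : ℕ) where

  Coeff : ℕ → ℕ → ℤ → Set
  Coeff m r c = c ≡ + 0 ⊎ (m + o ≤ 5 * r × 5^ π m r ℤ∣.∣ c)

  Coeffs : ℕ → ℕ → List ℤ → Set
  Coeffs m r []       = ⊤
  Coeffs m r (c ∷ cs) = Coeff m r c × Coeffs m (suc r) cs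

  coeffs? : ∀ m r cs → Dec (Coeffs m r cs)
  coeffs? m r []       = yes tt
  coeffs? m r (c ∷ cs) = (c ℤ.≟ + 0 ⊎-dec ((m + o ℕ.≤? 5 * r) ×-dec (_ ℤ∣.∣? c))) ×-dec coeffs? m (suc r) cs

  coeff-+ : ∀ {m r c d} → Coeff m r c → Coeff m r d → Coeff m r (c ℤ.+ d)
  coeff-+ {d = d} (inj₁ refl) v          = subst (Coeff _ _) (sym (ℤₚ.+-identityˡ d)) v
  coeff-+ {c = c} u           (inj₁ refl) = subst (Coeff _ _) (sym (ℤₚ.+-identityʳ c)) u
  coeff-+ (inj₂ (lo , ∣c))    (inj₂ (_ , ∣d)) = inj₂ (lo , ℤ∣.∣m∣n⇒∣m+n ∣c ∣d)

  coeffs-+ : ∀ {m} r cs ds → Coeffs m r cs → Coeffs m r ds → Coeffs m r (_+ᴾ_ {1} cs ds)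
  coeffs-+ r []       ds       _        v        = v
  coeffs-+ r (c ∷ cs) []       u        _        = u
  coeffs-+ r (c ∷ cs) (d ∷ ds) (u , us) (v , vs) = coeff-+ u v , coeffs-+ (suc r) cs ds us vs

  -- The ceiling in `Weight` gives 7v ≥ 5l + i - d, which is the hypothesis of `π-shift` for passing
  -- from n + i to n + d; the range of summation survives because d ≤ i + 5l.
  coeff-* : ∀ n d i l s r c → Weight d i l s → Coeff (n + i) r c → Coeff (n + d) (r + l) (s ℤ.* c)
  coeff-* n d i l s r c (inj₁ refl)         _                 = inj₁ (ℤₚ.*-zeroˡ c)
  coeff-* n d i l s r c (inj₂ _)            (inj₁ refl)       = inj₁ (ℤₚ.*-zeroʳ s)
  coeff-* n d i l s r c (inj₂ (d≤ , 5^v∣s)) (inj₂ (lo , 5^∣c)) = inj₂ (low , ℤ∣.∣-trans (5^-∣ (π-shift (n + d) (n + i) l v r heavy))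
      (subst (ℤ∣._∣ s ℤ.* c) (sym (5^-+ v (π (n + i) r))) (∣-* 5^v∣s 5^∣c)))
    where
    open ℕₚ.≤-Reasoning
    v = ((5 * l + i ∸ d) + 6) / 7
    low : n + d + o ≤ 5 * (r + l)
    low = begin
      n + d + o                      ≤⟨ ℕₚ.+-monoˡ-≤ o (ℕₚ.+-monoʳ-≤ n d≤) ⟩
      n + (i + 5 * l) + o        ≡⟨ low≡ n i l o ⟩
      n + i + o + 5 * l          ≤⟨ ℕₚ.+-monoˡ-≤ (5 * l) lo ⟩
      5 * r + 5 * l                ≡⟨ ℕₚ.*-distribˡ-+ 5 r l ⟨
      5 * (r + l)                    ∎
      where
      low≡ : ∀ n i l o → n + (i + 5 * l) + o ≡ n + i + o + 5 * l
      low≡ = solveℕ-∀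
    heavy : 5 * l + (n + i) ≤ 7 * v + (n + d)
    heavy = begin
      5 * l + (n + i)                        ≡⟨ heavy≡ l n i ⟩
      5 * l + i + n                          ≤⟨ ℕₚ.+-monoˡ-≤ n (ℕₚ.m≤n+m∸n (5 * l + i) d) ⟩
      d + (5 * l + i ∸ d) + n              ≤⟨ ℕₚ.+-monoˡ-≤ n (ℕₚ.+-monoʳ-≤ d (ceil-7 (5 * l + i ∸ d))) ⟩
      d + 7 * v + n                          ≡⟨ heavy≡′ d (7 * v) n ⟩
      7 * v + (n + d)                        ∎
      where
      heavy≡ : ∀ l n i → 5 * l + (n + i) ≡ 5 * l + i + n
      heavy≡ = solveℕ-∀
      heavy≡′ : ∀ d w n → d + w + n ≡ w + (n + d)
      heavy≡′ = solveℕ-∀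

  coeffs-* : ∀ n d i l s r cs → Weight d i l s → Coeffs (n + i) r cs → Coeffs (n + d) (r + l) (_·ᴾ_ {0} s cs)
  coeffs-* n d i l s r []       _ _        = tt
  coeffs-* n d i l s r (c ∷ cs) w (u , us) = coeff-* n d i l s r c w u , coeffs-* n d i l s (suc r) cs w us

  zeros : ℕ → List ℤ → List ℤ
  zeros zero    cs = cs
  zeros (suc l) cs = zeros l (+ 0 ∷ cs)

  coeffs-zeros : ∀ {m} l cs → Coeffs m l cs → Coeffs m 0 (zeros l cs)
  coeffs-zeros zero    cs u = u
  coeffs-zeros (suc l) cs u = coeffs-zeros l (+ 0 ∷ cs) (inj₁ refl , u)

  at-zeros : ∀ l cs → at (zeros l cs) x ≈ x ^ l ⊛ at cs x
  at-zeros zero    cs = F.sym (F.*-identityˡ (at cs x))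
  at-zeros (suc l) cs = F.trans (at-zeros l (+ 0 ∷ cs)) (solve 3 (λ x L c → L :* (:0 :+ x :* c) , x :* L :* c) refl x (x ^ l) (at cs x))

  -- The list of coefficients is finite, and this becomes the finite support of h.
  Good : ℕ → FPS → Set
  Good m g = ∃[ cs ] (g ≈ at cs x × Coeffs m 0 cs)

  good-cong : ∀ {m g h} → g ≈ h → Good m h → Good m g
  good-cong p (cs , eq , u) = cs , F.trans p eq , u

  good-⊕ : ∀ {m g h} → Good m g → Good m h → Good m (g ⊕ h)
  good-⊕ (cs , p , u) (ds , r , v) = _+ᴾ_ {1} cs ds , F.trans (F.+-cong p r) (F.sym (+ᴾ-correct {1} cs ds (x ∷ []))) , coeffs-+ 0 cs ds u v

  good-monomial : ∀ n d i l s {g} → Weight d i l s → Good (n + i) g → Good (n + d) (x ^ l ⊛ (constF s ⊛ g))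
  good-monomial n d i l s {g} w (cs , p , u) = zeros l (_·ᴾ_ {0} s cs)
    , F.trans (F.*-congˡ {x ^ l} (F.trans (F.*-congˡ {constF s} p) (F.sym (·ᴾ-correct {0} s cs x [])))) (F.sym (at-zeros l (_·ᴾ_ {0} s cs)))
    , coeffs-zeros l (_·ᴾ_ {0} s cs) (coeffs-* n d i l s 0 cs w u)

  good-row : ∀ n d i l ss {g} → Weights d i l ss → Good (n + i) g → Good (n + d) (x ^ l ⊛ (at ss x ⊛ g))
  good-row n d i l []       {g} _        _ = [] , solve 2 (λ L g → L :* (:0 :* g) , :0) refl (x ^ l) g , tt
  good-row n d i l (s ∷ ss) {g} (w , ws) G = good-cong
    (solve 5 (λ L s x t g → L :* ((s :+ x :* t) :* g) , L :* (s :* g) :+ x :* L :* (t :* g)) refl (x ^ l) (constF s) x (at ss x) g)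
    (good-⊕ (good-monomial n d i l s w G) (good-row n d i (suc l) ss ws G))

  -- V stands for U⁽¹⁾ or (1+5x)⁵ U⁽⁰⁾.
  module Operator (V : FPS → FPS) (V-cong : ∀ {g h} → g ≈ h → V g ≈ V h) (V-⊕ : ∀ g h → V (g ⊕ h) ≈ V g ⊕ V h)
    (V-↑ : ∀ h g → V (↑ h ⊛ g) ≈ h ⊛ V g) (initial : ∀ j → j < 5 → Good j (V (x ^ j))) where

    at-X : ∀ c → at c X ≈ ↑ at c x
    at-X []      = F.sym (stretch-constF 5 (+ 0))
    at-X (c ∷ p) = F.sym (F.trans (stretch-⊕ 5 (constF c) (x ⊛ at p x)) (F.+-cong (stretch-constF 5 c)
      (F.trans (stretch-⊛ 5 x (at p x)) (F.*-congˡ {X} (F.sym (at-X p))))))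

    V-zero : ∀ {g} → g ≈ zeroF → V g ≈ zeroF
    V-zero {g} p = F.trans (V-cong (F.trans p (F.sym (F.trans (F.*-congʳ {g} (stretch-constF 5 (+ 0))) (F.zeroˡ g)))))
        (F.trans (V-↑ zeroF g) (F.zeroˡ (V g)))

    -- Row i is a polynomial in X multiplying x^i g; `V-↑` moves it out of V as the same polynomial
    -- in x, leaving V(x^i g) to the hypothesis.
    good-rows : ∀ n d i ps {g} → Weights₂ d i ps → (∀ j → j < length ps → Good (n + (i + j)) (V (x ^ j ⊛ g))) →
                Good (n + d) (V (⟦ ps ⟧ᴾ xX ⊛ g))
    good-rows n d i []       {g} _        _ = [] , V-zero (F.zeroˡ g) , tt
    good-rows n d i (p ∷ ps) {g} (w , ws) G = good-cong
      (F.trans (V-cong (F.trans (F.*-congʳ {g} (F.+-congʳ {x ⊛ ⟦ ps ⟧ᴾ xX} (at-X p)))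
          (solve 4 (λ c x t g → (c :+ x :* t) :* g , c :* g :+ t :* (x :* g)) refl (↑ at p x) x (⟦ ps ⟧ᴾ xX) g)))
        (F.trans (V-⊕ (↑ at p x ⊛ g) (⟦ ps ⟧ᴾ xX ⊛ (x ⊛ g))) (F.+-congʳ {V (⟦ ps ⟧ᴾ xX ⊛ (x ⊛ g))}
          (F.trans (V-↑ (at p x) g) (F.sym (F.*-identityˡ (at p x ⊛ V g)))))))
      (good-⊕ (good-row n d i 0 p w (good-cong (V-cong (F.sym (F.*-identityˡ g)))
          (subst (λ k → Good (n + k) (V (x ^ 0 ⊛ g))) (ℕₚ.+-identityʳ i) (G 0 (s≤s z≤n)))))
        (good-rows n d (suc i) ps ws (λ j j< → good-cong (V-cong (solve 3 (λ J x g → J :* (x :* g) , x :* J :* g) refl (x ^ j) x g))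
          (subst (λ k → Good (n + k) (V (x ^ suc j ⊛ g))) (ℕₚ.+-suc i j) (G (suc j) (s≤s j<))))))

    x^-+ : ∀ n j → x ^ (n + j) ≈ x ^ j ⊛ x ^ n
    x^-+ n j = F.trans (^-homo-* x n j) (F.*-comm (x ^ n) (x ^ j))

    -- Induction on a window of five consecutive exponents. Moving it up by one only adds n + 5,
    -- which `x⁵≈` reduces to the five exponents already treated.
    good-five : ∀ n j → j < 5 → Good (n + j) (V (x ^ (n + j)))
    good-five zero    j j<5 = initial j j<5
    good-five (suc n) j j<5 with ℕₚ.m≤n⇒m<n∨m≡n j<5
    ... | inj₁ (s≤s j<4) = subst (λ k → Good k (V (x ^ k))) (ℕₚ.+-suc n j) (good-five n (suc j) (s≤s j<4))
    ... | inj₂ refl = subst (λ k → Good k (V (x ^ k))) (ℕₚ.+-suc n 4) (good-cong (V-cong (F.trans (x^-+ n 5) (F.*-congʳ {x ^ n} x⁵≈)))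
      (good-rows n 5 0 recursion recursion-weights (λ i i<5 → good-cong (V-cong (F.sym (x^-+ n i))) (good-five n i i<5))))

    -- `Q` has weight d = 0, so a factor `Q` does not change the bounds for m. Its powers of x raise
    -- m in the induction hypothesis, which is therefore needed for all m.
    good-Q : ∀ n m → Good m (V (x ^ m ⊛ ⟦ Q ⟧ᴾ xX ^ n))
    good-Q zero    m = good-cong (V-cong (F.*-identityʳ (x ^ m))) (subst (λ k → Good k (V (x ^ k))) (ℕₚ.+-identityʳ m)
        (good-five m 0 (s≤s z≤n)))
    good-Q (suc n) m = good-cong (V-cong (solve 3 (λ m Q P → m :* (Q :* P) , Q :* (m :* P)) refl (x ^ m) (⟦ Q ⟧ᴾ xX) (⟦ Q ⟧ᴾ xX ^ n)))
      (subst (λ k → Good k (V (⟦ Q ⟧ᴾ xX ⊛ (x ^ m ⊛ ⟦ Q ⟧ᴾ xX ^ n)))) (ℕₚ.+-identityʳ m) (good-rows m 0 0 Q Q-weights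
        (λ j j< → good-cong (V-cong (F.trans (F.sym (F.*-assoc (x ^ j) (x ^ m) (⟦ Q ⟧ᴾ xX ^ n)))
            (F.*-congʳ {⟦ Q ⟧ᴾ xX ^ n} (F.sym (x^-+ m j))))) (good-Q n (m + j)))))

-- Reading off the coefficient functions

nth : List ℤ → ℕ → ℤ
nth []       _       = + 0
nth (c ∷ cs) zero    = c
nth (c ∷ cs) (suc i) = nth cs i

sumF-cong : ∀ {s t : ℕ → FPS} n → (∀ r → s r ≈ t r) → sumF s n ≈ sumF t n
sumF-cong zero    p = p 0
sumF-cong (suc n) p = F.+-cong (sumF-cong n p) (p (suc n))

sumF-suc : ∀ (t : ℕ → FPS) n → sumF t (suc n) ≈ t 0 ⊕ sumF (λ r → t (suc r)) n
sumF-suc t zero    = F.refl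
sumF-suc t (suc n) = F.trans (F.+-congʳ {t (suc (suc n))} (sumF-suc t n)) (F.+-assoc (t 0) (sumF (λ r → t (suc r)) n) (t (suc (suc n))))

sumF-⊛ : ∀ g (t : ℕ → FPS) n → g ⊛ sumF t n ≈ sumF (λ r → g ⊛ t r) n
sumF-⊛ g t zero    = F.refl
sumF-⊛ g t (suc n) = F.trans (F.distribˡ g (sumF t n) (t (suc n))) (F.+-congʳ {g ⊛ t (suc n)} (sumF-⊛ g t n))

sumF-truncate : ∀ (t : ℕ → FPS) B k → (∀ r → B < r → t r ≈ zeroF) → sumF t (k + B) ≈ sumF t B
sumF-truncate t B zero    z = F.refl
sumF-truncate t B (suc k) z = F.trans (F.+-cong (sumF-truncate t B k z) (z (suc (k + B)) (s≤s (ℕₚ.m≤n+m B k)))) (F.+-identityʳ (sumF t B))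

sumF-drop : ∀ (t : ℕ → FPS) lo B → (∀ r → r < lo → t r ≈ zeroF) → sumF t (lo + B) ≈ sumF (λ i → t (lo + i)) B
sumF-drop t zero     B z = F.refl
sumF-drop t (suc lo) B z = F.trans (sumF-suc t (lo + B)) (F.trans (F.+-cong (z 0 (s≤s z≤n))
    (sumF-drop (λ r → t (suc r)) lo B (λ r r< → z (suc r) (s≤s r<))))
  (F.+-identityˡ (sumF (λ i → t (suc lo + i)) B)))

scale-zero : ∀ {c} g → c ≡ + 0 → scale c g ≈ zeroF
scale-zero g refl k = trans (ℤₚ.*-zeroˡ (g k)) (sym (zeroF-at k))

at-sum : ∀ cs k → at cs x ≈ sumF (λ r → scale (nth cs r) (pow x r)) (length cs + k)
at-sum []       k = F.sym (vanishing k)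
  where
  vanishing : ∀ k → sumF (λ r → scale (+ 0) (pow x r)) k ≈ zeroF
  vanishing zero    = scale-zero oneF refl
  vanishing (suc k) = F.trans (F.+-cong (vanishing k) (scale-zero (pow x (suc k)) refl)) (F.+-identityˡ zeroF)
at-sum (c ∷ cs) k = F.trans (F.+-cong (F.trans (F.sym (F.*-identityʳ (constF c))) (constF-⊛ c oneF)) (F.trans (F.*-congˡ {x} (at-sum cs k))
    (F.trans (sumF-⊛ x (λ r → scale (nth cs r) (pow x r)) (length cs + k)) (sumF-cong (length cs + k) (λ r → move (nth cs r) (pow x r))))))
  (F.sym (sumF-suc (λ r → scale (nth (c ∷ cs) r) (pow x r)) (length cs + k)))
  where
  move : ∀ c g → x ⊛ scale c g ≈ scale c (x ⊛ g)
  move c g = F.trans (F.*-comm x (scale c g)) (F.trans (scale-⊛ c g x) (λ k → cong (c ℤ.*_) (F.*-comm g x k)))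

module Extract (π : ℕ → ℕ → ℕ) (π-shift : π-Shift π) (o : ℕ) where

  open Admissible π π-shift o

  -- The value of h is the quotient already contained in the divisibility witness.
  quot : ∀ {m r c} → Coeff m r c → ℤ
  quot (inj₁ _)                    = + 0
  quot (inj₂ (_ , ℤ∣.divides d _)) = d

  quots : ∀ {m r} cs → Coeffs m r cs → ℕ → ℤ
  quots []       _        _       = + 0
  quots (c ∷ cs) (u , us) zero    = quot u
  quots (c ∷ cs) (u , us) (suc i) = quots cs us i

  nth-quots : ∀ {m} r cs (us : Coeffs m r cs) i → nth cs i ≡ quots cs us i ℤ.* 5^ π m (r + i)
  nth-quots {m} r []       _        i = sym (ℤₚ.*-zeroˡ (5^ π m (r + i)))
  nth-quots {m} r (c ∷ cs) (inj₁ refl , us) zero = sym (ℤₚ.*-zeroˡ (5^ π m (r + 0)))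
  nth-quots {m} r (c ∷ cs) (inj₂ (_ , ℤ∣.divides d eq) , us) zero = trans eq (cong (λ k → d ℤ.* 5^ π m k) (sym (ℕₚ.+-identityʳ r)))
  nth-quots {m} r (c ∷ cs) (_ , us) (suc i) = trans (nth-quots (suc r) cs us i)
      (cong (λ k → quots cs us i ℤ.* 5^ π m k) (sym (ℕₚ.+-suc r i)))

  quots-low : ∀ {m} r cs (us : Coeffs m r cs) i → 5 * (r + i) < m + o → quots cs us i ≡ + 0
  quots-low r []       _        i low = refl
  quots-low r (c ∷ cs) (inj₁ _ , us) zero low = refl
  quots-low {m} r (c ∷ cs) (inj₂ (lo , ℤ∣.divides _ _) , us) zero low = contradiction
      (subst (λ k → m + o ≤ 5 * k) (sym (ℕₚ.+-identityʳ r)) lo) (ℕₚ.<⇒≱ low)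
  quots-low {m} r (c ∷ cs) (_ , us) (suc i) low = quots-low (suc r) cs us i (subst (λ k → 5 * k < m + o) (ℕₚ.+-suc r i) low)

  quots-high : ∀ {m} r cs (us : Coeffs m r cs) i → length cs ≤ i → quots cs us i ≡ + 0
  quots-high r []       _        i       _        = refl
  quots-high r (c ∷ cs) (_ , us) (suc i) (s≤s le) = quots-high (suc r) cs us i le

  coefficients : (∀ m n → ∃[ g ] Good m g) → ℤ → ℤ → ℤ → ℤ
  coefficients G (+ m) (+ n) (+ r) = quots (proj₁ (proj₂ (G m n))) (proj₂ (proj₂ (proj₂ (G m n)))) r
  coefficients G _ _ _ = + 0

  coefficients-finite : ∀ G → FinSupp (coefficients G)
  coefficients-finite G (+ m) (+ n) = length (proj₁ (proj₂ (G m n))) , bound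
    where
    bound : SuppBound (coefficients G) (+ m) (+ n) (length (proj₁ (proj₂ (G m n))))
    bound (+ r)    B<r = quots-high 0 (proj₁ (proj₂ (G m n))) _ r (ℕₚ.<⇒≤ B<r)
    bound -[1+ r ] B<r = refl
  coefficients-finite G (+ m) -[1+ n ]  = 0 , λ _ _ → refl
  coefficients-finite G -[1+ m ] (+ n)    = 0 , λ _ _ → refl
  coefficients-finite G -[1+ m ] -[1+ n ] = 0 , λ _ _ → refl

  -- B is any bound for the support, possibly smaller than the length of the list. Both sums are
  -- compared at a common larger length; terms beyond lo + B and below lo vanish.
  coefficients-sum : ∀ G lo m n B → (∀ r → r < lo → 5 * r < m + o) → SuppBound (coefficients G) (+ m) (+ n) B →
                     proj₁ (G m n) ≈ hSum (coefficients G) π lo m n B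
  coefficients-sum G lo m n B low supp = F.trans (proj₁ (proj₂ (proj₂ (G m n))))
      (F.trans (at-sum cs (lo + B)) (F.trans (sumF-cong (length cs + (lo + B))
      (λ r k → cong (λ c → scale c (pow x r) k) (nth-quots 0 cs us r)))
    (F.trans (sumF-truncate t (lo + B) (length cs) (λ r r> → zero-term r (supp (+ r) (ℕₚ.≤-<-trans (ℕₚ.m≤n+m B lo) r>))))
    (sumF-drop t lo B (λ r r< → zero-term r (quots-low 0 cs us r (low r r<)))))))
    where
    cs = proj₁ (proj₂ (G m n))
    us = proj₂ (proj₂ (proj₂ (G m n)))
    t : ℕ → FPS
    t r = scale (quots cs us r ℤ.* 5^ π m r) (pow x r)
    zero-term : ∀ r → quots cs us r ≡ + 0 → t r ≈ zeroF
    zero-term r z = scale-zero (pow x r) (trans (cong (ℤ._* 5^ π m r) z) (ℤₚ.*-zeroˡ (5^ π m r)))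

-- Clearing denominators and conclusion

1+5x≈ : onePlus5x ≈ oneF ⊕ constF (+ 5) ⊛ x
1+5x≈ = F.+-congˡ {oneF} (F.sym (constF-⊛ (+ 5) x))

1+5X≈ : ↑ onePlus5x ≈ oneF ⊕ constF (+ 5) ⊛ X
1+5X≈ = F.trans (stretch-cong 5 1+5x≈) (stretch-eval 5 {ρ = x ∷ []} {ρ′ = X ∷ []} (F.refl {X} ∷ []) (:1 :+ con (+ 5) :* var zero))

pow-0 : ∀ n → pow onePlus5x n 0 ≡ + 1
pow-0 n = trans (pow≈^ onePlus5x n 0) (^-0 onePlus5x n refl)

inv-1+5x : ∀ n → inv (pow onePlus5x n) ≈ ⟦ Q ⟧ᴾ xX ^ n ⊛ ↑ inv (pow onePlus5x (5 * n))
inv-1+5x n = F.sym (inv-unique (pow onePlus5x n) (Qⁿ ⊛ ↑ inv (pow onePlus5x (5 * n))) (pow-0 n)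
    (F.trans (F.sym (F.*-assoc (pow onePlus5x n) Qⁿ I)) (F.trans (F.*-congʳ {I}
    (F.trans (F.trans (F.*-congʳ {Qⁿ} (pow≈^ onePlus5x n)) (F.trans (F.*-comm (onePlus5x ^ n) Qⁿ)
        (F.sym (^-distrib-* (⟦ Q ⟧ᴾ xX) onePlus5x n))))
    (F.trans (^-congˡ n (F.trans (F.*-congˡ {⟦ Q ⟧ᴾ xX} 1+5x≈) (F.trans Q⊛1+5x (^-congˡ 5 (F.sym 1+5X≈)))))
        (F.trans (^-assocʳ (↑ onePlus5x) 5 n)
    (F.trans (F.sym (stretch-^ 5 onePlus5x (5 * n))) (stretch-cong 5 (F.sym (pow≈^ onePlus5x (5 * n)))))))))
  (F.trans (F.sym (stretch-⊛ 5 (pow onePlus5x (5 * n)) (inv (pow onePlus5x (5 * n)))))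
      (F.trans (stretch-cong 5 (⊛-inv (pow onePlus5x (5 * n)) (pow-0 (5 * n)))) (stretch-constF 5 (+ 1)))))))
  where
  Qⁿ I : FPS
  Qⁿ = ⟦ Q ⟧ᴾ xX ^ n
  I = ↑ inv (pow onePlus5x (5 * n))

xFrac≈ : ∀ m n → xFrac m n ≈ ↑ inv (pow onePlus5x (5 * n)) ⊛ (x ^ m ⊛ ⟦ Q ⟧ᴾ xX ^ n)
xFrac≈ m n = F.trans (F.*-cong (pow≈^ x m) (inv-1+5x n)) (solve 3 (λ m Q i → m :* (Q :* i) , i :* (m :* Q)) refl (x ^ m) (⟦ Q ⟧ᴾ xX ^ n)
    (↑ inv (pow onePlus5x (5 * n))))

U5-↑ : ∀ h g → U5 (↑ h ⊛ g) ≈ h ⊛ U5 g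
U5-↑ = comp-stretch⊛ 0 (s≤s z≤n)

-- The factor (1 + 5x)⁵ makes V₀(x^j) a polynomial in x; the power 0 in `V₁` only keeps the shape of
-- `U5-value`.
V₁ V₀ : FPS → FPS
V₁ g = onePlus5x ^ 0 ⊛ U5 g
V₀ g = onePlus5x ^ 5 ⊛ U5 (Φ ⊛ g)

module Admissible₁ = Admissible π₁ π₁-shift 0
module Admissible₀ = Admissible π₀ π₀-shift 4

initial₁ : ∀ j → j < 5 → Admissible₁.Good j (V₁ (x ^ j))
initial₁ 0 j< = P₁ 0 , U1-initial 0 j< , from-yes (Admissible₁.coeffs? 0 0 (P₁ 0))
initial₁ 1 j< = P₁ 1 , U1-initial 1 j< , from-yes (Admissible₁.coeffs? 1 0 (P₁ 1))
initial₁ 2 j< = P₁ 2 , U1-initial 2 j< , from-yes (Admissible₁.coeffs? 2 0 (P₁ 2))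
initial₁ 3 j< = P₁ 3 , U1-initial 3 j< , from-yes (Admissible₁.coeffs? 3 0 (P₁ 3))
initial₁ 4 j< = P₁ 4 , U1-initial 4 j< , from-yes (Admissible₁.coeffs? 4 0 (P₁ 4))
initial₁ (suc (suc (suc (suc (suc _))))) (s≤s (s≤s (s≤s (s≤s (s≤s ())))))

initial₀ : ∀ j → j < 5 → Admissible₀.Good j (V₀ (x ^ j))
initial₀ 0 j< = P₀ 0 , U0-initial 0 j< , from-yes (Admissible₀.coeffs? 0 0 (P₀ 0))
initial₀ 1 j< = P₀ 1 , U0-initial 1 j< , from-yes (Admissible₀.coeffs? 1 0 (P₀ 1))
initial₀ 2 j< = P₀ 2 , U0-initial 2 j< , from-yes (Admissible₀.coeffs? 2 0 (P₀ 2))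
initial₀ 3 j< = P₀ 3 , U0-initial 3 j< , from-yes (Admissible₀.coeffs? 3 0 (P₀ 3))
initial₀ 4 j< = P₀ 4 , U0-initial 4 j< , from-yes (Admissible₀.coeffs? 4 0 (P₀ 4))
initial₀ (suc (suc (suc (suc (suc _))))) (s≤s (s≤s (s≤s (s≤s (s≤s ())))))

V₁-cong : ∀ {g h} → g ≈ h → V₁ g ≈ V₁ h
V₁-cong p = F.*-congˡ {onePlus5x ^ 0} (comp-cong 0 p)

V₁-⊕ : ∀ g h → V₁ (g ⊕ h) ≈ V₁ g ⊕ V₁ h
V₁-⊕ g h = F.distribˡ (onePlus5x ^ 0) (U5 g) (U5 h)

V₁-↑ : ∀ h g → V₁ (↑ h ⊛ g) ≈ h ⊛ V₁ g
V₁-↑ h g = F.trans (F.*-congˡ {onePlus5x ^ 0} (U5-↑ h g)) (solve 3 (λ y h u → y :* (h :* u) , h :* (y :* u)) refl (onePlus5x ^ 0) h (U5 g))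

V₀-cong : ∀ {g h} → g ≈ h → V₀ g ≈ V₀ h
V₀-cong p = F.*-congˡ {onePlus5x ^ 5} (comp-cong 0 (F.*-congˡ {Φ} p))

V₀-⊕ : ∀ g h → V₀ (g ⊕ h) ≈ V₀ g ⊕ V₀ h
V₀-⊕ g h = F.trans (F.*-congˡ {onePlus5x ^ 5} (comp-cong 0 (F.distribˡ Φ g h))) (F.distribˡ (onePlus5x ^ 5) (U5 (Φ ⊛ g)) (U5 (Φ ⊛ h)))

V₀-↑ : ∀ h g → V₀ (↑ h ⊛ g) ≈ h ⊛ V₀ g
V₀-↑ h g = F.trans (F.*-congˡ {onePlus5x ^ 5} (F.trans (comp-cong 0 (solve 3 (λ p h g → p :* (h :* g) , h :* (p :* g)) refl Φ (↑ h) g))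
    (U5-↑ h (Φ ⊛ g))))
  (solve 3 (λ y h u → y :* (h :* u) , h :* (y :* u)) refl (onePlus5x ^ 5) h (U5 (Φ ⊛ g)))

good₁ : ∀ m n → ∃[ g ] Admissible₁.Good m g
good₁ m n = V₁ (x ^ m ⊛ ⟦ Q ⟧ᴾ xX ^ n) , Admissible₁.Operator.good-Q V₁ V₁-cong V₁-⊕ V₁-↑ initial₁ n m

good₀ : ∀ m n → ∃[ g ] Admissible₀.Good m g
good₀ m n = V₀ (x ^ m ⊛ ⟦ Q ⟧ᴾ xX ^ n) , Admissible₀.Operator.good-Q V₀ V₀-cong V₀-⊕ V₀-↑ initial₀ n m

U1-xFrac : ∀ m n → U⁽¹⁾ (xFrac m n) ≈ inv (pow onePlus5x (5 * n)) ⊛ V₁ (x ^ m ⊛ ⟦ Q ⟧ᴾ xX ^ n)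
U1-xFrac m n = F.trans (comp-cong 0 (xFrac≈ m n)) (F.trans (U5-↑ (inv (pow onePlus5x (5 * n))) (x ^ m ⊛ ⟦ Q ⟧ᴾ xX ^ n))
  (F.*-congˡ {inv (pow onePlus5x (5 * n))} (F.sym (F.*-identityˡ (U5 (x ^ m ⊛ ⟦ Q ⟧ᴾ xX ^ n))))))

U0-xFrac : ∀ m n → U⁽⁰⁾ (xFrac m n) ≈ inv (pow onePlus5x (5 * n + 5)) ⊛ V₀ (x ^ m ⊛ ⟦ Q ⟧ᴾ xX ^ n)
U0-xFrac m n = F.trans (comp-cong 0 (F.trans (F.*-congˡ {Φ} (xFrac≈ m n))
    (solve 3 (λ p h g → p :* (h :* g) , h :* (p :* g)) refl Φ (↑ I) (x ^ m ⊛ ⟦ Q ⟧ᴾ xX ^ n))))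
  (F.trans (U5-↑ I (Φ ⊛ (x ^ m ⊛ ⟦ Q ⟧ᴾ xX ^ n))) (F.trans (F.*-congʳ {W} I≈) (F.*-assoc J (onePlus5x ^ 5) W)))
  where
  I J W : FPS
  I = inv (pow onePlus5x (5 * n))
  J = inv (pow onePlus5x (5 * n + 5))
  W = U5 (Φ ⊛ (x ^ m ⊛ ⟦ Q ⟧ᴾ xX ^ n))
  I≈ : I ≈ J ⊛ onePlus5x ^ 5
  I≈ = F.sym (inv-unique (pow onePlus5x (5 * n)) (J ⊛ onePlus5x ^ 5) (pow-0 (5 * n)) (F.trans
    (solve 3 (λ y J z → y :* (J :* z) , y :* z :* J) refl (pow onePlus5x (5 * n)) J (onePlus5x ^ 5))
    (F.trans (F.*-congʳ {J} (F.trans (F.*-congʳ {onePlus5x ^ 5} (pow≈^ onePlus5x (5 * n)))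
        (F.trans (F.sym (^-homo-* onePlus5x (5 * n) 5)) (F.sym (pow≈^ onePlus5x (5 * n + 5))))))
    (⊛-inv (pow onePlus5x (5 * n + 5)) (pow-0 (5 * n + 5))))))

-- (m + (o + 4)) / 5 is the ceiling of (m + o)/5; it computes to `lo₀ m` for o = 4 and to `lo₁ m`
-- for o = 0.
below-quotient : ∀ m o r → r < (m + (o + 4)) / 5 → 5 * r < m + o
below-quotient m o r r< = ℕₚ.+-cancelʳ-< 4 (5 * r) (m + o) (begin-strict
  5 * r + 4                         <⟨ ℕₚ.≤-reflexive (expand r) ⟩
  suc r * 5                           ≤⟨ ℕₚ.*-monoˡ-≤ 5 r< ⟩
  (m + (o + 4)) / 5 * 5           ≤⟨ m/n*n≤m (m + (o + 4)) 5 ⟩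
  m + (o + 4)                       ≡⟨ ℕₚ.+-assoc m o 4 ⟨
  m + o + 4                         ∎)
  where
  open ℕₚ.≤-Reasoning
  expand : ∀ r → suc (5 * r + 4) ≡ suc r * 5
  expand = solveℕ-∀

module Extract₁ = Extract π₁ π₁-shift 0
module Extract₀ = Extract π₀ π₀-shift 4

theorem5p5 : ∃[ h₀ ] ∃[ h₁ ] (FinSupp h₀ × FinSupp h₁ ×
    (∀ (m n B : ℕ) → SuppBound h₀ (+ m) (+ n) B →
    U⁽⁰⁾ (xFrac m n) ≈ inv (pow onePlus5x (5 * n + 5)) ⊛ hSum h₀ π₀ (lo₀ m) m n B) ×
    (∀ (m n B : ℕ) → SuppBound h₁ (+ m) (+ n) B →
    U⁽¹⁾ (xFrac m n) ≈ inv (pow onePlus5x (5 * n)) ⊛ hSum h₁ π₁ (lo₁ m) m n B))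
theorem5p5 = Extract₀.coefficients good₀ , Extract₁.coefficients good₁ , Extract₀.coefficients-finite good₀ , Extract₁.coefficients-finite
    good₁
  , (λ m n B supp → F.trans (U0-xFrac m n) (F.*-congˡ {inv (pow onePlus5x (5 * n + 5))}
      (Extract₀.coefficients-sum good₀ (lo₀ m) m n B (below-quotient m 4) supp)))
  , (λ m n B supp → F.trans (U1-xFrac m n) (F.*-congˡ {inv (pow onePlus5x (5 * n))}
      (Extract₁.coefficients-sum good₁ (lo₁ m) m n B (below-quotient m 0) supp)))
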